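{- Let $I_0$ be a finite open interval of $\mathbb{R}$ and let $f\in C^{(3)}(I_0)$ satisfy $$0<\inf_{x\in I_0}|f''(x)|\le\sup_{x\in I_0}|f''(x)|<\infty.$$ Let $I\subseteq I_0$ be an interval. Let $\psi$ be an approximating function satisfying $$\lim_{t\to+\infty}\psi(t)=\lim_{t\to+\infty}\frac{1}{t\psi(t)}=0.$$ Then there exists a constant $c>0$, depending on $I$, such that for all sufficiently large $Q$ $$N_f(Q,\psi,I)\ \ge\ c\,Q^2\,\psi(Q)\,|I|.$$
   Context: An approximating function is a decreasing function $\psi:\mathbb{R}^+\to\mathbb{R}^+$. Every point of $\mathbb{Q}^2$ is written uniquely as $\mathbf{p}/q=(p_1/q,p_2/q)$ with $(p_1,p_2)\in\mathbb{Z}^2$ and $q\in\mathbb{N}$ the smallest positive integer such that $q$ times the point lies in $\mathbb{Z}^2$. For $Q\in\mathbb{R}^+$, $$N_f(Q,\psi,I):=\#\{\mathbf{p}/q\in\mathbb{Q}^2: q\le Q,\ p_1/q\in I,\ |f(p_1/q)-p_2/q|<\psi(Q)/Q\}.$$ $|I|$ is the length of $I$; $C^{(3)}(I_0)$ is the set of 3-times continuously differentiable functions on $I_0$. -}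

module Defs where

open import Algebra.Bundles using (CommutativeRing; Semiring)
open import Data.Integer.Base as ℤ using (ℤ; +_; -[1+_])
open import Data.List.Base using (List; length)
open import Data.List.Membership.Propositional using (_∈_)
open import Data.List.Relation.Unary.Unique.Propositional using (Unique)
open import Data.Nat.Base as ℕ using (ℕ; suc)
open import Data.Product using (Σ-syntax; ∃; ∃-syntax; _×_; _,_; proj₁; proj₂)
open import Data.Rational.Base as ℚ using (ℚ; _/_)
open import Function.Bundles using (_⟶ₛ_; _⟨$⟩_; _⇔_)
open import Level using (0ℓ) renaming (suc to lsuc)
open import Relation.Binary.Core using (Rel)
open import Relation.Binary.Definitions using (tri<; tri≈; tri>; _Respects_)
open import Relation.Binary.PropositionalEquality.Core using (_≡_)
open import Relation.Binary.Structures using (IsStrictTotalOrder)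
open import Relation.Nullary.Negation.Core using (¬_)
open import Relation.Unary using (Pred; Satisfiable; _⊆_)
import Relation.Binary.Construct.StrictToNonStrict as NonStrict
import Algebra.Definitions.RawMonoid as RawMonoidDefs

HasCardinality : {A : Set} → Pred A 0ℓ → ℕ → Set
HasCardinality {A} P n =
  Σ[ xs ∈ List A ] Unique xs × (∀ x → x ∈ xs ⇔ P x) × length xs ≡ n

-- q · (x , y) ∈ ℤ²
_ClearsDenominatorsOf_ : ℕ → ℚ × ℚ → Set
q ClearsDenominatorsOf (x , y) =
  (∃[ p₁ ] (+ q / 1) ℚ.* x ≡ p₁ / 1) × (∃[ p₂ ] (+ q / 1) ℚ.* y ≡ p₂ / 1)

record IsDenominator (pt : ℚ × ℚ) (q : ℕ) : Set where
  field
    positive : 0 ℕ.< q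
    clears   : q ClearsDenominatorsOf pt
    least    : ∀ {r} → 0 ℕ.< r → r ClearsDenominatorsOf pt → q ℕ.≤ r

record OrderedField : Set (lsuc 0ℓ) where
  infix  4 _<_ _≤_
  infix  8 _⁻¹
  field
    commutativeRing : CommutativeRing 0ℓ 0ℓ

  open CommutativeRing commutativeRing public

  field
    _<_                : Rel Carrier 0ℓ
    isStrictTotalOrder : IsStrictTotalOrder _≈_ _<_
    0<1                : 0# < 1#
    +-monoˡ-<          : ∀ z {x y} → x < y → x + z < y + z
    *-pos              : ∀ {x y} → 0# < x → 0# < y → 0# < x * y
    -- Total, with an unspecified value at 0#.
    _⁻¹                : Carrier → Carrier
    ⁻¹-cong            : ∀ {x y} → x ≈ y → x ⁻¹ ≈ y ⁻¹
    ⁻¹-inverseʳ        : ∀ {x} → ¬ x ≈ 0# → x * x ⁻¹ ≈ 1#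

  _≤_ : Rel Carrier 0ℓ
  _≤_ = NonStrict._≤_ _≈_ _<_

  IsUpperBound IsLowerBound IsSupremum IsInfimum : Pred Carrier 0ℓ → Pred Carrier 0ℓ
  IsUpperBound P b = ∀ {x} → P x → x ≤ b
  IsLowerBound P b = ∀ {x} → P x → b ≤ x
  IsSupremum P s = IsUpperBound P s × (∀ {b} → IsUpperBound P b → s ≤ b)
  IsInfimum  P s = IsLowerBound P s × (∀ {b} → IsLowerBound P b → b ≤ s)

-- The real numbers, characterised up to isomorphism as a complete
-- ordered field.  Equality is a setoid equality, so that Cauchy
-- sequences and Dedekind cuts are admissible carriers.

record CompleteOrderedField : Set (lsuc 0ℓ) where
  field
    orderedField : OrderedField

  open OrderedField orderedField public

  field
    supremum : (P : Pred Carrier 0ℓ) → Satisfiable P → ∃ (IsUpperBound P) →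
               ∃ (IsSupremum P)

module RealAnalysis (R : CompleteOrderedField) where

  open CompleteOrderedField R public renaming (Carrier to ℝ)
  open IsStrictTotalOrder isStrictTotalOrder using (compare)

  infixl 7 _÷_
  _÷_ : ℝ → ℝ → ℝ
  x ÷ y = x * y ⁻¹

  ∣_∣ : ℝ → ℝ
  ∣ x ∣ with compare x 0#
  ... | tri< _ _ _ = - x
  ... | tri≈ _ _ _ = x
  ... | tri> _ _ _ = x

  fromℕ : ℕ → ℝ
  fromℕ n = RawMonoidDefs._×_ (Semiring.+-rawMonoid semiring) n 1#

  fromℤ : ℤ → ℝ
  fromℤ (+ n)    = fromℕ n
  fromℤ -[1+ n ] = - fromℕ (suc n)

  fromℚ : ℚ → ℝ
  fromℚ r = fromℤ (ℚ.↥ r) ÷ fromℕ (ℚ.↧ₙ r)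

  -- Functions on a subset of ℝ are represented by total functions whose
  -- values outside the subset are left unconstrained.
  Function : Set
  Function = setoid ⟶ₛ setoid

  Image : Pred ℝ 0ℓ → (ℝ → ℝ) → Pred ℝ 0ℓ
  Image D g y = ∃[ x ] D x × y ≈ g x

  ⟨_,_⟩ : ℝ → ℝ → Pred ℝ 0ℓ
  ⟨ a , b ⟩ x = a < x × x < b

  -- A bounded interval, possibly empty or a single point, with or without
  -- its endpoints.
  record IsInterval (I : Pred ℝ 0ℓ) : Set where
    field
      left right  : ℝ
      left≤right  : left ≤ right
      respects    : I Respects _≈_
      inner       : ⟨ left , right ⟩ ⊆ I
      outer       : ∀ {x} → I x → left ≤ x × x ≤ right

    len : ℝ
    len = right - left

  IsDerivativeOn : Pred ℝ 0ℓ → Function → Function → Set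
  IsDerivativeOn D f g =
    ∀ {x} → D x → ∀ {ε} → 0# < ε →
    ∃[ δ ] 0# < δ ×
      (∀ {y} → D y → 0# < ∣ y - x ∣ → ∣ y - x ∣ < δ →
       ∣ ((f ⟨$⟩ y) - (f ⟨$⟩ x)) ÷ (y - x) - (g ⟨$⟩ x) ∣ < ε)

  IsContinuousOn : Pred ℝ 0ℓ → Function → Set
  IsContinuousOn D f =
    ∀ {x} → D x → ∀ {ε} → 0# < ε →
    ∃[ δ ] 0# < δ ×
      (∀ {y} → D y → ∣ y - x ∣ < δ → ∣ (f ⟨$⟩ y) - (f ⟨$⟩ x) ∣ < ε)

  record C³ (D : Pred ℝ 0ℓ) (f : Function) : Set where
    field
      f′ f″ f‴      : Function
      f′-derivative : IsDerivativeOn D f f′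
      f″-derivative : IsDerivativeOn D f′ f″
      f‴-derivative : IsDerivativeOn D f″ f‴
      f‴-continuous : IsContinuousOn D f‴

  TendsToAt+∞ : (ℝ → ℝ) → ℝ → Set
  TendsToAt+∞ g l =
    ∀ {ε} → 0# < ε → ∃[ T ] 0# < T × (∀ {t} → T < t → ∣ g t - l ∣ < ε)

  -- "Decreasing" is taken in the weak sense.
  record IsApproximatingFunction (ψ : Function) : Set where
    field
      positive   : ∀ {t} → 0# < t → 0# < ψ ⟨$⟩ t
      decreasing : ∀ {s t} → 0# < s → s ≤ t → ψ ⟨$⟩ t ≤ ψ ⟨$⟩ s

  record NearCurve (f : Function) (Q : ℝ) (ψ : Function) (I : Pred ℝ 0ℓ)
                   (pt : ℚ × ℚ) : Set where
    field
      q             : ℕ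
      isDenominator : IsDenominator pt q
      q≤Q           : fromℕ q ≤ Q
      abscissa∈I    : I (fromℚ (proj₁ pt))
      close         : ∣ (f ⟨$⟩ fromℚ (proj₁ pt)) - fromℚ (proj₂ pt) ∣
                      < (ψ ⟨$⟩ Q) ÷ Q

  -- N_f(Q,ψ,I) = n
  N[_,_,_,_]≔_ : Function → ℝ → Function → Pred ℝ 0ℓ → ℕ → Set
  N[ f , Q , ψ , I ]≔ n = HasCardinality (NearCurve f Q ψ I) n

{-# OPTIONS --safe #-}

module Submission where

-- Replacing f by -f we may take f″ between two positive constants.  To x in
-- I and an integer vector (q , p₁ , p₂) attach B = q x - p₁ and
-- A = p₂ - q f(x) + f′(x) B, which is q times the vertical distance to the
-- tangent at x.  Dirichlet's theorem gives a vector with A ≪ ψ, B ≪ 1/(Qψ) and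
-- 1 ≤ q ≤ Q, and if moreover q ≫ Q, then (p₁/q , p₂/q) is within ψ/Q of the
-- curve and p₁/q within O(1/(Q²ψ)) of x.  So, for a grid of step ≍ 1/(Q²ψ), it suffices that
-- at half of the grid points no nonzero vector is tiny in all of A, B and q.
--
-- This is an instance of the quantitative nondivergence of Kleinbock and
-- Margulis.  Consider also the dual vectors n, with the values at x of
-- F = n₀ + n₁ x + n₂ f and F′.  The cross product of a short and a tiny vector
-- is a tiny dual vector orthogonal to the short one, the cross product of two
-- dual vectors orthogonal to u is a multiple of u, and a vector and a dual
-- vector that are short and tiny at the same point are orthogonal.  Hence on a
-- maximal interval on which some primitive u is short, either u is tiny or
-- there is a tiny dual v orthogonal to u; and on a maximal subinterval on
-- which such a v is short, v or u is the tiny one.  Both (A , B) and (F , F′)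
-- behave like a quadratic and its derivative, so a vector that is no longer
-- short next to an interval is tiny only on a small proportion of it.  A
-- greedy covering with overlaps of multiplicity two adds up the proportions.

-- Dirichlet's theorem alone gives no count: nothing keeps its denominators from being small, and
-- one rational point of small denominator serves many grid points at once. Excluding tiny vectors
-- is what forces a new point for each good grid point. With A, B, q bounded by ψ, K, Q, where ψ K Q
-- = 1, the dual vectors live in the box of sides 1/Q, 1/K, 1/ψ, and cross products pass from either
-- box to the other without loss of scale. So points and lines obey the same statements, and the
-- combinatorial argument is run once for both. Counting on a grid replaces measure: the step is so
-- small that a tiny vector is still short C steps away, and proportions of an interval become
-- numbers of grid points. The constants follow from the proportions: one vector is tiny on at most
-- 4 / C of an interval, the two levels with their two coverings raise this to 24 / C, so C = 48;
-- then C and the bounds on f″ alone determine ζ, independently of Q.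

open import Defs
open import Axiom.ExcludedMiddle using (ExcludedMiddle)
open import Algebra.Bundles using (CommutativeRing)
open import Data.Bool.Base using (Bool; true; false; _∧_; _∨_; not; if_then_else_; T)
open import Data.Empty using (⊥; ⊥-elim)
open import Data.Fin.Base as Fin using (Fin; toℕ; fromℕ<; combine)
import Data.Fin.Properties as FinP
open import Data.Integer.Base as ℤ using (ℤ; +_; -[1+_])
import Data.Integer.DivMod as ℤD
import Data.Integer.GCD as ℤG
import Data.Integer.Properties as ℤP
open import Data.List.Base as List using (List; []; _∷_; _++_; foldr; map; length; zipWith; concatMap; replicate; _∷ʳ_; upTo; cartesianProductWith)
open import Data.List.Membership.Propositional using (_∈_)
open import Data.List.Membership.Propositional.Properties using (∈-∃++; ∈-map⁺; ∈-++⁺ˡ; ∈-++⁺ʳ; ∈-++⁻; ∈-upTo⁺; ∈-cartesianProductWith⁺; ∈-concatMap⁺)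
import Data.List.Properties as ListP
open import Data.List.Relation.Unary.All as All using (All; []; _∷_)
import Data.List.Relation.Unary.AllPairs as AllPairs
open import Data.List.Relation.Unary.Any as Any using (here; there)
open import Data.List.Relation.Unary.Unique.Propositional using (Unique)
open import Data.Maybe.Base as Maybe using (Maybe; just; nothing)
open import Data.Nat.Base as ℕ using (ℕ; zero; suc)
import Data.Nat.Coprimality as Coprimality
import Data.Nat.Divisibility as ℕD
import Data.Nat.Properties as ℕP
open import Data.Product using (∃; ∃-syntax; _×_; _,_; proj₁; proj₂)
open import Data.Rational.Base as ℚ using (ℚ; mkℚ; _/_; ↥_; ↧_; ↧ₙ_)
import Data.Rational.Properties as ℚP
open import Data.Rational.Unnormalised.Base as ℚᵘ using (mkℚᵘ; *≡*)
import Data.Rational.Unnormalised.Properties as ℚᵘP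
open import Data.Sum.Base as Sum using (_⊎_; inj₁; inj₂; [_,_]; [_,_]′)
open import Data.Unit.Base using (tt)
open import Function.Bundles using (_⟨$⟩_; Func; mk⇔; Equivalence)
open import Level using (0ℓ)
open import Relation.Binary.Core using (Rel)
open import Relation.Binary.Definitions using (tri<; tri≈; tri>)
open import Relation.Binary.PropositionalEquality as ≡ using (_≡_; cong; cong₂; subst)
open import Relation.Binary.Structures using (IsStrictTotalOrder)
open import Relation.Nullary using (¬_; Dec; yes; no; does)
open import Relation.Unary using (Pred; _⊆_)

-- Certified linear arithmetic

-- Positivstellensatz certificates: a contradiction is found among given
-- facts, and hinted products of facts, by Fourier–Motzkin elimination over
-- the monomials; only the certificate is verified.

infixl 7 _:+_ _:-_
infixl 8 _:*_
infix  9 :-_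

-- `one` evaluates to `1#` itself and `con (+ n)` to the n-fold sum that defines `fromℕ n`, whose
-- last summand is `0#`; goals about `1#` and about numerals thus both match without conversion.
data Expr : Set where
  var         : ℕ → Expr
  con         : ℤ → Expr
  one         : Expr
  _:+_ _:*_ : Expr → Expr → Expr
  :-_         : Expr → Expr

_:-_ : Expr → Expr → Expr
a :- b = a :+ :- b

c : ℕ → Expr
c n = con (+ n)

Monomial : Set
Monomial = List ℕ

Poly : Set
Poly = List (Monomial × ℤ)

_≟ᴹ_ : (m m′ : Monomial) → Dec (m ≡ m′)
_≟ᴹ_ = ListP.≡-dec ℕP._≟_

insertVar : ℕ → Monomial → Monomial
insertVar i []      = i ∷ []
insertVar i (j ∷ m) = if i ℕ.≤ᵇ j then i ∷ j ∷ m else j ∷ insertVar i m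

_·ᴹ_ : Monomial → Monomial → Monomial
m ·ᴹ m′ = foldr insertVar m′ m

addTerm : Monomial × ℤ → Poly → Poly
addTerm t       []             = t ∷ []
addTerm (m , k) ((m′ , k′) ∷ p) with m ≟ᴹ m′
... | yes _ = (m′ , k ℤ.+ k′) ∷ p
... | no  _ = (m′ , k′) ∷ addTerm (m , k) p

addPoly : Poly → Poly → Poly
addPoly p q = foldr addTerm q p

mulTerm : Monomial × ℤ → Monomial × ℤ → Monomial × ℤ
mulTerm (m , k) (m′ , k′) = m ·ᴹ m′ , k ℤ.* k′

mulPoly : Poly → Poly → Poly
mulPoly p q = foldr (λ t → addPoly (map (mulTerm t) q)) [] p

norm : Expr → Poly
norm (var i)  = (i ∷ [] , + 1) ∷ []
norm (con k)  = ([] , k) ∷ []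
norm one      = ([] , + 1) ∷ []
norm (a :+ b) = addPoly (norm a) (norm b)
norm (a :* b) = mulPoly (norm a) (norm b)
norm (:- a)   = mulPoly (([] , -[1+ 0 ]) ∷ []) (norm a)

isZero : ℤ → Bool
isZero k = does (k ℤP.≟ + 0)

isZeroPoly : Poly → Bool
isZeroPoly []            = true
isZeroPoly ((_ , k) ∷ p) = isZero k ∧ isZeroPoly p

data Kind : Set where
  strict weak equal : Kind

-- `strict , e` is the fact 0 < e, and similarly for the other kinds.
Fact : Set
Fact = Kind × Expr

infix 6 _:<_ _:≤_ _:≈_

record Relation : Set where
  constructor rel
  field
    kind    : Kind
    lhs rhs : Expr

_:<_ _:≤_ _:≈_ : Expr → Expr → Relation
_:<_ = rel strict
_:≤_ = rel weak
_:≈_ = rel equal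

-- # n is the n-th hypothesis, counted from 0, and ¬g the negated goal.
data Hint : Set where
  #_   : ℕ → Hint
  ¬g   : Hint
  _⊠_  : Hint → Hint → Hint
  _⊡_  : Expr → Hint → Hint
  sq   : Expr → Hint

infixr 6 _⊠_ _⊡_
infix  7 #_

infix 1 _⊢_by_
infix 1 _⊢_

record Problem : Set where
  constructor _⊢_by_
  field
    hyps  : List Relation
    goal  : Relation
    hints : List Hint

_⊢_ : List Relation → Relation → Problem
hs ⊢ g = hs ⊢ g by []

toFact : Relation → Fact
toFact (rel k a b) = k , b :- a

trivial : Fact
trivial = equal , con (+ 0)

mulKind : Kind → Kind → Kind
mulKind equal _  = equal
mulKind strict equal = equal
mulKind weak equal = equal
mulKind strict strict = strict
mulKind strict weak = weak
mulKind weak strict = weak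
mulKind weak weak = weak

mulFact : Fact → Fact → Fact
mulFact (k , a) (l , b) = mulKind k l , a :* b

-- A factor of unknown sign preserves only equations; any other fact turns into the trivial one.
scaleFact : Expr → Fact → Fact
scaleFact a (equal , b) = equal , a :* b
scaleFact a (_  , _) = trivial

addKind : Kind → Kind → Kind
addKind strict _  = strict
addKind weak strict = strict
addKind weak _  = weak
addKind equal k  = k

addFact : Fact → Fact → Fact
addFact (k , a) (l , b) = addKind k l , a :+ b

nth : List Fact → ℕ → Fact
nth []       _       = trivial
nth (f ∷ fs) zero    = f
nth (f ∷ fs) (suc n) = nth fs n

derive : Fact → List Fact → Hint → Fact
derive g hs (# n)   = nth hs n
derive g hs ¬g      = g
derive g hs (a ⊠ b) = mulFact (derive g hs a) (derive g hs b)
derive g hs (e ⊡ a) = scaleFact e (derive g hs a)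
derive g hs (sq e)  = weak , e :* e

-- Total in the weight, so that soundness asks nothing of the search: an inequality whose weight is
-- not positive contributes the trivial fact.
multiple : ℤ → Fact → Fact
multiple k        (equal , a) = equal , con k :* a
multiple (+ zero) _        = trivial
multiple (+ k)    (l  , a) = l , con (+ k) :* a
multiple -[1+ _ ] _        = trivial

weightedSum : List ℤ → List Fact → Fact
weightedSum (k ∷ ks) (f ∷ fs) = addFact (multiple k f) (weightedSum ks fs)
weightedSum _        _        = trivial

absurd : Fact → Bool
absurd (strict , e) = isZeroPoly (norm e)
absurd _        = false

-- Fourier-Motzkin search for certificates

module Search where

  -- `vec` lists the coefficients over the monomials, and `cert` the weights with which the original
  -- facts combine to this row.
  record Row : Set where
    constructor row
    field
      vec    : List ℤ
      cert   : List ℤ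
      kind   : Kind

  coeff : Monomial → Poly → ℤ
  coeff m []            = + 0
  coeff m ((m′ , k) ∷ p) with m ≟ᴹ m′
  ... | yes _ = k
  ... | no  _ = coeff m p

  addMonomial : Monomial → List Monomial → List Monomial
  addMonomial m []        = m ∷ []
  addMonomial m (m′ ∷ ms) with m ≟ᴹ m′
  ... | yes _ = m′ ∷ ms
  ... | no  _ = m′ ∷ addMonomial m ms

  monomials : List Poly → List Monomial
  monomials = foldr (λ p ms → foldr (λ t → addMonomial (proj₁ t)) ms p) []

  units : ℕ → List (List ℤ)
  units zero    = []
  units (suc n) = (+ 1 ∷ replicate n (+ 0)) ∷ map (+ 0 ∷_) (units n)

  rows : List Fact → List Row
  rows fs = fromPolys (map (λ f → norm (proj₂ f)) fs)
    where
    make : List Monomial → Fact × Poly → List ℤ → Row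
    make ms ((k , _) , p) u = row (map (λ m → coeff m p) ms) u k
    fromMonomials : List Poly → List Monomial → List Row
    fromMonomials ps ms = zipWith (make ms) (zipWith _,_ fs ps) (units (length fs))
    fromPolys : List Poly → List Row
    fromPolys ps = fromMonomials ps (monomials ps)

  entry : ℕ → List ℤ → ℤ
  entry _       []       = + 0
  entry zero    (k ∷ _)  = k
  entry (suc n) (_ ∷ ks) = entry n ks

  comb : ℤ → Row → ℤ → Row → Row
  comb a (row v s k) b (row w t l) =
    row (zipWith _+′_ v w) (zipWith _+′_ s t) (addKind k l)
    where
    _+′_ : ℤ → ℤ → ℤ
    x +′ y = a ℤ.* x ℤ.+ b ℤ.* y

  sign : ℤ → ℤ
  sign (+ zero)  = + 0
  sign (+ suc _) = + 1
  sign -[1+ _ ]  = -[1+ 0 ]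

  firstNonzero : List ℤ → Maybe ℕ
  firstNonzero []       = nothing
  firstNonzero (k ∷ ks) = if isZero k then Maybe.map suc (firstNonzero ks) else just 0

  -- The row `r′` is multiplied by the positive number |x|, which keeps the direction of an
  -- inequality; the multiplier of the equation `r` may have either sign.
  pivot : Row → ℕ → List Row → List Row
  pivot r j = map (λ r′ → step (entry j (Row.vec r)) (entry j (Row.vec r′)) r′)
    where
    step : ℤ → ℤ → Row → Row
    step x y r′ = if isZero y then r′ else comb (+ ℤ.∣ x ∣) r′ (ℤ.- (sign x ℤ.* y)) r

  splitEqs : List Row → List Row × List Row
  splitEqs []       = [] , []
  splitEqs (r ∷ rs) with splitEqs rs | Row.kind r
  ... | es , is | equal = r ∷ es , is
  ... | es , is | _  = es , r ∷ is

  eliminateEqs : ℕ → List Row → List Row → List Row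
  eliminateEqs zero    _        is = is
  eliminateEqs (suc n) []       is = is
  eliminateEqs (suc n) (e ∷ es) is with firstNonzero (Row.vec e)
  ... | nothing = eliminateEqs n es is
  ... | just j  = eliminateEqs n (pivot e j es) (pivot e j is)

  data Sign : Set where
    pos neg zer : Sign

  signAt : ℕ → Row → Sign
  signAt j r with entry j (Row.vec r)
  ... | + zero  = zer
  ... | + suc _ = pos
  ... | -[1+ _ ] = neg

  select : Sign → ℕ → List Row → List Row
  select s j [] = []
  select s j (r ∷ rs) with s | signAt j r
  ... | pos | pos = r ∷ select s j rs
  ... | neg | neg = r ∷ select s j rs
  ... | zer | zer = r ∷ select s j rs
  ... | _   | _   = select s j rs

  -- The number of rows that eliminating this monomial creates; the cheapest monomial goes first,
  -- against the growth of the system.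
  cost : ℕ → List Row → ℕ
  cost j rs = length (select pos j rs) ℕ.* length (select neg j rs)

  cheapest : List ℕ → List Row → ℕ × ℕ → ℕ × ℕ
  cheapest []       rs best = best
  cheapest (j ∷ js) rs (b , v) = cheapest js rs (better (cost j rs))
    where
    better : ℕ → ℕ × ℕ
    better w = if w ℕ.<ᵇ v then (j , w) else (b , v)

  remove : ℕ → List ℕ → List ℕ
  remove j [] = []
  remove j (i ∷ is) = if j ℕ.≡ᵇ i then is else i ∷ remove j is

  allZero : List ℤ → Bool
  allZero []       = true
  allZero (k ∷ ks) = isZero k ∧ allZero ks

  useful : Row → Bool
  useful (row v _ strict) = true
  useful (row v _ _)  = not (allZero v)

  resolve : ℕ → List Row → List Row
  resolve j rs = List.filterᵇ useful
    (select zer j rs ++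
     concatMap (λ p → map (λ q → comb (+ ℤ.∣ entry j (Row.vec q) ∣) p (+ ℤ.∣ entry j (Row.vec p) ∣) q)
                          (select neg j rs))
               (select pos j rs))

  eliminate : ℕ → List ℕ → List Row → List Row
  eliminate zero    _         rs = rs
  eliminate (suc n) []        rs = rs
  eliminate (suc n) (j₀ ∷ js) rs = next (proj₁ (cheapest js rs (j₀ , cost j₀ rs)))
    where
    next : ℕ → List Row
    next j = eliminate n (remove j (j₀ ∷ js)) (resolve j rs)

  contradictory : List Row → List ℤ
  contradictory []                = []
  contradictory (row v s strict ∷ rs) = if allZero v then s else contradictory rs
  contradictory (_ ∷ rs)          = contradictory rs

  width : List Row → ℕ
  width []      = 0
  width (r ∷ _) = length (Row.vec r)

  search : ℕ → List Row × List Row → List ℤ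
  search n (es , is) = contradictory (eliminate n (List.upTo n) (eliminateEqs (length es) es is))

  certificate : List Fact → List ℤ
  certificate fs = fromRows (rows fs)
    where
    fromRows : List Row → List ℤ
    fromRows rs = search (width rs) (splitEqs rs)

open Search public using (certificate)

facts : Problem → Fact → List Fact
facts (hs ⊢ _ by ts) g = (strict , one) ∷ g ∷ map toFact hs ++ map (derive g (map toFact hs)) ts

refutes : Problem → Fact → Bool
refutes p g = check (facts p g)
  where
  check : List Fact → Bool
  check fs = absurd (weightedSum (certificate fs) fs)

provable : Problem → Bool
provable p@(_ ⊢ rel strict a b by _) = refutes p (weak , a :- b)
provable p@(_ ⊢ rel weak a b by _) = refutes p (strict , a :- b)
provable p@(_ ⊢ rel equal a b by _) =
  isZeroPoly (norm (a :- b)) ∨ (refutes p (strict , a :- b) ∧ refutes p (strict , b :- a))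

-- A problem is written as an Agda function of its variables, to which `applyVars` supplies `var 0`,
-- `var 1` and so on.
Curried : ℕ → Set
Curried zero    = Problem
Curried (suc n) = Expr → Curried n

applyVars : ∀ k n → Curried n → Problem
applyVars k zero    p = p
applyVars k (suc n) p = applyVars (suc k) n (p (var k))

-- Soundness of certificates over an ordered ring, to be used for both ℝ and ℤ

record OrderedRing : Set₁ where
  infix 4 _<_ _≤_
  field
    commutativeRing : CommutativeRing 0ℓ 0ℓ

  open CommutativeRing commutativeRing public

  field
    _<_                : Rel Carrier 0ℓ
    isStrictTotalOrder : IsStrictTotalOrder _≈_ _<_
    0<1                : 0# < 1#
    +-monoˡ-<          : ∀ z {x y} → x < y → x + z < y + z
    *-pos              : ∀ {x y} → 0# < x → 0# < y → 0# < x * y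

  _≤_ : Rel Carrier 0ℓ
  x ≤ y = x < y ⊎ x ≈ y

module Linear (O : OrderedRing) where

  open OrderedRing O hiding (zero)
  open IsStrictTotalOrder isStrictTotalOrder
    using (compare; <-respˡ-≈; <-respʳ-≈; irrefl) renaming (trans to <-trans)
  open import Algebra.Properties.Ring ring
    using (-0#≈0#; -‿involutive; -‿+-comm; -‿distribˡ-*; -‿distribʳ-*; -1*x≈-x; +-cancelʳ)
  open import Algebra.Properties.Semiring.Mult semiring
    using (×-homo-+; ×1-homo-*; ×-congʳ) renaming (_×_ to _×#_)
  open import Relation.Binary.Reasoning.Setoid setoid

  ⟦_⟧ℤ : ℤ → Carrier
  ⟦ + n ⟧ℤ      = n ×# 1#
  ⟦ -[1+ n ] ⟧ℤ = - (suc n ×# 1#)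

  x+-x : ∀ x → x + - x ≈ 0#
  x+-x = -‿inverseʳ

  +-interchange : ∀ a b x y → (a + b) + (x + y) ≈ (a + x) + (b + y)
  +-interchange a b x y = begin
    (a + b) + (x + y) ≈⟨ +-assoc a b (x + y) ⟩
    a + (b + (x + y)) ≈⟨ +-congˡ (+-assoc b x y) ⟨
    a + (b + x + y)   ≈⟨ +-congˡ (+-congʳ (+-comm b x)) ⟩
    a + (x + b + y)   ≈⟨ +-congˡ (+-assoc x b y) ⟩
    a + (x + (b + y)) ≈⟨ +-assoc a x (b + y) ⟨
    (a + x) + (b + y) ∎

  *-interchange : ∀ a b x y → (a * b) * (x * y) ≈ (a * x) * (b * y)
  *-interchange a b x y = begin
    (a * b) * (x * y) ≈⟨ *-assoc a b (x * y) ⟩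
    a * (b * (x * y)) ≈⟨ *-congˡ (*-assoc b x y) ⟨
    a * (b * x * y)   ≈⟨ *-congˡ (*-congʳ (*-comm b x)) ⟩
    a * (x * b * y)   ≈⟨ *-congˡ (*-assoc x b y) ⟩
    a * (x * (b * y)) ≈⟨ *-assoc a x (b * y) ⟨
    (a * x) * (b * y) ∎

  ⟦⟧-neg : ∀ i → ⟦ ℤ.- i ⟧ℤ ≈ - ⟦ i ⟧ℤ
  ⟦⟧-neg (+ zero)  = sym -0#≈0#
  ⟦⟧-neg (+ suc n) = begin - (suc n ×# 1#) ∎
  ⟦⟧-neg -[1+ n ]  = sym (-‿involutive _)

  ⟦⟧-⊖ : ∀ m n → ⟦ m ℤ.⊖ n ⟧ℤ ≈ m ×# 1# + - (n ×# 1#)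
  ⟦⟧-⊖ zero zero = sym (x+-x 0#)
  ⟦⟧-⊖ zero (suc n) = sym (+-identityˡ _)
  ⟦⟧-⊖ (suc m) zero = sym (trans (+-congˡ -0#≈0#) (+-identityʳ _))
  ⟦⟧-⊖ (suc m) (suc n) rewrite ℤP.[1+m]⊖[1+n]≡m⊖n m n = begin
    ⟦ m ℤ.⊖ n ⟧ℤ                           ≈⟨ ⟦⟧-⊖ m n ⟩
    m ×# 1# + - (n ×# 1#)                  ≈⟨ +-identityˡ _ ⟨
    0# + (m ×# 1# + - (n ×# 1#))           ≈⟨ +-congʳ (x+-x 1#) ⟨
    1# + - 1# + (m ×# 1# + - (n ×# 1#))    ≈⟨ +-interchange _ _ _ _ ⟩
    1# + m ×# 1# + (- 1# + - (n ×# 1#))    ≈⟨ +-congˡ (-‿+-comm 1# _) ⟩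
    1# + m ×# 1# + - (1# + n ×# 1#)        ∎

  ⟦⟧-+ : ∀ i j → ⟦ i ℤ.+ j ⟧ℤ ≈ ⟦ i ⟧ℤ + ⟦ j ⟧ℤ
  ⟦⟧-+ (+ m) (+ n) = ×-homo-+ 1# m n
  ⟦⟧-+ (+ m) -[1+ n ] = ⟦⟧-⊖ m (suc n)
  ⟦⟧-+ -[1+ m ] (+ n) = trans (⟦⟧-⊖ n (suc m)) (+-comm _ _)
  ⟦⟧-+ -[1+ m ] -[1+ n ] = begin
    - (suc (suc (m ℕ.+ n)) ×# 1#)       ≡⟨ cong (λ k → - (k ×# 1#)) (ℕP.+-suc (suc m) n) ⟨
    - ((suc m ℕ.+ suc n) ×# 1#)         ≈⟨ -‿cong (×-homo-+ 1# (suc m) (suc n)) ⟩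
    - (suc m ×# 1# + suc n ×# 1#)       ≈⟨ -‿+-comm _ _ ⟨
    - (suc m ×# 1#) + - (suc n ×# 1#)   ∎

  ⟦⟧-* : ∀ i j → ⟦ i ℤ.* j ⟧ℤ ≈ ⟦ i ⟧ℤ * ⟦ j ⟧ℤ
  ⟦⟧-* (+ m) (+ n) rewrite ≡.sym (ℤP.pos-* m n) = ×1-homo-* m n
  ⟦⟧-* (+ m) -[1+ n ] rewrite ≡.sym (ℤP.neg-distribʳ-* (+ m) (+ suc n)) = begin
    ⟦ ℤ.- (+ m ℤ.* + suc n) ⟧ℤ      ≈⟨ ⟦⟧-neg (+ m ℤ.* + suc n) ⟩
    - ⟦ + m ℤ.* + suc n ⟧ℤ          ≈⟨ -‿cong (⟦⟧-* (+ m) (+ suc n)) ⟩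
    - (m ×# 1# * suc n ×# 1#)       ≈⟨ -‿distribʳ-* _ _ ⟩
    m ×# 1# * - (suc n ×# 1#)       ∎
  ⟦⟧-* -[1+ m ] (+ n) rewrite ≡.sym (ℤP.neg-distribˡ-* (+ suc m) (+ n)) = begin
    ⟦ ℤ.- (+ suc m ℤ.* + n) ⟧ℤ      ≈⟨ ⟦⟧-neg (+ suc m ℤ.* + n) ⟩
    - ⟦ + suc m ℤ.* + n ⟧ℤ          ≈⟨ -‿cong (⟦⟧-* (+ suc m) (+ n)) ⟩
    - (suc m ×# 1# * n ×# 1#)       ≈⟨ -‿distribˡ-* _ _ ⟩
    - (suc m ×# 1#) * n ×# 1#       ∎
  ⟦⟧-* -[1+ m ] -[1+ n ] = begin
    (suc m ℕ.* suc n) ×# 1#           ≈⟨ ×1-homo-* (suc m) (suc n) ⟩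
    suc m ×# 1# * suc n ×# 1#         ≈⟨ -‿involutive _ ⟨
    - - (suc m ×# 1# * suc n ×# 1#)   ≈⟨ -‿cong (-‿distribʳ-* _ _) ⟩
    - (suc m ×# 1# * - (suc n ×# 1#)) ≈⟨ -‿distribˡ-* _ _ ⟩
    - (suc m ×# 1#) * - (suc n ×# 1#) ∎

  lookup : List Carrier → ℕ → Carrier
  lookup []      _       = 0#
  lookup (x ∷ ρ) zero    = x
  lookup (x ∷ ρ) (suc i) = lookup ρ i

  eval : List Carrier → Expr → Carrier
  eval ρ (var i)  = lookup ρ i
  eval ρ (con k)  = ⟦ k ⟧ℤ
  eval ρ one      = 1#
  eval ρ (a :+ b) = eval ρ a + eval ρ b
  eval ρ (a :* b) = eval ρ a * eval ρ b
  eval ρ (:- a)   = - eval ρ a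

  evalᴹ : List Carrier → Monomial → Carrier
  evalᴹ ρ []      = 1#
  evalᴹ ρ (i ∷ m) = lookup ρ i * evalᴹ ρ m

  evalᵀ : List Carrier → Monomial × ℤ → Carrier
  evalᵀ ρ (m , k) = ⟦ k ⟧ℤ * evalᴹ ρ m

  evalᴾ : List Carrier → Poly → Carrier
  evalᴾ ρ []      = 0#
  evalᴾ ρ (t ∷ p) = evalᵀ ρ t + evalᴾ ρ p

  module _ (ρ : List Carrier) where

    insertVar-correct : ∀ i m → evalᴹ ρ (insertVar i m) ≈ lookup ρ i * evalᴹ ρ m
    insertVar-correct i [] = refl
    insertVar-correct i (j ∷ m) with i ℕ.≤ᵇ j
    ... | true  = refl
    ... | false = begin
      lookup ρ j * evalᴹ ρ (insertVar i m)      ≈⟨ *-congˡ (insertVar-correct i m) ⟩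
      lookup ρ j * (lookup ρ i * evalᴹ ρ m)     ≈⟨ *-assoc _ _ _ ⟨
      lookup ρ j * lookup ρ i * evalᴹ ρ m       ≈⟨ *-congʳ (*-comm _ _) ⟩
      lookup ρ i * lookup ρ j * evalᴹ ρ m       ≈⟨ *-assoc _ _ _ ⟩
      lookup ρ i * (lookup ρ j * evalᴹ ρ m)     ∎

    ·ᴹ-correct : ∀ m m′ → evalᴹ ρ (m ·ᴹ m′) ≈ evalᴹ ρ m * evalᴹ ρ m′
    ·ᴹ-correct []      m′ = sym (*-identityˡ _)
    ·ᴹ-correct (i ∷ m) m′ = begin
      evalᴹ ρ (insertVar i (m ·ᴹ m′))           ≈⟨ insertVar-correct i (m ·ᴹ m′) ⟩
      lookup ρ i * evalᴹ ρ (m ·ᴹ m′)            ≈⟨ *-congˡ (·ᴹ-correct m m′) ⟩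
      lookup ρ i * (evalᴹ ρ m * evalᴹ ρ m′)     ≈⟨ *-assoc _ _ _ ⟨
      lookup ρ i * evalᴹ ρ m * evalᴹ ρ m′       ∎

    addTerm-correct : ∀ t p → evalᴾ ρ (addTerm t p) ≈ evalᵀ ρ t + evalᴾ ρ p
    addTerm-correct t [] = refl
    addTerm-correct (m , k) ((m′ , k′) ∷ p) with m ≟ᴹ m′
    ... | yes ≡.refl = begin
      ⟦ k ℤ.+ k′ ⟧ℤ * evalᴹ ρ m + evalᴾ ρ p                     ≈⟨ +-congʳ (*-congʳ (⟦⟧-+ k k′)) ⟩
      (⟦ k ⟧ℤ + ⟦ k′ ⟧ℤ) * evalᴹ ρ m + evalᴾ ρ p                ≈⟨ +-congʳ (distribʳ _ _ _) ⟩
      ⟦ k ⟧ℤ * evalᴹ ρ m + ⟦ k′ ⟧ℤ * evalᴹ ρ m + evalᴾ ρ p      ≈⟨ +-assoc _ _ _ ⟩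
      ⟦ k ⟧ℤ * evalᴹ ρ m + (⟦ k′ ⟧ℤ * evalᴹ ρ m + evalᴾ ρ p)    ∎
    ... | no _ = begin
      evalᵀ ρ (m′ , k′) + evalᴾ ρ (addTerm (m , k) p)           ≈⟨ +-congˡ (addTerm-correct (m , k) p) ⟩
      evalᵀ ρ (m′ , k′) + (evalᵀ ρ (m , k) + evalᴾ ρ p)         ≈⟨ +-assoc _ _ _ ⟨
      evalᵀ ρ (m′ , k′) + evalᵀ ρ (m , k) + evalᴾ ρ p           ≈⟨ +-congʳ (+-comm _ _) ⟩
      evalᵀ ρ (m , k) + evalᵀ ρ (m′ , k′) + evalᴾ ρ p           ≈⟨ +-assoc _ _ _ ⟩
      evalᵀ ρ (m , k) + (evalᵀ ρ (m′ , k′) + evalᴾ ρ p)         ∎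

    addPoly-correct : ∀ p q → evalᴾ ρ (addPoly p q) ≈ evalᴾ ρ p + evalᴾ ρ q
    addPoly-correct []      q = sym (+-identityˡ _)
    addPoly-correct (t ∷ p) q = begin
      evalᴾ ρ (addTerm t (addPoly p q))      ≈⟨ addTerm-correct t (addPoly p q) ⟩
      evalᵀ ρ t + evalᴾ ρ (addPoly p q)      ≈⟨ +-congˡ (addPoly-correct p q) ⟩
      evalᵀ ρ t + (evalᴾ ρ p + evalᴾ ρ q)    ≈⟨ +-assoc _ _ _ ⟨
      evalᵀ ρ t + evalᴾ ρ p + evalᴾ ρ q      ∎

    mulTerm-correct : ∀ t p → evalᴾ ρ (map (mulTerm t) p) ≈ evalᵀ ρ t * evalᴾ ρ p
    mulTerm-correct t [] = sym (zeroʳ _)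
    mulTerm-correct t@(m , k) ((m′ , k′) ∷ p) = begin
      ⟦ k ℤ.* k′ ⟧ℤ * evalᴹ ρ (m ·ᴹ m′) + evalᴾ ρ (map (mulTerm t) p)
        ≈⟨ +-cong (*-cong (⟦⟧-* k k′) (·ᴹ-correct m m′)) (mulTerm-correct t p) ⟩
      (⟦ k ⟧ℤ * ⟦ k′ ⟧ℤ) * (evalᴹ ρ m * evalᴹ ρ m′) + evalᵀ ρ t * evalᴾ ρ p
        ≈⟨ +-congʳ (*-interchange _ _ _ _) ⟩
      evalᵀ ρ t * evalᵀ ρ (m′ , k′) + evalᵀ ρ t * evalᴾ ρ p
        ≈⟨ distribˡ _ _ _ ⟨
      evalᵀ ρ t * (evalᵀ ρ (m′ , k′) + evalᴾ ρ p) ∎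

    mulPoly-correct : ∀ p q → evalᴾ ρ (mulPoly p q) ≈ evalᴾ ρ p * evalᴾ ρ q
    mulPoly-correct []      q = sym (zeroˡ _)
    mulPoly-correct (t ∷ p) q = begin
      evalᴾ ρ (addPoly (map (mulTerm t) q) (mulPoly p q))       ≈⟨ addPoly-correct (map (mulTerm t) q) _ ⟩
      evalᴾ ρ (map (mulTerm t) q) + evalᴾ ρ (mulPoly p q)       ≈⟨ +-cong (mulTerm-correct t q) (mulPoly-correct p q) ⟩
      evalᵀ ρ t * evalᴾ ρ q + evalᴾ ρ p * evalᴾ ρ q             ≈⟨ distribʳ _ _ _ ⟨
      (evalᵀ ρ t + evalᴾ ρ p) * evalᴾ ρ q                       ∎

    1×1≈1 : 1 ×# 1# ≈ 1#
    1×1≈1 = +-identityʳ 1#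

    norm-correct : ∀ e → evalᴾ ρ (norm e) ≈ eval ρ e
    norm-correct (var i) = begin
      1 ×# 1# * (lookup ρ i * 1#) + 0#     ≈⟨ +-identityʳ _ ⟩
      1 ×# 1# * (lookup ρ i * 1#)          ≈⟨ *-cong 1×1≈1 (*-identityʳ _) ⟩
      1# * lookup ρ i                      ≈⟨ *-identityˡ _ ⟩
      lookup ρ i                           ∎
    norm-correct (con k) = trans (+-identityʳ _) (*-identityʳ _)
    norm-correct one = trans (+-identityʳ _) (trans (*-identityʳ _) 1×1≈1)
    norm-correct (a :+ b) = trans (addPoly-correct (norm a) (norm b)) (+-cong (norm-correct a) (norm-correct b))
    norm-correct (a :* b) = trans (mulPoly-correct (norm a) (norm b)) (*-cong (norm-correct a) (norm-correct b))
    norm-correct (:- a) = begin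
      evalᴾ ρ (mulPoly (([] , -[1+ 0 ]) ∷ []) (norm a))         ≈⟨ mulPoly-correct (([] , -[1+ 0 ]) ∷ []) (norm a) ⟩
      (- (1 ×# 1#) * 1# + 0#) * evalᴾ ρ (norm a)                ≈⟨ *-congʳ (trans (+-identityʳ _) (*-identityʳ _)) ⟩
      - (1 ×# 1#) * evalᴾ ρ (norm a)                            ≈⟨ *-cong (-‿cong 1×1≈1) (norm-correct a) ⟩
      - 1# * eval ρ a                                           ≈⟨ -1*x≈-x _ ⟩
      - eval ρ a                                                ∎

    isZeroPoly-correct : ∀ p → T (isZeroPoly p) → evalᴾ ρ p ≈ 0#
    isZeroPoly-correct []            _ = refl
    isZeroPoly-correct ((m , k) ∷ p) z with k ℤP.≟ + 0
    ... | yes ≡.refl = trans (+-cong (zeroˡ _) (isZeroPoly-correct p z)) (+-identityˡ _)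

    isZeroPoly-sound : ∀ e → T (isZeroPoly (norm e)) → eval ρ e ≈ 0#
    isZeroPoly-sound e z = trans (sym (norm-correct e)) (isZeroPoly-correct (norm e) z)

  0<-+ : ∀ {x y} → 0# < x → 0# < y → 0# < x + y
  0<-+ {x} {y} 0<x 0<y = <-trans 0<y (<-respˡ-≈ (+-identityˡ y) (+-monoˡ-< y 0<x))

  0<-*ℕ : ∀ n → 0# < suc n ×# 1#
  0<-*ℕ zero    = <-respʳ-≈ (sym (+-identityʳ 1#)) 0<1
  0<-*ℕ (suc n) = 0<-+ 0<1 (0<-*ℕ n)

  Holds : List Carrier → Fact → Set
  Holds ρ (strict , e) = 0# < eval ρ e
  Holds ρ (weak , e) = 0# ≤ eval ρ e
  Holds ρ (equal , e) = 0# ≈ eval ρ e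

  pos≤ : ∀ {x y} → 0# ≤ x → 0# ≤ y → 0# ≤ x * y
  pos≤ (inj₁ p) (inj₁ q) = inj₁ (*-pos p q)
  pos≤ (inj₂ p) _        = inj₂ (trans (sym (zeroˡ _)) (*-congʳ p))
  pos≤ _        (inj₂ q) = inj₂ (trans (sym (zeroʳ _)) (*-congˡ q))

  module _ (ρ : List Carrier) where

    *-zeroˡ : ∀ {x} y → 0# ≈ x → 0# ≈ x * y
    *-zeroˡ y p = trans (sym (zeroˡ y)) (*-congʳ p)

    *-zeroʳ : ∀ x {y} → 0# ≈ y → 0# ≈ x * y
    *-zeroʳ x p = trans (sym (zeroʳ x)) (*-congˡ p)

    mulFact-sound : ∀ f g → Holds ρ f → Holds ρ g → Holds ρ (mulFact f g)
    mulFact-sound (equal , a) (l , b)  p q = *-zeroˡ _ p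
    mulFact-sound (strict , a) (equal , b) p q = *-zeroʳ _ q
    mulFact-sound (weak , a) (equal , b) p q = *-zeroʳ _ q
    mulFact-sound (strict , a) (strict , b) p q = *-pos p q
    mulFact-sound (strict , a) (weak , b) p q = pos≤ (inj₁ p) q
    mulFact-sound (weak , a) (strict , b) p q = pos≤ p (inj₁ q)
    mulFact-sound (weak , a) (weak , b) p q = pos≤ p q

    scaleFact-sound : ∀ e f → Holds ρ f → Holds ρ (scaleFact e f)
    scaleFact-sound e (equal , _) p = *-zeroʳ _ p
    scaleFact-sound e (strict , _) p = refl
    scaleFact-sound e (weak , _) p = refl

    +-zero : ∀ {x y} → 0# ≈ x → y ≈ x + y
    +-zero p = trans (sym (+-identityˡ _)) (+-congʳ p)

    addFact-sound : ∀ f g → Holds ρ f → Holds ρ g → Holds ρ (addFact f g)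
    addFact-sound (equal , _) (strict , _) p q        = <-respʳ-≈ (+-zero p) q
    addFact-sound (equal , _) (weak , _) p (inj₁ q) = inj₁ (<-respʳ-≈ (+-zero p) q)
    addFact-sound (equal , _) (weak , _) p (inj₂ q) = inj₂ (trans q (+-zero p))
    addFact-sound (equal , _) (equal , _) p q        = trans q (+-zero p)
    addFact-sound (strict , _) (strict , _) p q        = 0<-+ p q
    addFact-sound (strict , _) (weak , _) p (inj₁ q) = 0<-+ p q
    addFact-sound (strict , _) (weak , _) p (inj₂ q) = <-respʳ-≈ (trans (+-zero q) (+-comm _ _)) p
    addFact-sound (strict , _) (equal , _) p q        = <-respʳ-≈ (trans (+-zero q) (+-comm _ _)) p
    addFact-sound (weak , _) (strict , _) (inj₁ p) q = 0<-+ p q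
    addFact-sound (weak , _) (strict , _) (inj₂ p) q = <-respʳ-≈ (+-zero p) q
    addFact-sound (weak , _) (weak , _) (inj₁ p) (inj₁ q) = inj₁ (0<-+ p q)
    addFact-sound (weak , _) (weak , _) (inj₂ p) (inj₁ q) = inj₁ (<-respʳ-≈ (+-zero p) q)
    addFact-sound (weak , _) (weak , _) (inj₂ p) (inj₂ q) = inj₂ (trans q (+-zero p))
    addFact-sound (weak , _) (weak , _) (inj₁ p) (inj₂ q) = inj₁ (<-respʳ-≈ (trans (+-zero q) (+-comm _ _)) p)
    addFact-sound (weak , _) (equal , _) (inj₁ p) q = inj₁ (<-respʳ-≈ (trans (+-zero q) (+-comm _ _)) p)
    addFact-sound (weak , _) (equal , _) (inj₂ p) q = inj₂ (trans p (trans (+-zero q) (+-comm _ _)))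

    multiple-sound : ∀ k f → Holds ρ f → Holds ρ (multiple k f)
    multiple-sound k         (equal , a) p = *-zeroʳ _ p
    multiple-sound (+ zero)  (strict , a) p = refl
    multiple-sound (+ zero)  (weak , a) p = refl
    multiple-sound (+ suc k) (strict , a) p = *-pos (0<-*ℕ k) p
    multiple-sound (+ suc k) (weak , a) p = pos≤ (inj₁ (0<-*ℕ k)) p
    multiple-sound -[1+ _ ]  (strict , a) p = refl
    multiple-sound -[1+ _ ]  (weak , a) p = refl

    weightedSum-sound : ∀ ks fs → All (Holds ρ) fs → Holds ρ (weightedSum ks fs)
    weightedSum-sound []       []       ps       = refl
    weightedSum-sound []       (f ∷ fs) ps       = refl
    weightedSum-sound (k ∷ ks) []       ps       = refl
    weightedSum-sound (k ∷ ks) (f ∷ fs) (p ∷ ps) =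
      addFact-sound (multiple k f) (weightedSum ks fs) (multiple-sound k f p) (weightedSum-sound ks fs ps)

    absurd-sound : ∀ f → T (absurd f) → ¬ Holds ρ f
    absurd-sound (strict , e) z p = irrefl (sym (isZeroPoly-sound ρ e z)) p

    nth-sound : ∀ fs n → All (Holds ρ) fs → Holds ρ (nth fs n)
    nth-sound []       n       ps       = refl
    nth-sound (f ∷ fs) zero    (p ∷ ps) = p
    nth-sound (f ∷ fs) (suc n) (p ∷ ps) = nth-sound fs n ps

    square-nonneg : ∀ x → 0# ≤ x * x
    square-nonneg x with compare 0# x
    ... | tri< p _ _ = inj₁ (*-pos p p)
    ... | tri≈ _ p _ = inj₂ (*-zeroˡ x p)
    ... | tri> _ _ p = inj₁ (<-respʳ-≈ -x*-x (*-pos 0<-x 0<-x))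
      where
      0<-x : 0# < - x
      0<-x = <-respʳ-≈ (+-identityˡ _) (<-respˡ-≈ (x+-x x) (+-monoˡ-< (- x) p))
      -x*-x : - x * - x ≈ x * x
      -x*-x = trans (sym (-‿distribˡ-* x (- x))) (trans (-‿cong (sym (-‿distribʳ-* x x))) (-‿involutive _))

    derive-sound : ∀ g hs t → Holds ρ g → All (Holds ρ) hs → Holds ρ (derive g hs t)
    derive-sound g hs (# n)   p ps = nth-sound hs n ps
    derive-sound g hs ¬g      p ps = p
    derive-sound g hs (a ⊠ b) p ps =
      mulFact-sound (derive g hs a) (derive g hs b) (derive-sound g hs a p ps) (derive-sound g hs b p ps)
    derive-sound g hs (e ⊡ a) p ps = scaleFact-sound e (derive g hs a) (derive-sound g hs a p ps)
    derive-sound g hs (sq e)  p ps = square-nonneg (eval ρ e)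

    ++-All : ∀ {fs gs} → All (Holds ρ) fs → All (Holds ρ) gs → All (Holds ρ) (fs ++ gs)
    ++-All []       qs = qs
    ++-All (p ∷ ps) qs = p ∷ ++-All ps qs

    derived : ∀ g hs ts → Holds ρ g → All (Holds ρ) hs → All (Holds ρ) (map (derive g hs) ts)
    derived g hs []       p ps = []
    derived g hs (t ∷ ts) p ps = derive-sound g hs t p ps ∷ derived g hs ts p ps

    refutes-sound : ∀ P g → T (refutes P g) → All (Holds ρ) (map toFact (Problem.hyps P)) → ¬ Holds ρ g
    refutes-sound P@(hs ⊢ _ by ts) g z ps p =
      absurd-sound (weightedSum (certificate fs) fs) z
        (weightedSum-sound (certificate fs) fs
          (0<1 ∷ p ∷ ++-All ps (derived g (map toFact hs) ts p ps)))
      where fs = facts P g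

    Sat : Relation → Set
    Sat (rel strict a b) = eval ρ a < eval ρ b
    Sat (rel weak a b) = eval ρ a ≤ eval ρ b
    Sat (rel equal a b) = eval ρ a ≈ eval ρ b

    0<- : ∀ {x y} → x < y → 0# < y + - x
    0<- {x} {y} p = <-respˡ-≈ (x+-x x) (+-monoˡ-< (- x) p)

    0≈- : ∀ {x y} → x ≈ y → 0# ≈ y + - x
    0≈- {x} {y} p = trans (sym (x+-x x)) (+-congʳ p)

    toFact-sound : ∀ r → Sat r → Holds ρ (toFact r)
    toFact-sound (rel strict a b) p        = 0<- p
    toFact-sound (rel weak a b) (inj₁ p) = inj₁ (0<- p)
    toFact-sound (rel weak a b) (inj₂ p) = inj₂ (0≈- p)
    toFact-sound (rel equal a b) p        = 0≈- p

    Implies : List Relation → Set → Set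
    Implies []       G = G
    Implies (h ∷ hs) G = Sat h → Implies hs G

    intro : ∀ hs {G} → (All (Holds ρ) (map toFact hs) → G) → Implies hs G
    intro []       k = k []
    intro (h ∷ hs) k p = intro hs (λ ps → k (toFact-sound h p ∷ ps))

    -- Comparison is decidable, so a goal holds once the certificate refutes its negation; an
    -- equation that is no polynomial identity needs both strict inequalities refuted.
    provable-sound : ∀ P → T (provable P) → Implies (Problem.hyps P) (Sat (Problem.goal P))
    provable-sound P@(hs ⊢ rel strict a b by _) z = intro hs prove
      where
      prove : All (Holds ρ) (map toFact hs) → eval ρ a < eval ρ b
      prove ps with compare (eval ρ a) (eval ρ b)
      ... | tri< p _ _ = p
      ... | tri≈ _ p _ = ⊥-elim (refutes-sound P (weak , a :- b) z ps (inj₂ (0≈- (sym p))))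
      ... | tri> _ _ p = ⊥-elim (refutes-sound P (weak , a :- b) z ps (inj₁ (0<- p)))
    provable-sound P@(hs ⊢ rel weak a b by _) z = intro hs prove
      where
      prove : All (Holds ρ) (map toFact hs) → eval ρ a ≤ eval ρ b
      prove ps with compare (eval ρ a) (eval ρ b)
      ... | tri< p _ _ = inj₁ p
      ... | tri≈ _ p _ = inj₂ p
      ... | tri> _ _ p = ⊥-elim (refutes-sound P (strict , a :- b) z ps (0<- p))
    provable-sound P@(hs ⊢ rel equal a b by _) z = intro hs prove
      where
      prove : All (Holds ρ) (map toFact hs) → eval ρ a ≈ eval ρ b
      prove ps with isZeroPoly (norm (a :- b)) in e
      ... | true = +-cancelʳ (- eval ρ b) _ _
                     (trans (isZeroPoly-sound ρ (a :- b) (subst T (≡.sym e) tt)) (sym (x+-x (eval ρ b))))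
      ... | false with refutes P (strict , a :- b) in e₁ | refutes P (strict , b :- a) in e₂
      ...   | true | true with compare (eval ρ a) (eval ρ b)
      ...     | tri< p _ _ = ⊥-elim (refutes-sound P (strict , b :- a) (subst T (≡.sym e₂) tt) ps (0<- p))
      ...     | tri≈ _ p _ = p
      ...     | tri> _ _ p = ⊥-elim (refutes-sound P (strict , a :- b) (subst T (≡.sym e₁) tt) ps (0<- p))

  Statement : (n : ℕ) → List Carrier → Problem → Set
  Statement zero    ρ P = Implies ρ (Problem.hyps P) (Sat ρ (Problem.goal P))
  Statement (suc n) ρ P = ∀ x → Statement n (ρ ∷ʳ x) P

  prove : ∀ (n : ℕ) ρ P → T (provable P) → Statement n ρ P
  prove zero    ρ P z   = provable-sound ρ P z
  prove (suc n) ρ P z x = prove n (ρ ∷ʳ x) P z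

  -- The implicit argument evaluates to the unit type exactly when the search succeeds, so each use
  -- is checked by running the search on it.
  lin : ∀ n (p : Curried n) {_ : T (provable (applyVars 0 n p))} → Statement n [] (applyVars 0 n p)
  lin n p {z} = prove n [] (applyVars 0 n p) z

T-∧ : ∀ {a b} → T (a ∧ b) → T a × T b
T-∧ {true} {true} _ = tt , tt

ℤ-orderedRing : OrderedRing
ℤ-orderedRing = record
  { commutativeRing    = ℤP.+-*-commutativeRing
  ; _<_                = ℤ._<_
  ; isStrictTotalOrder = ℤP.<-isStrictTotalOrder
  ; 0<1                = ℤ.+<+ (ℕ.s≤s ℕ.z≤n)
  ; +-monoˡ-<          = λ z → ℤP.+-monoˡ-< z
  ; *-pos              = λ { {x = + suc m} {y = + suc n} _ _ → ℤ.+<+ (ℕ.s≤s ℕ.z≤n)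
                           ; {x = + zero} (ℤ.+<+ ()) _
                           ; {x = + suc m} {y = + zero} _ (ℤ.+<+ ()) }
  }

-- Linear arithmetic over ℕ, by reduction to ℤ

module ℕ-Linear where

  open ≡ using (refl)

  module ℤL = Linear ℤ-orderedRing

  evalℕ : List ℕ → Expr → ℕ
  evalℕ ρ (var i)        = look ρ i
    where
    look : List ℕ → ℕ → ℕ
    look []      _       = 0
    look (x ∷ ρ) zero    = x
    look (x ∷ ρ) (suc i) = look ρ i
  evalℕ ρ (con (+ n))    = n
  evalℕ ρ (con -[1+ _ ]) = 0
  evalℕ ρ one            = 1
  evalℕ ρ (a :+ b)       = evalℕ ρ a ℕ.+ evalℕ ρ b
  evalℕ ρ (a :* b)       = evalℕ ρ a ℕ.* evalℕ ρ b
  evalℕ ρ (:- a)         = 0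

  -- Without negation, evaluation in ℕ agrees with evaluation in ℤ; on all other expressions `evalℕ`
  -- has junk values.
  natural : Expr → Bool
  natural (var _)        = true
  natural (con (+ _))    = true
  natural (con -[1+ _ ]) = false
  natural one            = true
  natural (a :+ b)       = natural a ∧ natural b
  natural (a :* b)       = natural a ∧ natural b
  natural (:- _)         = false

  numeral : ∀ n → ℤL.⟦ + n ⟧ℤ ≡ + n
  numeral zero    = refl
  numeral (suc n) rewrite numeral n = refl

  eval≡ : ∀ ρ e → T (natural e) → ℤL.eval (map +_ ρ) e ≡ + evalℕ ρ e
  eval≡ []      (var i)       _ = refl
  eval≡ (x ∷ ρ) (var zero)    _ = refl
  eval≡ (x ∷ ρ) (var (suc i)) _ = eval≡ ρ (var i) tt
  eval≡ ρ (con (+ n)) _ = numeral n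
  eval≡ ρ one         _ = refl
  eval≡ ρ (a :+ b)    t = cong₂ ℤ._+_ (eval≡ ρ a (proj₁ (T-∧ t))) (eval≡ ρ b (proj₂ (T-∧ {natural a} t)))
  eval≡ ρ (a :* b)    t = ≡.trans
    (cong₂ ℤ._*_ (eval≡ ρ a (proj₁ (T-∧ t))) (eval≡ ρ b (proj₂ (T-∧ {natural a} t))))
    (≡.sym (ℤP.pos-* (evalℕ ρ a) (evalℕ ρ b)))

  naturalᴿ : Relation → Bool
  naturalᴿ (rel _ a b) = natural a ∧ natural b

  allNatural : List Relation → Bool
  allNatural []       = true
  allNatural (r ∷ rs) = naturalᴿ r ∧ allNatural rs

  -- Over the integers `a < b` amounts to `1 + a ≤ b`. The elimination reasons over the rationals
  -- and would miss what follows from integrality.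
  tightenHyp tightenGoal : Relation → Relation
  tightenHyp (rel strict a b)  = rel weak (one :+ a) b
  tightenHyp r             = r
  tightenGoal (rel weak a b) = rel strict a (one :+ b)
  tightenGoal r            = r

  nonneg : ℕ → List Relation
  nonneg zero    = []
  nonneg (suc n) = rel weak (c 0) (var n) ∷ nonneg n

  tighten : ℕ → Problem → Problem
  tighten n (hs ⊢ g by ts) = (map tightenHyp hs ++ nonneg n) ⊢ tightenGoal g by ts

  provableℕ : ℕ → Problem → Bool
  provableℕ n P = provable (tighten n P) ∧ (naturalᴿ (Problem.goal P) ∧ allNatural (Problem.hyps P))

  Satℕ : List ℕ → Relation → Set
  Satℕ ρ (rel strict a b) = evalℕ ρ a ℕ.< evalℕ ρ b
  Satℕ ρ (rel weak a b) = evalℕ ρ a ℕ.≤ evalℕ ρ b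
  Satℕ ρ (rel equal a b) = evalℕ ρ a ≡ evalℕ ρ b

  Impliesℕ : List ℕ → List Relation → Set → Set
  Impliesℕ ρ []       G = G
  Impliesℕ ρ (h ∷ hs) G = Satℕ ρ h → Impliesℕ ρ hs G

  ≤⇒ : ∀ {i j} → i ℕ.≤ j → OrderedRing._≤_ ℤ-orderedRing (+ i) (+ j)
  ≤⇒ {i} {j} p with ℕP.m≤n⇒m<n∨m≡n p
  ... | inj₁ q    = inj₁ (ℤ.+<+ q)
  ... | inj₂ refl = inj₂ refl

  lift-hyp : ∀ ρ r → T (naturalᴿ r) → Satℕ ρ r → ℤL.Sat (map +_ ρ) (tightenHyp r)
  lift-hyp ρ (rel strict a b) t p
    rewrite eval≡ ρ a (proj₁ (T-∧ t)) | eval≡ ρ b (proj₂ (T-∧ {natural a} t)) = ≤⇒ p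
  lift-hyp ρ (rel weak a b) t p
    rewrite eval≡ ρ a (proj₁ (T-∧ t)) | eval≡ ρ b (proj₂ (T-∧ {natural a} t)) = ≤⇒ p
  lift-hyp ρ (rel equal a b) t p
    rewrite eval≡ ρ a (proj₁ (T-∧ t)) | eval≡ ρ b (proj₂ (T-∧ {natural a} t)) = cong +_ p

  lower-goal : ∀ ρ r → T (naturalᴿ r) → ℤL.Sat (map +_ ρ) (tightenGoal r) → Satℕ ρ r
  lower-goal ρ (rel strict a b) t p
    rewrite eval≡ ρ a (proj₁ (T-∧ t)) | eval≡ ρ b (proj₂ (T-∧ {natural a} t)) with p
  ... | ℤ.+<+ q = q
  lower-goal ρ (rel weak a b) t p
    rewrite eval≡ ρ a (proj₁ (T-∧ t)) | eval≡ ρ b (proj₂ (T-∧ {natural a} t)) with p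
  ... | ℤ.+<+ q = ℕP.≤-pred q
  lower-goal ρ (rel equal a b) t p
    rewrite eval≡ ρ a (proj₁ (T-∧ t)) | eval≡ ρ b (proj₂ (T-∧ {natural a} t)) = ℤP.+-injective p

  apply-nonneg : ∀ ρ n {G} → ℤL.Implies (map +_ ρ) (nonneg n) G → G
  apply-nonneg ρ zero    g = g
  apply-nonneg ρ (suc n) g = apply-nonneg ρ n (g (var≥0 ρ n))
    where
    var≥0 : ∀ ρ n → ℤL.Sat (map +_ ρ) (rel weak (c 0) (var n))
    var≥0 []      n       = inj₂ refl
    var≥0 (x ∷ ρ) zero    = ≤⇒ ℕ.z≤n
    var≥0 (x ∷ ρ) (suc n) = var≥0 ρ n

  lower : ∀ ρ n hs {G H} → T (allNatural hs) → (G → H) →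
          ℤL.Implies (map +_ ρ) (map tightenHyp hs ++ nonneg n) G → Impliesℕ ρ hs H
  lower ρ n []       t k f   = k (apply-nonneg ρ n f)
  lower ρ n (h ∷ hs) t k f p =
    lower ρ n hs (proj₂ (T-∧ {naturalᴿ h} t)) k (f (lift-hyp ρ h (proj₁ (T-∧ t)) p))

  Statementℕ : (n : ℕ) → List ℕ → Problem → Set
  Statementℕ zero    ρ P = Impliesℕ ρ (Problem.hyps P) (Satℕ ρ (Problem.goal P))
  Statementℕ (suc n) ρ P = ∀ x → Statementℕ n (ρ ∷ʳ x) P

  proveℕ : ∀ (m n : ℕ) ρ P → T (provableℕ m P) → Statementℕ n ρ P
  proveℕ m zero ρ P@(hs ⊢ g by _) t =
    lower ρ m hs (proj₂ (T-∧ {naturalᴿ g} (proj₂ (T-∧ {provable (tighten m P)} t))))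
      (lower-goal ρ g (proj₁ (T-∧ (proj₂ (T-∧ {provable (tighten m P)} t)))))
      (ℤL.provable-sound (map +_ ρ) (tighten m P) (proj₁ (T-∧ t)))
  proveℕ m (suc n) ρ P t x = proveℕ m n (ρ ∷ʳ x) P t

  linℕ : ∀ n (p : Curried n) {_ : T (provableℕ n (applyVars 0 n p))} →
         Statementℕ n [] (applyVars 0 n p)
  linℕ n p {t} = proveℕ n n [] (applyVars 0 n p) t

open ℕ-Linear public using (linℕ)

-- Counting and covering

module Counting (em : ExcludedMiddle 0ℓ) where

  open import Data.Nat.Base using (_+_; _*_; _≤_; _<_; z≤n; s≤s)
  open ≡ using (refl; sym; trans)

  indicator : Set → ℕ
  indicator P with em {P}
  ... | yes _ = 1
  ... | no  _ = 0

  count : (ℕ → Set) → ℕ → ℕ → ℕ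
  count P a zero    = 0
  count P a (suc n) = indicator (P a) + count P (suc a) n

  indicator-yes : ∀ {P} → P → indicator P ≡ 1
  indicator-yes {P} p with em {P}
  ... | yes _ = refl
  ... | no ¬p = ⊥-elim (¬p p)

  indicator-no : ∀ {P} → ¬ P → indicator P ≡ 0
  indicator-no {P} ¬p with em {P}
  ... | yes p = ⊥-elim (¬p p)
  ... | no _  = refl

  indicator-⊎ : ∀ {P Q R} → (P → Q ⊎ R) → indicator P ≤ indicator Q + indicator R
  indicator-⊎ {P} {Q} {R} f with em {P}
  ... | no _  = z≤n
  ... | yes p with f p
  ...   | inj₁ q rewrite indicator-yes q = s≤s z≤n
  ...   | inj₂ r rewrite indicator-yes r = ℕP.m≤n+m 1 _

  infix 4 _∈[_,+_⟩
  _∈[_,+_⟩ : ℕ → ℕ → ℕ → Set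
  i ∈[ a ,+ n ⟩ = a ≤ i × i < a + n

  ∈-head : ∀ {a n} → a ∈[ a ,+ suc n ⟩
  ∈-head {a} {n} = ℕP.≤-refl , linℕ 2 (λ a n → [] ⊢ a :< a :+ (one :+ n)) a n

  ∈-tail : ∀ {i a n} → i ∈[ suc a ,+ n ⟩ → i ∈[ a ,+ suc n ⟩
  ∈-tail {i} {a} {n} (p , q) =
    ℕP.<⇒≤ p , linℕ 3 (λ i a n → i :< one :+ a :+ n ∷ [] ⊢ i :< a :+ (one :+ n)) i a n q

  count-⊎ : ∀ {P Q R} a n → (∀ {i} → i ∈[ a ,+ n ⟩ → P i → Q i ⊎ R i) →
            count P a n ≤ count Q a n + count R a n
  count-⊎ a zero    f = z≤n
  count-⊎ {P} {Q} {R} a (suc n) f =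
    linℕ 6 (λ p q r x y z → p :≤ q :+ r ∷ x :≤ y :+ z ∷ [] ⊢ p :+ x :≤ (q :+ y) :+ (r :+ z))
      (indicator (P a)) (indicator (Q a)) (indicator (R a)) (count P (suc a) n) (count Q (suc a) n) (count R (suc a) n)
      (indicator-⊎ (f ∈-head)) (count-⊎ {P} {Q} {R} (suc a) n (λ i∈ → f (∈-tail i∈)))

  count-∅ : ∀ {P} a n → (∀ {i} → i ∈[ a ,+ n ⟩ → ¬ P i) → count P a n ≡ 0
  count-∅ a zero    f = refl
  count-∅ a (suc n) f = cong₂ _+_ (indicator-no (f ∈-head)) (count-∅ (suc a) n (λ i∈ → f (∈-tail i∈)))

  count-mono : ∀ {P Q} a n → (∀ {i} → i ∈[ a ,+ n ⟩ → P i → Q i) → count P a n ≤ count Q a n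
  count-mono {P} {Q} a n f =
    subst (count P a n ≤_)
      (trans (cong (λ z → count Q a n + z) (count-∅ {λ _ → ⊥} a n (λ _ ()))) (ℕP.+-identityʳ _))
      (count-⊎ {P} {Q} {λ _ → ⊥} a n (λ i∈ p → inj₁ (f i∈ p)))

  count-++ : ∀ P a m n → count P a (m + n) ≡ count P a m + count P (a + m) n
  count-++ P a zero    n = cong (λ b → count P b n) (sym (ℕP.+-identityʳ a))
  count-++ P a (suc m) n
    rewrite count-++ P (suc a) m n | ℕP.+-suc a m = sym (ℕP.+-assoc (indicator (P a)) _ _)

  count-snoc : ∀ P a n → count P a (suc n) ≡ count P a n + indicator (P (a + n))
  count-snoc P a n = trans (cong (count P a) (ℕP.+-comm 1 n))
    (trans (count-++ P a n 1) (cong (λ z → count P a n + z) (ℕP.+-identityʳ _)))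

  indicator≤1 : ∀ P → indicator P ≤ 1
  indicator≤1 P with em {P}
  ... | yes _ = s≤s z≤n
  ... | no  _ = z≤n

  count≤ : ∀ P a n → count P a n ≤ n
  count≤ P a zero    = z≤n
  count≤ P a (suc n) = ℕP.+-mono-≤ (indicator≤1 (P a)) (count≤ P (suc a) n)

  count-¬ : ∀ P a n → n ≤ count P a n + count (λ i → ¬ P i) a n
  count-¬ P a n = subst (_≤ count P a n + count (λ i → ¬ P i) a n) (count-⊤ a n)
    (count-⊎ a n (λ _ _ → dec))
    where
    dec : ∀ {i} → P i ⊎ ¬ P i
    dec {i} with em {P i}
    ... | yes p = inj₁ p
    ... | no ¬p = inj₂ ¬p
    count-⊤ : ∀ a n → count (λ i → i ≡ i) a n ≡ n
    count-⊤ a zero = refl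
    count-⊤ a (suc n) = cong₂ _+_ (indicator-yes refl) (count-⊤ (suc a) n)

  count-⊆ : ∀ P {a k s n} → s ≤ a → a + k ≤ s + n → count P a k ≤ count P s n
  count-⊆ P {a} {k} {s} {n} s≤a a+k≤s+n with ℕP.m≤n⇒∃[o]m+o≡n s≤a | ℕP.m≤n⇒∃[o]m+o≡n a+k≤s+n
  ... | p , refl | r , e with ℕP.+-cancelˡ-≡ s (p + k + r) n (trans (linℕ 4 (λ s p k r → [] ⊢ s :+ (p :+ k :+ r) :≈ s :+ p :+ k :+ r) s p k r) e)
  ... | refl rewrite count-++ P s (p + k) r | count-++ P s p k =
    ℕP.≤-trans (ℕP.m≤n+m _ (count P s p)) (ℕP.m≤m+n _ _)

  -- The first and the last element of `P` are at most m / C apart, which leaves room for at most m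
  -- / C + 1 elements.
  count-spread : ∀ P C m a n →
    (∀ {i δ} → i ∈[ a ,+ n ⟩ → i + δ ∈[ a ,+ n ⟩ → P i → P (i + δ) → C * δ ≤ m) →
    C * count P a n ≤ m + C
  count-spread P C m a zero    h rewrite ℕP.*-zeroʳ C = z≤n
  count-spread P C m a (suc n) h with em {P a}
  ... | no ¬p = count-spread P C m (suc a) n (λ i∈ j∈ → h (∈-tail i∈) (∈-tail j∈))
  ... | yes p = subst (λ x → C * (x + count P (suc a) n) ≤ m + C) (indicator-yes p) (from (suc n) ℕP.≤-refl)
    where
    from : ∀ k → k ≤ suc n → C * count P a k ≤ m + C
    from zero _ rewrite ℕP.*-zeroʳ C = z≤n
    from (suc k) k<n with em {P (a + k)}
    ... | no ¬q rewrite count-snoc P a k | indicator-no ¬q | ℕP.+-identityʳ (count P a k) =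
      from k (ℕP.<⇒≤ k<n)
    ... | yes q = ℕP.≤-trans (ℕP.*-monoʳ-≤ C (count≤ P a (suc k)))
      (linℕ 3 (λ C m k → C :* k :≤ m ∷ [] ⊢ C :* (one :+ k) :≤ m :+ C) C m k
        (h ∈-head (ℕP.m≤m+n a k , ℕP.+-monoʳ-< a k<n) p q))

  maximum : ∀ (R : ℕ → Set) e {x} → x ≤ e → R x → ∃[ y ] R y × (∀ {z} → z ≤ e → R z → z ≤ y)
  maximum R zero {zero} _ r = 0 , r , λ z≤ _ → z≤
  maximum R (suc e) {x} x≤ r with em {R (suc e)}
  ... | yes q = suc e , q , λ z≤ _ → z≤
  ... | no ¬q with ℕP.m≤n⇒m<n∨m≡n x≤
  ...   | inj₂ refl = ⊥-elim (¬q r)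
  ...   | inj₁ x<  with maximum R e (ℕP.≤-pred x<) r
  ...     | y , ry , h = y , ry , λ {z} z≤ rz → [ (λ z< → h (ℕP.≤-pred z<) rz) , (λ { refl → ⊥-elim (¬q rz) }) ]
                                                 (ℕP.m≤n⇒m<n∨m≡n z≤)

  -- A covering lemma on the line: the intervals may overlap in any way, and the selection of a
  -- subfamily costs a factor two in the density.
  module Cover (Z : ℕ → Set) (J : ℕ → ℕ → Set) (k d a₀ e : ℕ)
    (sparse   : ∀ {s n} → J s n → k * count Z s n ≤ d * n)
    (inside   : ∀ {s n} → J s n → s + n ≤ e)
    (covering : ∀ {i} → a₀ ≤ i → i < e → Z i → ∃[ s ] ∃[ n ] J s n × i ∈[ s ,+ n ⟩) where

    -- Scanning from left to right and always choosing the interval that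
    -- reaches furthest, intervals two steps apart are disjoint; hence the
    -- potential t + r, where b bounds from below the next interval.
    scan : ∀ fuel r a b t → r ≤ fuel → a + r ≡ e → b + t ≡ e → a₀ ≤ a → b ≤ a →
           (∀ {s n} → J s n → a < s + n → b ≤ s) → k * count Z a r ≤ d * (t + r)
    scan fuel zero a b t _ _ _ _ _ _ rewrite ℕP.*-zeroʳ k = z≤n
    scan (suc fuel) (suc r) a b t r≤ a+r b+t a₀≤a b≤a h
      with em {∃[ s ] ∃[ n ] J s n × a ∈[ s ,+ n ⟩}
    ... | no ¬covered
      rewrite indicator-no {Z a} (λ z → ¬covered (covering a₀≤a (linℕ 3 (λ a r e → a :+ (one :+ r) :≈ e ∷ [] ⊢ a :< e) a r e a+r) z)) =
        ℕP.≤-trans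
          (scan fuel r (suc a) b t (ℕP.≤-pred r≤) (trans (sym (ℕP.+-suc a r)) a+r) b+t
            (ℕP.m≤n⇒m≤1+n a₀≤a) (ℕP.m≤n⇒m≤1+n b≤a) (λ j p → h j (ℕP.<⇒≤ p)))
          (ℕP.*-monoʳ-≤ d (ℕP.+-monoʳ-≤ t (ℕP.n≤1+n r)))
    ... | yes (s₀ , n₀ , j₀ , s₀≤a , a<)
      with maximum (λ y → ∃[ s ] ∃[ n ] J s n × a ∈[ s ,+ n ⟩ × s + n ≡ y) e (inside j₀)
             (s₀ , n₀ , j₀ , (s₀≤a , a<) , refl)
    ... | _ , (s , n , j , (s≤a , a<s+n) , refl) , furthest
      with ℕP.m≤n⇒∃[o]m+o≡n (ℕP.<⇒≤ a<s+n)
    ... | p , a+p with ℕP.m≤n⇒∃[o]m+o≡n (inside j)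
    ... | r′ , a+p+r′ =
      subst (λ x → k * count Z a x ≤ d * (t + suc r)) (sym r≡) bound
      where
      r≡ : suc r ≡ p + r′
      r≡ = linℕ 7 (λ a r e s n p r′ → a :+ (one :+ r) :≈ e ∷ a :+ p :≈ s :+ n ∷ s :+ n :+ r′ :≈ e ∷ []
             ⊢ one :+ r :≈ p :+ r′) a r e s n p r′ a+r a+p a+p+r′
      r′≤ : r′ ≤ fuel
      r′≤ = linℕ 6 (λ r r′ p fuel a x → one :+ r :≤ one :+ fuel ∷ a :+ p :≈ x ∷ a :< x ∷ one :+ r :≈ p :+ r′ ∷ []
              ⊢ r′ :≤ fuel) r r′ p fuel a (s + n) r≤ a+p a<s+n r≡
      rest : k * count Z (a + p) r′ ≤ d * (suc r + r′)
      rest = scan fuel r′ (a + p) a (suc r) r′≤ (trans (cong (λ z → z + r′) a+p) a+p+r′) a+r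
               (ℕP.≤-trans a₀≤a (ℕP.m≤m+n a p)) (ℕP.m≤m+n a p) next
        where
        -- An interval that starts at or before `a` and reaches beyond `a + p` would contain `a` and
        -- reach further than the chosen one.
        next : ∀ {s′ n′} → J s′ n′ → a + p < s′ + n′ → a ≤ s′
        next {s′} {n′} j′ q with ℕP.≤-total a s′
        ... | inj₁ a≤s′ = a≤s′
        ... | inj₂ s′≤a = ⊥-elim (ℕP.<-irrefl refl (ℕP.<-≤-trans (subst (_< s′ + n′) a+p q)
          (furthest (inside j′) (s′ , n′ , j′ , (s′≤a , ℕP.≤-<-trans (ℕP.m≤m+n a p) q) , refl))))
      first : k * count Z a p ≤ d * n
      first = ℕP.≤-trans (ℕP.*-monoʳ-≤ k (count-⊆ Z s≤a (ℕP.≤-reflexive a+p))) (sparse j)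
      -- `n + r′` is the distance from `s` to `e`, which is at most `t` because `b ≤ s`.
      lengths : n + (suc r + r′) ≤ t + suc r
      lengths = linℕ 9 (λ a r e s n p r′ b t → a :+ (one :+ r) :≈ e ∷ a :+ p :≈ s :+ n ∷ s :+ n :+ r′ :≈ e ∷ b :+ t :≈ e ∷ b :≤ s ∷ []
             ⊢ n :+ (one :+ r :+ r′) :≤ t :+ (one :+ r)) a r e s n p r′ b t a+r a+p a+p+r′ b+t (h j a<s+n)
      bound : k * count Z a (p + r′) ≤ d * (t + suc r)
      bound rewrite count-++ Z a p r′ = ℕP.≤-trans
        (linℕ 7 (λ k x y d n r r′ → k :* x :≤ d :* n ∷ k :* y :≤ d :* (one :+ r :+ r′) ∷ []
          ⊢ k :* (x :+ y) :≤ d :* (n :+ (one :+ r :+ r′))) k (count Z a p) (count Z (a + p) r′) d n r r′ first rest)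
        (ℕP.*-monoʳ-≤ d lengths)

    total : ∀ r → a₀ + r ≡ e → (∀ {s n} → J s n → a₀ ≤ s) → k * count Z a₀ r ≤ d * (r + r)
    total r a+r h = scan r r a₀ a₀ r ℕP.≤-refl a+r a+r ℕP.≤-refl ℕP.≤-refl (λ j _ → h j)

  record Maximal (P : ℕ → ℕ → Set) (a₀ e s n : ℕ) : Set where
    field
      holds  : P s n
      a₀≤s   : a₀ ≤ s
      s+n≤e  : s + n ≤ e
      left   : ∀ {s′} → s ≡ suc s′ → a₀ ≤ s′ → ¬ P s′ (suc n)
      right  : s + n < e → ¬ P s (suc n)

  -- The interval is extended by one point at a time; its length cannot exceed `e`, so `e - n` units
  -- of fuel suffice.
  grow : ∀ (P : ℕ → ℕ → Set) {a₀ e} fuel s n → n + fuel ≡ e → P s n → a₀ ≤ s → s + n ≤ e →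
         ∃[ s′ ] ∃[ n′ ] Maximal P a₀ e s′ n′ × s′ ≤ s × s + n ≤ s′ + n′
  grow P {a₀} {e} zero s n n+f p a₀≤s s+n≤e = s , n , record
    { holds = p ; a₀≤s = a₀≤s ; s+n≤e = s+n≤e
    ; left  = λ { {s′} refl _ _ → ℕP.<-irrefl refl (linℕ 3 (λ s n e → n :+ c 0 :≈ e ∷ one :+ s :+ n :≤ e ∷ [] ⊢ e :< e) s′ n e n+f s+n≤e) }
    ; right = λ q _ → ℕP.<-irrefl refl (linℕ 3 (λ s n e → n :+ c 0 :≈ e ∷ s :+ n :< e ∷ [] ⊢ e :< e) s n e n+f q)
    } , ℕP.≤-refl , ℕP.≤-refl
  grow P {a₀} {e} (suc f) s n n+f p a₀≤s s+n≤e
    with em {s + n < e × P s (suc n)} | em {∃[ s′ ] s ≡ suc s′ × a₀ ≤ s′ × P s′ (suc n)}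
  ... | yes (q , p′) | _ with grow P f s (suc n) (trans (sym (ℕP.+-suc n f)) n+f) p′ a₀≤s (subst (_≤ e) (sym (ℕP.+-suc s n)) q)
  ...   | s″ , n″ , m , l , r = s″ , n″ , m , l , ℕP.≤-trans (ℕP.+-monoʳ-≤ s (ℕP.n≤1+n n)) r
  grow P {a₀} {e} (suc f) s n n+f p a₀≤s s+n≤e | no _ | yes (s′ , refl , a₀≤s′ , p′)
    with grow P f s′ (suc n) (trans (sym (ℕP.+-suc n f)) n+f) p′ a₀≤s′ (subst (_≤ e) (sym (ℕP.+-suc s′ n)) s+n≤e)
  ...   | s″ , n″ , m , l , r = s″ , n″ , m , ℕP.m≤n⇒m≤1+n l , ℕP.≤-trans (ℕP.≤-reflexive (sym (ℕP.+-suc s′ n))) r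
  grow P {a₀} {e} (suc f) s n n+f p a₀≤s s+n≤e | no ¬r | no ¬l = s , n , record
    { holds = p ; a₀≤s = a₀≤s ; s+n≤e = s+n≤e
    ; left  = λ {s′} eq a₀≤s′ p′ → ¬l (s′ , eq , a₀≤s′ , p′)
    ; right = λ q p′ → ¬r (q , p′)
    } , ℕP.≤-refl , ℕP.≤-refl

  -- The combinatorics of the two levels, with vectors reduced to a set `U` and their arithmetic to
  -- the hypotheses `same-side`, `dual-side` and `second`. As the side `T` is arbitrary, points and
  -- lines are treated at once.
  module TwoLevel
    (Side : Set) (dual : Side → Side) (sides : ∀ T T′ → T′ ≡ T ⊎ T′ ≡ dual T)
    (U : Set) (_⟂_ : U → U → Set)
    (Short Tiny : Side → U → ℕ → Set) (N C : ℕ) where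

    AllShort : Side → U → ℕ → ℕ → Set
    AllShort T u s n = ∀ {i} → i ∈[ s ,+ n ⟩ → Short T u i

    Exit : Side → U → ℕ → ℕ → Set
    Exit T u s n = (∃[ s′ ] s ≡ suc s′ × ¬ Short T u s′) ⊎ (s + n < N × ¬ Short T u (s + n))

    module _
      (tiny⇒short : ∀ {T u i} → Tiny T u i → Short T u i)
      (same-side  : ∀ {T u w i} → i < N → Short T u i → Tiny T w i →
                    Tiny T u i ⊎ (∃[ v ] v ⟂ u × Tiny (dual T) v i))
      (dual-side  : ∀ {T u w i} → i < N → Short T u i → Tiny (dual T) w i → w ⟂ u)
      (second     : ∀ {T u v w i} → i < N → v ⟂ u → w ⟂ u → Short (dual T) v i → Tiny (dual T) w i →
                    Tiny (dual T) v i ⊎ Tiny T u i)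
      (sparse     : ∀ {T u s n} → s + n ≤ N → AllShort T u s n → Exit T u s n →
                    C * count (Tiny T u) s n ≤ 4 * n)
      (nonshort   : ∀ {T u} → ¬ AllShort T u 0 N) where

      Bad : ℕ → Set
      Bad i = ∃[ T ] ∃[ u ] Tiny T u i

      -- The side is quantified as well: a dual vector that is short on a whole maximal interval
      -- must find an exit too, and `exit-dual` relies on this.
      SomeShort : ℕ → ℕ → Set
      SomeShort s n = ∃[ T ] ∃[ u ] AllShort T u s n

      extend-left : ∀ {T u s n} → Short T u s → AllShort T u (suc s) n → AllShort T u s (suc n)
      extend-left {s = s} {n} p ps {i} (s≤i , i<) with ℕP.m≤n⇒m<n∨m≡n s≤i
      ... | inj₁ s<i  = ps (s<i , subst (i <_) (ℕP.+-suc s n) i<)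
      ... | inj₂ refl = p

      extend-right : ∀ {T u s n} → AllShort T u s n → Short T u (s + n) → AllShort T u s (suc n)
      extend-right {s = s} {n} ps p {i} (s≤i , i<)
        with ℕP.m≤n⇒m<n∨m≡n (ℕP.≤-pred (subst (i <_) (ℕP.+-suc s n) i<))
      ... | inj₁ i<s+n = ps (s≤i , i<s+n)
      ... | inj₂ refl  = p

      singleton : ∀ {T u i} → Short T u i → AllShort T u i 1
      singleton {i = i} p {j} (i≤j , j<) with ℕP.≤-antisym i≤j (ℕP.≤-pred (subst (j <_) (ℕP.+-comm i 1) j<))
      ... | refl = p

      -- Maximality stops every vector that is short throughout at each end lying inside the grid,
      -- and `nonshort` ensures that there is such an end.
      exit : ∀ {s n T u} → Maximal SomeShort 0 N s n → AllShort T u s n → Exit T u s n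
      exit {suc s′} {n} {T} {u} m ps =
        inj₁ (s′ , refl , λ p → Maximal.left m refl z≤n (T , u , extend-left p ps))
      exit {zero} {n} {T} {u} m ps with ℕP.m≤n⇒m<n∨m≡n (Maximal.s+n≤e m)
      ... | inj₁ n<N  = inj₂ (n<N , λ p → Maximal.right m n<N (T , u , extend-right ps p))
      ... | inj₂ refl = ⊥-elim (nonshort ps)

      module _ {s n} (max : Maximal SomeShort 0 N s n) where

        open Maximal max

        module _ {T u} (ps : AllShort T u s n) where

          DualShort : ℕ → ℕ → Set
          DualShort s′ n′ = ∃[ v ] v ⟂ u × AllShort (dual T) v s′ n′

          exit-dual : ∀ {s′ n′ v} → v ⟂ u → AllShort (dual T) v s′ n′ → Maximal DualShort s (s + n) s′ n′ →
                      Exit (dual T) v s′ n′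
          exit-dual {s′} {n′} {v} v⟂u qs m with ℕP.m≤n⇒m<n∨m≡n (Maximal.a₀≤s m)
          exit-dual {suc s″} {n′} {v} v⟂u qs m | inj₁ s<s′ =
            inj₁ (s″ , refl , λ q → Maximal.left m refl (ℕP.≤-pred s<s′) (v , v⟂u , extend-left q qs))
          ... | inj₂ refl with ℕP.m≤n⇒m<n∨m≡n (Maximal.s+n≤e m)
          ...   | inj₁ below = inj₂ (ℕP.<-≤-trans below s+n≤e , λ q → Maximal.right m below (v , v⟂u , extend-right qs q))
          ...   | inj₂ same with ℕP.+-cancelˡ-≡ s n′ n same
          ...     | refl = exit max qs

          -- What is left after setting aside the points where `u` itself is tiny; these are the
          -- points that the second level has to count.
          Residual : ℕ → Set
          Residual i = (∃[ v ] v ⟂ u × Tiny (dual T) v i) × ¬ Tiny T u i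

          Piece : ℕ → ℕ → Set
          Piece s′ n′ = s ≤ s′ × s′ + n′ ≤ s + n × C * count Residual s′ n′ ≤ 4 * n′

          pieces : ∀ {i} → s ≤ i → i < s + n → Residual i → ∃[ s′ ] ∃[ n′ ] Piece s′ n′ × i ∈[ s′ ,+ n′ ⟩
          pieces {i} s≤i i< ((v , v⟂u , t) , ¬t)
            with ℕP.m≤n⇒∃[o]m+o≡n {1} {s + n} (ℕP.≤-trans (s≤s z≤n) i<)
          ... | f , 1+f with grow DualShort f i 1 1+f (v , v⟂u , singleton (tiny⇒short t)) s≤i (subst (_≤ s + n) (ℕP.+-comm 1 i) i<)
          ... | s′ , n′ , m , s′≤i , i+1≤ with Maximal.holds m
          ... | w , w⟂u , qs =
            s′ , n′ , (Maximal.a₀≤s m , Maximal.s+n≤e m , bound) , s′≤i , subst (_≤ s′ + n′) (ℕP.+-comm i 1) i+1≤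
            where
            inN : s′ + n′ ≤ N
            inN = ℕP.≤-trans (Maximal.s+n≤e m) s+n≤e
            bound : C * count Residual s′ n′ ≤ 4 * n′
            bound = ℕP.≤-trans (ℕP.*-monoʳ-≤ C (count-mono s′ n′ (λ i∈ r → residual⇒tiny i∈ r)))
                      (sparse inN qs (exit-dual w⟂u qs m))
              where
              residual⇒tiny : ∀ {i} → i ∈[ s′ ,+ n′ ⟩ → Residual i → Tiny (dual T) w i
              residual⇒tiny i∈ ((v′ , v′⟂u , t′) , ¬t′)
                with second (ℕP.<-≤-trans (proj₂ i∈) inN) w⟂u v′⟂u (qs i∈) t′
              ... | inj₁ t″ = t″
              ... | inj₂ t″ = ⊥-elim (¬t′ t″)

          residual-count : C * count Residual s n ≤ 4 * (n + n)
          residual-count = Cover.total Residual Piece C 4 s (s + n) (λ p → proj₂ (proj₂ p)) (λ p → proj₁ (proj₂ p))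
            pieces n refl proj₁

          bad-cases : ∀ {i} → i ∈[ s ,+ n ⟩ → Bad i → Tiny T u i ⊎ Residual i
          bad-cases {i} i∈ (T′ , w , t) with em {Tiny T u i}
          ... | yes t′ = inj₁ t′
          ... | no ¬t′ with sides T T′
          ...   | inj₂ refl = inj₂ ((w , dual-side (ℕP.<-≤-trans (proj₂ i∈) s+n≤e) (ps i∈) t , t) , ¬t′)
          ...   | inj₁ refl with same-side (ℕP.<-≤-trans (proj₂ i∈) s+n≤e) (ps i∈) t
          ...     | inj₁ t′ = ⊥-elim (¬t′ t′)
          ...     | inj₂ r  = inj₂ (r , ¬t′)

          -- 12 = 4 + 2 · 4: the points where `u` is tiny have density at most 4 / C, and the
          -- covering by pieces doubles the bound 4 / C for the residual ones.
          bad-count : C * count Bad s n ≤ 12 * n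
          bad-count = linℕ 5 (λ C x y z n → x :≤ y :+ z ∷ C :* y :≤ c 4 :* n ∷ C :* z :≤ c 4 :* (n :+ n) ∷ c 0 :≤ C ∷ []
                        ⊢ C :* x :≤ c 12 :* n by # 0 ⊠ # 3 ∷ [])
            C (count Bad s n) (count (Tiny T u) s n) (count Residual s n) n
            (count-⊎ s n bad-cases) (sparse s+n≤e ps (exit max ps)) residual-count z≤n

      -- The covering by maximal intervals doubles the bound once more, to 24 / C.
      few-bad : C * count Bad 0 N ≤ 12 * (N + N)
      few-bad = Cover.total Bad (λ s n → s + n ≤ N × C * count Bad s n ≤ 12 * n) C 12 0 N proj₂ proj₁
        (λ _ → covering) N refl (λ _ → z≤n)
        where
        covering : ∀ {i} → i < N → Bad i → ∃[ s ] ∃[ n ] (s + n ≤ N × C * count Bad s n ≤ 12 * n) × i ∈[ s ,+ n ⟩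
        covering {i} i<N (T , u , t) with ℕP.m≤n⇒∃[o]m+o≡n {1} {N} (ℕP.≤-trans (s≤s z≤n) i<N)
        ... | f , 1+f with grow SomeShort f i 1 1+f (T , u , singleton (tiny⇒short t)) z≤n (subst (_≤ N) (ℕP.+-comm 1 i) i<N)
        ... | s , n , m , s≤i , i+1≤ with Maximal.holds m
        ... | T′ , w , ps = s , n , (Maximal.s+n≤e m , bad-count m ps) , s≤i , subst (_≤ s + n) (ℕP.+-comm i 1) i+1≤

orderedRing : OrderedField → OrderedRing
orderedRing F = record
  { commutativeRing    = commutativeRing
  ; _<_                = _<_
  ; isStrictTotalOrder = isStrictTotalOrder
  ; 0<1                = 0<1
  ; +-monoˡ-<          = +-monoˡ-<
  ; *-pos              = *-pos
  }
  where open OrderedField F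

-- Elementary facts about the real numbers

module Real (em : ExcludedMiddle 0ℓ) (R : CompleteOrderedField) where

  open RealAnalysis R public
  open Linear (orderedRing orderedField) public
    using (lin; ⟦_⟧ℤ; ⟦⟧-+; ⟦⟧-*; ⟦⟧-neg; ⟦⟧-⊖)
  open IsStrictTotalOrder isStrictTotalOrder public using (compare)

  <⇒≤ : ∀ {x y} → x < y → x ≤ y
  <⇒≤ = inj₁

  ≈⇒≤ : ∀ {x y} → x ≈ y → x ≤ y
  ≈⇒≤ = inj₂

  ≤-refl : ∀ {x} → x ≤ x
  ≤-refl = inj₂ refl

  ≤-trans : ∀ {x y z} → x ≤ y → y ≤ z → x ≤ z
  ≤-trans = lin 3 (λ x y z → x :≤ y ∷ y :≤ z ∷ [] ⊢ x :≤ z) _ _ _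

  ≤-total : ∀ x y → x ≤ y ⊎ y ≤ x
  ≤-total x y with compare x y
  ... | tri< p _ _ = inj₁ (inj₁ p)
  ... | tri≈ _ p _ = inj₁ (inj₂ p)
  ... | tri> _ _ p = inj₂ (inj₁ p)

  <-or-≥ : ∀ x y → x < y ⊎ y ≤ x
  <-or-≥ x y with compare x y
  ... | tri< p _ _ = inj₁ p
  ... | tri≈ _ p _ = inj₂ (inj₂ (sym p))
  ... | tri> _ _ p = inj₂ (inj₁ p)

  ≤⇒≯ : ∀ {x y} → x ≤ y → ¬ y < x
  ≤⇒≯ {x} {y} p q = irr (lin 2 (λ x y → x :≤ y ∷ y :< x ∷ [] ⊢ x :< x) x y p q)
    where irr = IsStrictTotalOrder.irrefl isStrictTotalOrder refl

  fromℤ≈ : ∀ i → fromℤ i ≈ ⟦ i ⟧ℤ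
  fromℤ≈ (+ n)    = refl
  fromℤ≈ -[1+ n ] = refl

  fromℤ-+ : ∀ i j → fromℤ (i ℤ.+ j) ≈ fromℤ i + fromℤ j
  fromℤ-+ i j = trans (fromℤ≈ (i ℤ.+ j)) (trans (⟦⟧-+ i j) (sym (+-cong (fromℤ≈ i) (fromℤ≈ j))))

  fromℤ-* : ∀ i j → fromℤ (i ℤ.* j) ≈ fromℤ i * fromℤ j
  fromℤ-* i j = trans (fromℤ≈ (i ℤ.* j)) (trans (⟦⟧-* i j) (sym (*-cong (fromℤ≈ i) (fromℤ≈ j))))

  fromℤ-neg : ∀ i → fromℤ (ℤ.- i) ≈ - fromℤ i
  fromℤ-neg i = trans (fromℤ≈ (ℤ.- i)) (trans (⟦⟧-neg i) (sym (-‿cong (fromℤ≈ i))))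

  fromℕ-+ : ∀ m n → fromℕ (m ℕ.+ n) ≈ fromℕ m + fromℕ n
  fromℕ-+ m n = fromℤ-+ (+ m) (+ n)

  fromℕ-* : ∀ m n → fromℕ (m ℕ.* n) ≈ fromℕ m * fromℕ n
  fromℕ-* m n = trans (reflexive (≡.cong fromℤ (pos-* m n))) (fromℤ-* (+ m) (+ n))
    where open import Data.Integer.Properties using (pos-*)

  0≤fromℕ : ∀ n → 0# ≤ fromℕ n
  0≤fromℕ zero    = ≤-refl
  0≤fromℕ (suc n) = lin 1 (λ x → c 0 :≤ x ∷ [] ⊢ c 0 :≤ one :+ x) _ (0≤fromℕ n)

  fromℕ-mono : ∀ {m n} → m ℕ.≤ n → fromℕ m ≤ fromℕ n
  fromℕ-mono {n = n} ℕ.z≤n = 0≤fromℕ n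
  fromℕ-mono (ℕ.s≤s p)     = lin 2 (λ x y → x :≤ y ∷ [] ⊢ one :+ x :≤ one :+ y) _ _ (fromℕ-mono p)

  fromℕ-mono-< : ∀ {m n} → m ℕ.< n → fromℕ m + 1# ≤ fromℕ n
  fromℕ-mono-< p = lin 2 (λ x y → one :+ x :≤ y ∷ [] ⊢ x :+ one :≤ y) _ _ (fromℕ-mono p)

  fromℕ-cancel-≤ : ∀ {m n} → fromℕ m ≤ fromℕ n → m ℕ.≤ n
  fromℕ-cancel-≤ {m} {n} p with ℕP.≤-total m n
  ... | inj₁ q = q
  ... | inj₂ q with ℕP.m≤n⇒m<n∨m≡n q
  ...   | inj₂ ≡.refl = ℕP.≤-refl
  ...   | inj₁ n<m = ⊥-elim (≤⇒≯ p (lin 2 (λ x y → x :+ one :≤ y ∷ [] ⊢ x :< y) _ _ (fromℕ-mono-< n<m)))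

  fromℕ-cancel-< : ∀ {m n} → fromℕ m < fromℕ n → m ℕ.< n
  fromℕ-cancel-< {m} {n} p with ℕP.≤-total n m
  ... | inj₁ q = ⊥-elim (≤⇒≯ (fromℕ-mono q) p)
  ... | inj₂ q with ℕP.m≤n⇒m<n∨m≡n q
  ...   | inj₁ r = r
  ...   | inj₂ ≡.refl = ⊥-elim (≤⇒≯ ≤-refl p)

  fromℤ-sub : ∀ i j → fromℤ (i ℤ.- j) ≈ fromℤ i - fromℤ j
  fromℤ-sub i j = trans (fromℤ-+ i (ℤ.- j)) (+-congˡ (fromℤ-neg j))

  0<fromℕ-suc : ∀ n → 0# < fromℕ (suc n)
  0<fromℕ-suc n = lin 1 (λ m → c 0 :≤ m ∷ [] ⊢ c 0 :< one :+ m) _ (0≤fromℕ n)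

  fromℤ-≥1 : ∀ i → ¬ i ≡ + 0 → 1# ≤ fromℤ i ⊎ fromℤ i ≤ - 1#
  fromℤ-≥1 (+ zero)  i≢0 = ⊥-elim (i≢0 ≡.refl)
  fromℤ-≥1 (+ suc n) _ = inj₁ (lin 1 (λ x → c 0 :≤ x ∷ [] ⊢ one :≤ one :+ x) _ (0≤fromℕ n))
  fromℤ-≥1 -[1+ n ]  _ = inj₂ (lin 1 (λ x → c 0 :≤ x ∷ [] ⊢ :- (one :+ x) :≤ :- one) _ (0≤fromℕ n))

  infix 4 _∥_
  -- |x| ≤ b as a pair of inequalities, which `lin` can use directly, whereas `∣_∣` is defined by
  -- cases.
  _∥_ : ℝ → ℝ → Set
  x ∥ b = - b ≤ x × x ≤ b

  ∥-resp : ∀ {x y b} → x ≈ y → x ∥ b → y ∥ b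
  ∥-resp e (p , q) = lin 3 (λ x y b → x :≈ y ∷ :- b :≤ x ∷ [] ⊢ :- b :≤ y) _ _ _ e p
                   , lin 3 (λ x y b → x :≈ y ∷ x :≤ b ∷ [] ⊢ y :≤ b) _ _ _ e q

  ∥-mono : ∀ {x b b′} → b ≤ b′ → x ∥ b → x ∥ b′
  ∥-mono e (p , q) = lin 3 (λ x b b′ → b :≤ b′ ∷ :- b :≤ x ∷ [] ⊢ :- b′ :≤ x) _ _ _ e p
                   , lin 3 (λ x b b′ → b :≤ b′ ∷ x :≤ b ∷ [] ⊢ x :≤ b′) _ _ _ e q

  ∥-neg : ∀ {x b} → x ∥ b → - x ∥ b
  ∥-neg (p , q) = lin 2 (λ x b → x :≤ b ∷ [] ⊢ :- b :≤ :- x) _ _ q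
                , lin 2 (λ x b → :- b :≤ x ∷ [] ⊢ :- x :≤ b) _ _ p

  ∥-+ : ∀ {x y a b} → x ∥ a → y ∥ b → x + y ∥ a + b
  ∥-+ (p , q) (r , s) = lin 4 (λ x y a b → :- a :≤ x ∷ :- b :≤ y ∷ [] ⊢ :- (a :+ b) :≤ x :+ y) _ _ _ _ p r
                      , lin 4 (λ x y a b → x :≤ a ∷ y :≤ b ∷ [] ⊢ x :+ y :≤ a :+ b) _ _ _ _ q s

  ∥-* : ∀ {x y a b} → x ∥ a → y ∥ b → x * y ∥ a * b
  ∥-* (p , q) (r , s) =
      lin 4 (λ x y a b → :- a :≤ x ∷ x :≤ a ∷ :- b :≤ y ∷ y :≤ b ∷ [] ⊢ :- (a :* b) :≤ x :* y
             by # 0 ⊠ # 2 ∷ # 1 ⊠ # 3 ∷ []) _ _ _ _ p q r s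
    , lin 4 (λ x y a b → :- a :≤ x ∷ x :≤ a ∷ :- b :≤ y ∷ y :≤ b ∷ [] ⊢ x :* y :≤ a :* b
             by # 0 ⊠ # 3 ∷ # 1 ⊠ # 2 ∷ []) _ _ _ _ p q r s

  ∥-≥0 : ∀ {x b} → x ∥ b → 0# ≤ b
  ∥-≥0 (p , q) = lin 2 (λ x b → :- b :≤ x ∷ x :≤ b ∷ [] ⊢ c 0 :≤ b) _ _ p q

  ∣∣-cases : ∀ x → (0# ≤ x × ∣ x ∣ ≈ x) ⊎ (x < 0# × ∣ x ∣ ≈ - x)
  ∣∣-cases x with compare x 0#
  ... | tri< p _ _ = inj₂ (p , refl)
  ... | tri≈ _ p _ = inj₁ (inj₂ (sym p) , refl)
  ... | tri> _ _ p = inj₁ (inj₁ p , refl)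

  ∣∣<-intro : ∀ {x b} → x < b → - b < x → ∣ x ∣ < b
  ∣∣<-intro {x} p q with ∣∣-cases x
  ... | inj₁ (_ , e) = lin 3 (λ a x b → a :≈ x ∷ x :< b ∷ [] ⊢ a :< b) _ _ _ e p
  ... | inj₂ (_ , e) = lin 3 (λ a x b → a :≈ :- x ∷ :- b :< x ∷ [] ⊢ a :< b) _ _ _ e q

  ∣∣<-elim : ∀ {x b} → ∣ x ∣ < b → x < b × - b < x
  ∣∣<-elim {x} p with ∣∣-cases x
  ... | inj₁ (r , e) = lin 3 (λ a x b → a :≈ x ∷ a :< b ∷ [] ⊢ x :< b) _ _ _ e p
                     , lin 3 (λ a x b → a :≈ x ∷ a :< b ∷ c 0 :≤ x ∷ [] ⊢ :- b :< x) _ _ _ e p r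
  ... | inj₂ (r , e) = lin 3 (λ a x b → a :≈ :- x ∷ a :< b ∷ x :< c 0 ∷ [] ⊢ x :< b) _ _ _ e p r
                     , lin 3 (λ a x b → a :≈ :- x ∷ a :< b ∷ [] ⊢ :- b :< x) _ _ _ e p

  pos⇒≉0 : ∀ {x} → 0# < x → ¬ x ≈ 0#
  pos⇒≉0 p e = ≤⇒≯ (≈⇒≤ e) p

  ⁻¹-inverse : ∀ {x} → 0# < x → x * x ⁻¹ ≈ 1#
  ⁻¹-inverse p = ⁻¹-inverseʳ (pos⇒≉0 p)

  ⁻¹-pos : ∀ {x} → 0# < x → 0# < x ⁻¹
  ⁻¹-pos {x} p = lin 2 (λ x y → c 0 :< x ∷ x :* y :≈ one ∷ [] ⊢ c 0 :< y by # 0 ⊠ ¬g ∷ []) x _ p (⁻¹-inverse p)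

  ÷-* : ∀ x {y} → 0# < y → x ÷ y * y ≈ x
  ÷-* x {y} p = lin 3 (λ x y z → y :* z :≈ one ∷ [] ⊢ x :* z :* y :≈ x by x ⊡ # 0 ∷ []) x y _ (⁻¹-inverse p)

  archimedean : ∀ x → ∃[ n ] x < fromℕ n
  archimedean x with em {∃[ n ] x < fromℕ n}
  ... | yes p = p
  ... | no ¬p = ⊥-elim contradiction
    where
    bounded : ∀ {y} → Image (λ y → ∃[ n ] y ≈ fromℕ n) (λ y → y) y → y ≤ x
    bounded {y} (z , (n , e) , e′) with <-or-≥ x (fromℕ n)
    ... | inj₁ q = ⊥-elim (¬p (n , q))
    ... | inj₂ q = lin 4 (λ x y z n → n :≤ x ∷ z :≈ n ∷ y :≈ z ∷ [] ⊢ y :≤ x) _ _ _ _ q e e′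
    contradiction : ⊥
    contradiction with supremum (Image (λ y → ∃[ n ] y ≈ fromℕ n) (λ y → y)) (0# , 0# , (0 , refl) , refl) (x , bounded)
    ... | s , upper , least with <-or-≥ (s - 1#) s
    ...   | inj₂ q = ≤⇒≯ (lin 1 (λ s → s :≤ s :- one ∷ [] ⊢ one :≤ c 0) _ q) 0<1
    ...   | inj₁ _ = ≤⇒≯ (least below) (lin 1 (λ s → [] ⊢ s :- one :< s) s)
      where
      below : ∀ {y} → Image (λ y → ∃[ n ] y ≈ fromℕ n) (λ y → y) y → y ≤ s - 1#
      below (z , (n , e) , e′) =
        lin 4 (λ y z n s → y :≈ z ∷ z :≈ n ∷ one :+ n :≤ s ∷ [] ⊢ y :≤ s :- one) _ _ _ _ e′ e (upper (fromℕ (suc n) , (suc n , refl) , refl))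

  abstract

    floorℕ : ∀ x → 0# ≤ x → ∃[ n ] fromℕ n ≤ x × x < fromℕ n + 1#
    floorℕ x 0≤x with archimedean x
    ... | k , x<k = search k x<k
      where
      search : ∀ k → x < fromℕ k → ∃[ n ] fromℕ n ≤ x × x < fromℕ n + 1#
      search zero    x<0 = ⊥-elim (≤⇒≯ 0≤x x<0)
      search (suc k) x<1+k with <-or-≥ x (fromℕ k)
      ... | inj₁ x<k = search k x<k
      ... | inj₂ k≤x = k , k≤x , lin 2 (λ x k → x :< one :+ k ∷ [] ⊢ x :< k :+ one) _ _ x<1+k

    floor : ∀ x → ∃[ i ] fromℤ i ≤ x × x < fromℤ i + 1#
    floor x with archimedean (- x)
    ... | k , -x<k with floorℕ (x + fromℕ k) (lin 2 (λ x k → :- x :< k ∷ [] ⊢ c 0 :≤ x :+ k) _ _ -x<k)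
    ... | n , n≤ , <n+1 = n ℤ.⊖ k
        , lin 4 (λ i n k x → i :≈ n :- k ∷ n :≤ x :+ k ∷ [] ⊢ i :≤ x) _ _ _ _ i≈ n≤
        , lin 4 (λ i n k x → i :≈ n :- k ∷ x :+ k :< n :+ one ∷ [] ⊢ x :< i :+ one) _ _ _ _ i≈ <n+1
      where
      i≈ : fromℤ (n ℤ.⊖ k) ≈ fromℕ n - fromℕ k
      i≈ = trans (fromℤ≈ (n ℤ.⊖ k)) (⟦⟧-⊖ n k)

-- Pairs of functions that behave like a quadratic and its derivative

module Quadratic (em : ExcludedMiddle 0ℓ) (R : CompleteOrderedField) where

  open Real em R
  open Counting em

  module Weights (μ : ℝ) (1≤μ : 1# ≤ μ) where

    -- The interval [1/μ , μ], described without division. Mean values of f″ and Taylor coefficients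
    -- will be weights for one common `μ`.
    Weight : ℝ → Set
    Weight w = 1# ≤ μ * w × w ≤ μ

    weight>0 : ∀ {w} → Weight w → 0# < w
    weight>0 (p , _) = lin 2 (λ μ w → one :≤ μ ∷ one :≤ μ :* w ∷ [] ⊢ c 0 :< w by # 0 ⊠ ¬g ∷ []) μ _ 1≤μ p

    weight-∥ : ∀ {w} → Weight w → w ∥ μ
    weight-∥ ω@(_ , q) = lin 2 (λ w μ → one :≤ μ ∷ c 0 :< w ∷ [] ⊢ :- μ :≤ w) _ _ 1≤μ (weight>0 ω) , q

    -- Two terms of the same sign cannot cancel, so the bound on the sum bounds each of them;
    -- removing a weight costs a factor `μ`.
    no-cancel : ∀ {P R X v w} → Weight v → Weight w → (0# ≤ P × 0# ≤ R) ⊎ (P ≤ 0# × R ≤ 0#) →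
                v * P + w * R ∥ X → P ∥ μ * X × R ∥ μ * X
    no-cancel {P} {R} {X} {v} {w} V W (inj₁ (p , r)) (_ , q) =
        (lin 2 (λ P B → c 0 :≤ P ∷ P :≤ B ∷ [] ⊢ :- B :≤ P) _ _ p P≤ , P≤)
      , (lin 2 (λ P B → c 0 :≤ P ∷ P :≤ B ∷ [] ⊢ :- B :≤ P) _ _ r R≤ , R≤)
      where
      P≤ : P ≤ μ * X
      P≤ = lin 6 (λ μ P R v w X → one :≤ μ ∷ c 0 :≤ P ∷ c 0 :≤ R ∷ c 0 :< w ∷ one :≤ μ :* v ∷ v :* P :+ w :* R :≤ X ∷ []
             ⊢ P :≤ μ :* X by # 4 ⊠ # 1 ∷ # 0 ⊠ # 5 ∷ # 5 ∷ (# 0 ⊠ # 3 ⊠ # 2) ∷ # 3 ⊠ # 2 ∷ [])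
             μ P R v w X 1≤μ p r (weight>0 W) (proj₁ V) q
      R≤ : R ≤ μ * X
      R≤ = lin 6 (λ μ P R v w X → one :≤ μ ∷ c 0 :≤ P ∷ c 0 :≤ R ∷ c 0 :< w ∷ one :≤ μ :* v ∷ w :* P :+ v :* R :≤ X ∷ []
             ⊢ R :≤ μ :* X by # 4 ⊠ # 2 ∷ # 0 ⊠ # 5 ∷ # 5 ∷ (# 0 ⊠ # 3 ⊠ # 1) ∷ # 3 ⊠ # 1 ∷ [])
             μ P R w v X 1≤μ p r (weight>0 V) (proj₁ W) q
    no-cancel {P} {R} {X} {v} {w} V W (inj₂ (p , r)) b
      with no-cancel {P = - P} {R = - R} {X} V W
             (inj₁ (lin 1 (λ x → x :≤ c 0 ∷ [] ⊢ c 0 :≤ :- x) _ p , lin 1 (λ x → x :≤ c 0 ∷ [] ⊢ c 0 :≤ :- x) _ r))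
             (∥-resp (lin 4 (λ P R v w → [] ⊢ :- (v :* P :+ w :* R) :≈ v :* (:- P) :+ w :* (:- R)) P R v w) (∥-neg b))
    ... | bP , bR = ∥-resp (lin 1 (λ x → [] ⊢ :- :- x :≈ x) P) (∥-neg bP)
                  , ∥-resp (lin 1 (λ x → [] ⊢ :- :- x :≈ x) R) (∥-neg bR)

    weight-1 : Weight 1#
    weight-1 = lin 1 (λ μ → one :≤ μ ∷ [] ⊢ one :≤ μ :* one) μ 1≤μ , 1≤μ

    -- The expansion over a step d of a quadratic Φ with derivative φ and second derivative s, each
    -- coefficient being known only up to a weight.
    φ-Increment : ℝ → ℝ → ℝ → ℝ → Set
    φ-Increment s d φ φ′ = ∃[ w ] Weight w × φ′ - φ ≈ s * (w * d)

    Φ-Increment : ℝ → ℝ → ℝ → ℝ → ℝ → Set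
    Φ-Increment s d φ Φ Φ′ =
      ∃[ v ] ∃[ w ] Weight v × Weight w × Φ′ - Φ ≈ v * (φ * d) + w * (s * (d * d))

    SameSign : ℝ → ℝ → Set
    SameSign x y = (0# ≤ x × 0# ≤ y) ⊎ (x ≤ 0# × y ≤ 0#)

    -- If |φ| grows along the step, then s d has the sign of φ, so the two terms in the increment of
    -- Φ cannot cancel.
    growing : ∀ {s d φ φ′} → 0# < d → φ-Increment s d φ φ′ →
              (0# ≤ φ × φ ≤ φ′) ⊎ (φ ≤ 0# × φ′ ≤ φ) → SameSign (φ * d) (s * (d * d))
    growing {s} {d} {φ} {φ′} d>0 (w , W , e) (inj₁ (p , q)) = inj₁
      ( lin 2 (λ φ d → c 0 :≤ φ ∷ c 0 :< d ∷ [] ⊢ c 0 :≤ φ :* d by # 0 ⊠ # 1 ∷ []) _ _ p d>0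
      , lin 5 (λ s d φ ψ w → φ :≤ ψ ∷ ψ :- φ :≈ s :* (w :* d) ∷ c 0 :< d ∷ c 0 :< w ∷ []
          ⊢ c 0 :≤ s :* (d :* d) by # 0 ⊠ # 2 ∷ d ⊡ # 1 ∷ # 3 ⊠ ¬g ∷ []) s d φ φ′ w q e d>0 (weight>0 W))
    growing {s} {d} {φ} {φ′} d>0 (w , W , e) (inj₂ (p , q)) = inj₂
      ( lin 2 (λ φ d → φ :≤ c 0 ∷ c 0 :< d ∷ [] ⊢ φ :* d :≤ c 0 by # 0 ⊠ # 1 ∷ []) _ _ p d>0
      , lin 5 (λ s d φ ψ w → ψ :≤ φ ∷ ψ :- φ :≈ s :* (w :* d) ∷ c 0 :< d ∷ c 0 :< w ∷ []
          ⊢ s :* (d :* d) :≤ c 0 by # 0 ⊠ # 2 ∷ d ⊡ # 1 ∷ # 3 ⊠ ¬g ∷ []) s d φ φ′ w q e d>0 (weight>0 W))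

    ordered : ∀ {x y} → SameSign x y →
              ((0# ≤ x × x ≤ y) ⊎ (x ≤ 0# × y ≤ x)) ⊎ ((0# ≤ y × y ≤ x) ⊎ (y ≤ 0# × x ≤ y))
    ordered {x} {y} (inj₁ (p , q)) with ≤-total x y
    ... | inj₁ r = inj₁ (inj₁ (p , r))
    ... | inj₂ r = inj₂ (inj₁ (q , r))
    ordered {x} {y} (inj₂ (p , q)) with ≤-total x y
    ... | inj₁ r = inj₂ (inj₂ (q , r))
    ... | inj₂ r = inj₁ (inj₂ (p , r))

    -- Φ is expanded at the endpoint where |φ| is smaller: from there |φ| grows, and the terms of
    -- the increment have one sign. If this is the second endpoint, φ d is recovered from φ′ d and s
    -- d², whence the factor `μ + μ * μ`.
    pair-bounds : ∀ {s d φ φ′ Φ Φ′ X} → 0# < d → φ-Increment s d φ φ′ → Φ-Increment s d φ Φ Φ′ →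
                  Φ-Increment s (- d) φ′ Φ′ Φ → SameSign φ φ′ → Φ ∥ X → Φ′ ∥ X →
                  (φ * d ∥ (μ + μ * μ) * (X + X)) × (s * (d * d) ∥ μ * (X + X))
    pair-bounds {s} {d} {φ} {φ′} {Φ} {Φ′} {X} d>0 i₁@(w , W , e) (v₁ , w₁ , V₁ , W₁ , e₁) (v₂ , w₂ , V₂ , W₂ , e₂) ss b b′
      with ordered ss
    ... | inj₁ g with no-cancel V₁ W₁ (growing {s} d>0 i₁ g) (∥-resp e₁ (∥-+ b′ (∥-neg b)))
    ...   | bP , bR = ∥-mono (lin 2 (λ μ X → one :≤ μ ∷ c 0 :≤ X ∷ [] ⊢ μ :* X :≤ (μ :+ μ :* μ) :* X
                                by # 0 ⊠ # 0 ⊠ # 1 ∷ # 0 ⊠ # 1 ∷ []) μ _ 1≤μ (∥-≥0 (∥-+ b b))) bP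
                    , bR
    pair-bounds {s} {d} {φ} {φ′} {Φ} {Φ′} {X} d>0 i₁@(w , W , e) (v₁ , w₁ , V₁ , W₁ , e₁) (v₂ , w₂ , V₂ , W₂ , e₂) ss b b′
      | inj₂ g with no-cancel V₂ W₂ (flip-sign (growing {s = - s} d>0 (w , W , e′) g))
                      (∥-resp e₂ (∥-+ b (∥-neg b′)))
      where
      e′ : φ - φ′ ≈ (- s) * (w * d)
      e′ = lin 5 (λ s d w φ ψ → ψ :- φ :≈ s :* (w :* d) ∷ [] ⊢ φ :- ψ :≈ (:- s) :* (w :* d)) _ _ _ _ _ e
      flip-sign : SameSign (φ′ * d) (- s * (d * d)) → SameSign (φ′ * - d) (s * (- d * - d))
      flip-sign (inj₁ (p , q)) = inj₂ (lin 2 (λ φ d → c 0 :≤ φ :* d ∷ [] ⊢ φ :* (:- d) :≤ c 0) _ _ p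
                                     , lin 2 (λ s d → c 0 :≤ (:- s) :* (d :* d) ∷ [] ⊢ s :* ((:- d) :* (:- d)) :≤ c 0) _ _ q)
      flip-sign (inj₂ (p , q)) = inj₁ (lin 2 (λ φ d → φ :* d :≤ c 0 ∷ [] ⊢ c 0 :≤ φ :* (:- d)) _ _ p
                                     , lin 2 (λ s d → (:- s) :* (d :* d) :≤ c 0 ∷ [] ⊢ c 0 :≤ s :* ((:- d) :* (:- d))) _ _ q)
    ... | bP , bR =
      ∥-resp (lin 5 (λ s d w φ ψ → ψ :- φ :≈ s :* (w :* d) ∷ [] ⊢
                :- (ψ :* (:- d)) :+ :- (w :* (s :* (d :* d))) :≈ φ :* d by d ⊡ # 0 ∷ []) _ _ _ _ _ e)
        (∥-mono (lin 2 (λ μ X → [] ⊢ μ :* X :+ μ :* (μ :* X) :≤ (μ :+ μ :* μ) :* X) μ _)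
          (∥-+ (∥-neg bP) (∥-neg (∥-* (weight-∥ W) bR′))))
      , bR′
      where
      bR′ : s * (d * d) ∥ μ * (X + X)
      bR′ = ∥-resp (lin 2 (λ s d → [] ⊢ s :* ((:- d) :* (:- d)) :≈ s :* (d :* d)) s d) bR

    slope-bound : ∀ {s d φ φ′ Y} → φ-Increment s d φ φ′ → φ ∥ Y → φ′ ∥ Y → s * d ∥ μ * (Y + Y)
    slope-bound {s} {d} {φ} {φ′} {Y} (w , W , e) b b′ =
      proj₁ (no-cancel {R = 0#} W W zero-sign
        (∥-resp (lin 5 (λ s d w φ ψ → ψ :- φ :≈ s :* (w :* d) ∷ [] ⊢ ψ :- φ :≈ w :* (s :* d) :+ w :* c 0) _ _ _ _ _ e)
          (∥-+ b′ (∥-neg b))))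
      where
      zero-sign : SameSign (s * d) 0#
      zero-sign with ≤-total 0# (s * d)
      ... | inj₁ p = inj₁ (p , ≤-refl)
      ... | inj₂ p = inj₂ (p , ≤-refl)

    module Small (C ζ : ℝ) (1≤C : 1# ≤ C) (0≤ζ : 0# ≤ ζ)
             (ζ-small : fromℕ 42 * (μ * (μ * μ) * (C * C) * ζ) ≤ 1#) where

      -- G dominates every product of the constants that occurs below, and 42
      -- every numerical factor.
      G : ℝ
      G = μ * (μ * μ) * (C * C)

      1≤μμ : 1# ≤ μ * μ
      1≤μμ = lin 1 (λ x → one :≤ x ∷ [] ⊢ one :≤ x :* x by # 0 ⊠ # 0 ∷ []) _ 1≤μ

      1≤CC : 1# ≤ C * C
      1≤CC = lin 1 (λ x → one :≤ x ∷ [] ⊢ one :≤ x :* x by # 0 ⊠ # 0 ∷ []) _ 1≤C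

      mono : ∀ {a b x y} → 1# ≤ a → a ≤ x → 1# ≤ b → b ≤ y → a * b ≤ x * y
      mono = lin 4 (λ a b x y → one :≤ a ∷ a :≤ x ∷ one :≤ b ∷ b :≤ y ∷ [] ⊢ a :* b :≤ x :* y
               by # 1 ⊠ # 3 ∷ # 1 ⊠ # 2 ∷ # 0 ⊠ # 3 ∷ []) _ _ _ _

      1≤* : ∀ {a b} → 1# ≤ a → 1# ≤ b → 1# ≤ a * b
      1≤* = lin 2 (λ a b → one :≤ a ∷ one :≤ b ∷ [] ⊢ one :≤ a :* b by # 0 ⊠ # 1 ∷ []) _ _

      μ≤μμ : μ ≤ μ * μ
      μ≤μμ = lin 1 (λ x → one :≤ x ∷ [] ⊢ x :≤ x :* x by # 0 ⊠ # 0 ∷ []) _ 1≤μ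

      C≤CC : C ≤ C * C
      C≤CC = lin 1 (λ x → one :≤ x ∷ [] ⊢ x :≤ x :* x by # 0 ⊠ # 0 ∷ []) _ 1≤C

      μμ≤μμμ : μ * μ ≤ μ * (μ * μ)
      μμ≤μμμ = mono 1≤μ ≤-refl 1≤μ μ≤μμ

      μ≤μμμ : μ ≤ μ * (μ * μ)
      μ≤μμμ = ≤-trans μ≤μμ μμ≤μμμ

      1≤μμμ : 1# ≤ μ * (μ * μ)
      1≤μμμ = 1≤* 1≤μ 1≤μμ

      μ³C≤G : μ * (μ * μ) * C ≤ G
      μ³C≤G = mono 1≤μμμ ≤-refl 1≤C C≤CC

      μ²C≤G : μ * μ * C ≤ G
      μ²C≤G = mono 1≤μμ μμ≤μμμ 1≤C C≤CC

      μ²CC≤G : μ * μ * (C * C) ≤ G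
      μ²CC≤G = mono 1≤μμ μμ≤μμμ 1≤CC ≤-refl

      μC≤G : μ * C ≤ G
      μC≤G = mono 1≤μ μ≤μμμ 1≤C C≤CC

      μCC≤G : μ * (C * C) ≤ G
      μCC≤G = mono 1≤μ μ≤μμμ 1≤CC ≤-refl

      1≤G : 1# ≤ G
      1≤G = 1≤* 1≤μμμ 1≤CC

      42Gζ≤ : ∀ {α} → 0# ≤ α → fromℕ 42 * (G * (ζ * α)) ≤ α
      42Gζ≤ {α} = lin 3 (λ G ζ α → c 42 :* (G :* ζ) :≤ one ∷ c 0 :≤ α ∷ [] ⊢ c 42 :* (G :* (ζ :* α)) :≤ α by # 0 ⊠ # 1 ∷ [])
                  G ζ α ζ-small

      0≤ζ* : ∀ {α} → 0# ≤ α → 0# ≤ ζ * α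
      0≤ζ* = lin 2 (λ ζ α → c 0 :≤ ζ ∷ c 0 :≤ α ∷ [] ⊢ c 0 :≤ ζ :* α by # 0 ⊠ # 1 ∷ []) _ _ 0≤ζ

      -- Shortness refers to half of the box: in a 2 × 2 determinant of a short and a tiny vector
      -- both products are then at most half of ζ times the product of the sides, and the result is
      -- tiny for the same ζ.
      Tiny² Short² : ℝ → ℝ → ℝ → ℝ → Set
      Tiny² α β Φ φ = (Φ ∥ ζ * α) × (φ ∥ ζ * β)
      Short² α β Φ φ = (Φ + Φ ∥ α) × (φ + φ ∥ β)

      short : ∀ {α Φ A} → Φ ∥ A → A + A ≤ α → Φ + Φ ∥ α
      short b A≤ = ∥-mono A≤ (∥-+ b b)

      -- Being tiny at two points at distance d bounds φ d, s d² and s d; a displacement of at most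
      -- C d multiplies these by at most C or C², which the smallness of ζ absorbs.
      far : ∀ {α β s d e φ φ′ φ″ Φ Φ′ Φ″} → 0# ≤ α → 0# ≤ β → 0# < d → e ∥ C * d →
            φ-Increment s d φ φ′ → Φ-Increment s d φ Φ Φ′ → Φ-Increment s (- d) φ′ Φ′ Φ →
            φ-Increment s e φ φ″ → Φ-Increment s e φ Φ Φ″ → SameSign φ φ′ →
            Tiny² α β Φ φ → Tiny² α β Φ′ φ′ → Short² α β Φ″ φ″
      far {α} {β} {s} {d} {e} {φ} {φ′} {φ″} {Φ} {Φ′} {Φ″} 0≤α 0≤β d>0 (-Cd≤e , e≤Cd) i₁ I₁ I₂
          (w₃ , W₃ , e₃) (v₄ , w₄ , V₄ , W₄ , e₄) ss (bΦ , bφ) (bΦ′ , bφ′)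
        with pair-bounds {s} d>0 i₁ I₁ I₂ ss bΦ bΦ′ | slope-bound {s} i₁ bφ bφ′
      ... | bP , bR | bS =
          short (∥-resp Φ≈ (∥-+ bΦ (∥-+ (∥-* (weight-∥ V₄) (∥-* bλ bP)) (∥-* (weight-∥ W₄) (∥-* (∥-* bλ bλ) bR)))))
            (lin 5 (λ z G a μ C → c 0 :≤ z ∷ c 42 :* (G :* z) :≤ a ∷ one :≤ G ∷
                      μ :* μ :* C :≤ G ∷ μ :* (μ :* μ) :* C :≤ G ∷ μ :* μ :* (C :* C) :≤ G ∷ []
                   ⊢ (z :+ (μ :* (C :* ((μ :+ μ :* μ) :* (z :+ z))) :+ μ :* (C :* C :* (μ :* (z :+ z))))) :+
                     (z :+ (μ :* (C :* ((μ :+ μ :* μ) :* (z :+ z))) :+ μ :* (C :* C :* (μ :* (z :+ z)))))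
                     :≤ a by # 0 ⊠ # 2 ∷ # 0 ⊠ # 3 ∷ # 0 ⊠ # 4 ∷ # 0 ⊠ # 5 ∷ [])
              (ζ * α) G α μ C (0≤ζ* 0≤α) (42Gζ≤ 0≤α) 1≤G μ²C≤G μ³C≤G μ²CC≤G)
        , short (∥-resp φ≈ (∥-+ bφ (∥-* (weight-∥ W₃) (∥-* bλ bS))))
            (lin 5 (λ z G a μ C → c 0 :≤ z ∷ c 42 :* (G :* z) :≤ a ∷ one :≤ G ∷ μ :* μ :* C :≤ G ∷ []
                   ⊢ (z :+ μ :* (C :* (μ :* (z :+ z)))) :+ (z :+ μ :* (C :* (μ :* (z :+ z)))) :≤ a
                   by # 0 ⊠ # 2 ∷ # 0 ⊠ # 3 ∷ [])
              (ζ * β) G β μ C (0≤ζ* 0≤β) (42Gζ≤ 0≤β) 1≤G μ²C≤G)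
        where
        ƛ : ℝ
        ƛ = e ÷ d
        ƛd≈e : ƛ * d ≈ e
        ƛd≈e = ÷-* e d>0
        bλ : ƛ ∥ C
        bλ = lin 4 (λ l d e C → l :* d :≈ e ∷ c 0 :< d ∷ :- (C :* d) :≤ e ∷ [] ⊢ :- C :≤ l by # 1 ⊠ ¬g ∷ []) ƛ d e C ƛd≈e d>0 -Cd≤e
           , lin 4 (λ l d e C → l :* d :≈ e ∷ c 0 :< d ∷ e :≤ C :* d ∷ [] ⊢ l :≤ C by # 1 ⊠ ¬g ∷ []) ƛ d e C ƛd≈e d>0 e≤Cd
        φ≈ : φ + w₃ * (ƛ * (s * d)) ≈ φ″
        φ≈ = lin 7 (λ φ ψ w l s d e → l :* d :≈ e ∷ ψ :- φ :≈ s :* (w :* e) ∷ [] ⊢ φ :+ w :* (l :* (s :* d)) :≈ ψ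
               by s :* w ⊡ # 0 ∷ []) φ φ″ w₃ ƛ s d e ƛd≈e e₃
        Φ≈ : Φ + (v₄ * (ƛ * (φ * d)) + w₄ * (ƛ * ƛ * (s * (d * d)))) ≈ Φ″
        Φ≈ = lin 9 (λ Φ Ψ φ v w l s d e → l :* d :≈ e ∷ Ψ :- Φ :≈ v :* (φ :* e) :+ w :* (s :* (e :* e)) ∷ []
               ⊢ Φ :+ (v :* (l :* (φ :* d)) :+ w :* (l :* l :* (s :* (d :* d)))) :≈ Ψ
               by v :* φ ⊡ # 0 ∷ w :* s :* l :* d ⊡ # 0 ∷ w :* s :* e ⊡ # 0 ∷ []) Φ Φ″ φ v₄ w₄ ƛ s d e ƛd≈e e₄

      -- Serves when only one tiny point is known: as h is at most 4 α / β and 4 β / γ, a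
      -- displacement of at most C steps changes Φ and φ only by constant multiples of ζ α and ζ β.
      near : ∀ {α β γ h s e φ φ″ Φ Φ″} → 0# ≤ α → 0# ≤ β → β * h ≤ fromℕ 4 * α → γ * h ≤ fromℕ 4 * β →
             0# ≤ h → e ∥ C * h → s ∥ ζ * γ →
             φ-Increment s e φ φ″ → Φ-Increment s e φ Φ Φ″ → Tiny² α β Φ φ → Short² α β Φ″ φ″
      near {α} {β} {γ} {h} {s} {e} {φ} {φ″} {Φ} {Φ″} 0≤α 0≤β βh γh 0≤h be bs
           (w₃ , W₃ , e₃) (v₄ , w₄ , V₄ , W₄ , e₄) (bΦ , bφ) =
          short (∥-resp (lin 3 (λ Φ Ψ x → Ψ :- Φ :≈ x ∷ [] ⊢ Φ :+ x :≈ Ψ) Φ Φ″ _ e₄)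
                  (∥-+ bΦ (∥-+ (∥-* (weight-∥ V₄) bφe) (∥-* (weight-∥ W₄) bsee))))
            -- Here 2 · (1 + 4 + 16) = 42, the factor in `ζ-small`.
            (lin 5 (λ z G a μ C → c 0 :≤ z ∷ c 42 :* (G :* z) :≤ a ∷ one :≤ G ∷ μ :* C :≤ G ∷ μ :* (C :* C) :≤ G ∷ []
                   ⊢ (z :+ (μ :* (c 4 :* C :* z) :+ μ :* (c 16 :* (C :* C) :* z))) :+
                     (z :+ (μ :* (c 4 :* C :* z) :+ μ :* (c 16 :* (C :* C) :* z))) :≤ a
                     by # 0 ⊠ # 2 ∷ # 0 ⊠ # 3 ∷ # 0 ⊠ # 4 ∷ [])
              (ζ * α) G α μ C (0≤ζ* 0≤α) (42Gζ≤ 0≤α) 1≤G μC≤G μCC≤G)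
        , short (∥-resp (lin 5 (λ φ ψ s w e → ψ :- φ :≈ s :* (w :* e) ∷ [] ⊢ φ :+ w :* (s :* e) :≈ ψ) φ φ″ s w₃ e e₃)
                  (∥-+ bφ (∥-* (weight-∥ W₃) bse)))
            (lin 5 (λ z G a μ C → c 0 :≤ z ∷ c 42 :* (G :* z) :≤ a ∷ one :≤ G ∷ μ :* C :≤ G ∷ []
                   ⊢ (z :+ μ :* (c 4 :* C :* z)) :+ (z :+ μ :* (c 4 :* C :* z)) :≤ a
                     by # 0 ⊠ # 2 ∷ # 0 ⊠ # 3 ∷ [])
              (ζ * β) G β μ C (0≤ζ* 0≤β) (42Gζ≤ 0≤β) 1≤G μC≤G)
        where
        scale : ∀ {a b x} → 0# ≤ x → a ≤ fromℕ 4 * b → x * a ≤ x * (fromℕ 4 * b)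
        scale = lin 3 (λ a b x → c 0 :≤ x ∷ a :≤ c 4 :* b ∷ [] ⊢ x :* a :≤ x :* (c 4 :* b) by # 0 ⊠ # 1 ∷ []) _ _ _
        0≤ζC : 0# ≤ ζ * C
        0≤ζC = lin 2 (λ ζ C → c 0 :≤ ζ ∷ one :≤ C ∷ [] ⊢ c 0 :≤ ζ :* C by # 0 ⊠ # 1 ∷ []) ζ C 0≤ζ 1≤C
        bφe : φ * e ∥ fromℕ 4 * C * (ζ * α)
        bφe = ∥-mono (lin 5 (λ z C b h a → z :* C :* (b :* h) :≤ z :* C :* (c 4 :* a) ∷ []
                        ⊢ z :* b :* (C :* h) :≤ c 4 :* C :* (z :* a)) ζ C β h α (scale 0≤ζC βh)) (∥-* bφ be)
        bse : s * e ∥ fromℕ 4 * C * (ζ * β)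
        bse = ∥-mono (lin 5 (λ z C b h a → z :* C :* (b :* h) :≤ z :* C :* (c 4 :* a) ∷ []
                        ⊢ z :* b :* (C :* h) :≤ c 4 :* C :* (z :* a)) ζ C γ h β (scale 0≤ζC γh)) (∥-* bs be)
        bsee : s * (e * e) ∥ fromℕ 16 * (C * C) * (ζ * α)
        bsee = ∥-mono (lin 5 (λ z C b h a → c 0 :≤ z :* C ∷ one :≤ C ∷ b :* h :≤ c 4 :* a ∷ []
                         ⊢ c 4 :* C :* (z :* b) :* (C :* h) :≤ c 16 :* (C :* C) :* (z :* a) by # 2 ⊠ # 0 ∷ # 2 ⊠ # 0 ⊠ # 1 ∷ [])
                         ζ C β h α 0≤ζC 1≤C βh)
                 (∥-resp (*-assoc s e e) (∥-* bse be))

-- Sparsity of the tiny points on a grid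

module Grids (em : ExcludedMiddle 0ℓ) (R : CompleteOrderedField) where

  open Real em R
  open Counting em
  open Quadratic em R

  module Grid (μ : ℝ) (1≤μ : 1# ≤ μ) (Cₙ : ℕ) (1≤Cₙ : 1 ℕ.≤ Cₙ)
              (ζ : ℝ) (0≤ζ : 0# ≤ ζ) (ζ-small : fromℕ 42 * (μ * (μ * μ) * (fromℕ Cₙ * fromℕ Cₙ) * ζ) ≤ 1#)
              (x₀ h : ℝ) (h>0 : 0# < h) (N : ℕ) where

    open Weights μ 1≤μ public

    C : ℝ
    C = fromℕ Cₙ

    1≤C : 1# ≤ C
    1≤C = lin 2 (λ z y → one :+ z :≤ y ∷ z :≈ c 0 ∷ [] ⊢ one :≤ y) _ _ (fromℕ-mono 1≤Cₙ) refl

    open Small C ζ 1≤C 0≤ζ ζ-small public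

    x : ℕ → ℝ
    x i = x₀ + fromℕ i * h

    x-near : ∀ {i e n} → e ℕ.≤ i ℕ.+ n → i ℕ.≤ e ℕ.+ n → x e - x i ∥ fromℕ n * h
    x-near {i} {e} {n} p q =
        lin 6 (λ x₀ i e n h in′ → i :≤ in′ ∷ in′ :≈ e :+ n ∷ c 0 :< h ∷ []
                 ⊢ :- (n :* h) :≤ x₀ :+ e :* h :- (x₀ :+ i :* h) by # 0 ⊠ # 2 ∷ h ⊡ # 1 ∷ [])
          x₀ _ _ _ h _ (fromℕ-mono q) (fromℕ-+ e n) h>0
      , lin 6 (λ x₀ i e n h in′ → e :≤ in′ ∷ in′ :≈ i :+ n ∷ c 0 :< h ∷ []
                 ⊢ x₀ :+ e :* h :- (x₀ :+ i :* h) :≤ n :* h by # 0 ⊠ # 2 ∷ h ⊡ # 1 ∷ [])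
          x₀ _ _ _ h _ (fromℕ-mono p) (fromℕ-+ i n) h>0

    x-step : ∀ i δ → x (i ℕ.+ δ) - x i ≈ fromℕ δ * h
    x-step i δ = lin 5 (λ x₀ i d h id → id :≈ i :+ d ∷ [] ⊢ x₀ :+ id :* h :- (x₀ :+ i :* h) :≈ d :* h by h ⊡ # 0 ∷ [])
      x₀ _ _ h _ (fromℕ-+ i δ)

    record QuadraticPair (Φ φ : ℕ → ℝ) (s : ℝ) : Set where
      field
        φ-step : ∀ {i j} → i ℕ.< N → j ℕ.< N → φ-Increment s (x j - x i) (φ i) (φ j)
        Φ-step : ∀ {i j} → i ℕ.< N → j ℕ.< N → Φ-Increment s (x j - x i) (φ i) (Φ i) (Φ j)

    module Scale (α β γ : ℝ) (0≤α : 0# ≤ α) (0≤β : 0# ≤ β) (0≤γ : 0# ≤ γ)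
                 (βh≤4α : β * h ≤ fromℕ 4 * α) (γh≤4β : γ * h ≤ fromℕ 4 * β) where

      ShortAt TinyAt : (Φ φ : ℕ → ℝ) (s : ℝ) → ℕ → Set
      ShortAt Φ φ s i = (Φ i + Φ i ∥ α) × (φ i + φ i ∥ β) × (s + s ∥ γ)
      TinyAt  Φ φ s i = (Φ i ∥ ζ * α) × (φ i ∥ ζ * β) × (s ∥ ζ * γ)

      half : ∀ {a y} → 0# ≤ a → y ∥ ζ * a → y + y ∥ a
      half {a} {y} 0≤a b = ∥-mono
        (lin 3 (λ G z a → c 42 :* (G :* (z :* a)) :≤ a ∷ one :≤ G ∷ c 0 :≤ z :* a ∷ [] ⊢ z :* a :+ z :* a :≤ a by # 1 ⊠ # 2 ∷ [])
          G ζ a (42Gζ≤ 0≤a) 1≤G (0≤ζ* 0≤a))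
        (∥-+ b b)

      tiny⇒short : ∀ {Φ φ s i} → TinyAt Φ φ s i → ShortAt Φ φ s i
      tiny⇒short (p , q , r) = half 0≤α p , half 0≤β q , half 0≤γ r

      module _ {Φ φ : ℕ → ℝ} {s : ℝ} (quad : QuadraticPair Φ φ s) where

        open QuadraticPair quad

        module _ {a n e : ℕ} (a+n≤N : a ℕ.+ n ℕ.≤ N) (e<N : e ℕ.< N)
                 (e-near : ∀ {i} → i ∈[ a ,+ n ⟩ → e ℕ.≤ i ℕ.+ n × i ℕ.≤ e ℕ.+ n)
                 (exit : ¬ ShortAt Φ φ s e) where

          <N : ∀ {i} → i ∈[ a ,+ n ⟩ → i ℕ.< N
          <N i∈ = ℕP.<-≤-trans (proj₂ i∈) a+n≤N

          -- In a shorter interval the point `e` would be within `Cₙ` steps of the tiny point, and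
          -- `near` would make the pair short there.
          long : ∀ {i} → i ∈[ a ,+ n ⟩ → TinyAt Φ φ s i → Cₙ ℕ.≤ n
          long {i} i∈ (tΦ , tφ , ts) with ℕP.≤-total Cₙ n
          ... | inj₁ p = p
          ... | inj₂ n≤C = ⊥-elim (exit (add (near 0≤α 0≤β βh≤4α γh≤4β (<⇒≤ h>0) e∥ ts
                             (φ-step (<N i∈) e<N) (Φ-step (<N i∈) e<N) (tΦ , tφ))))
            where
            add : ∀ {A B} → A × B → A × B × (s + s ∥ γ)
            add (p , q) = p , q , half 0≤γ ts
            e∥ : x e - x i ∥ C * h
            e∥ = ∥-mono (lin 3 (λ n C h → n :≤ C ∷ c 0 :< h ∷ [] ⊢ n :* h :≤ C :* h by # 0 ⊠ # 1 ∷ []) _ _ h (fromℕ-mono n≤C) h>0)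
                   (x-near (proj₁ (e-near i∈)) (proj₂ (e-near i∈)))

          -- Otherwise `e` is at most `Cₙ` times as far from the first point as the second point is,
          -- and `far` makes the pair short at `e`.
          close-together : ∀ {i δ} → i ∈[ a ,+ n ⟩ → i ℕ.+ δ ∈[ a ,+ n ⟩ → SameSign (φ i) (φ (i ℕ.+ δ)) →
                  TinyAt Φ φ s i → TinyAt Φ φ s (i ℕ.+ δ) → Cₙ ℕ.* δ ℕ.≤ n
          close-together {i} {zero} _ _ _ _ _ rewrite ℕP.*-zeroʳ Cₙ = ℕ.z≤n
          close-together {i} {suc δ} i∈ j∈ ss (tΦ , tφ , ts) (tΦ′ , tφ′ , _) with ℕP.≤-total (Cₙ ℕ.* suc δ) n
          ... | inj₁ p = p
          ... | inj₂ n≤Cδ = ⊥-elim (exit (add (far {φ′ = φ (i ℕ.+ suc δ)} {Φ′ = Φ (i ℕ.+ suc δ)} 0≤α 0≤β d>0 e∥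
                (φ-step (<N i∈) (<N j∈)) (Φ-step (<N i∈) (<N j∈)) back
                (φ-step (<N i∈) e<N) (Φ-step (<N i∈) e<N) ss (tΦ , tφ) (tΦ′ , tφ′))))
            where
            j : ℕ
            j = i ℕ.+ suc δ
            add : ∀ {A B} → A × B → A × B × (s + s ∥ γ)
            add (p , q) = p , q , half 0≤γ ts
            d>0 : 0# < x j - x i
            d>0 = lin 3 (λ d δ h → d :≈ (one :+ δ) :* h ∷ c 0 :≤ δ ∷ c 0 :< h ∷ [] ⊢ c 0 :< d by # 1 ⊠ # 2 ∷ [])
                    _ _ h (x-step i (suc δ)) (0≤fromℕ δ) h>0
            e∥ : x e - x i ∥ C * (x j - x i)
            e∥ = ∥-mono (lin 6 (λ n C d h D m → n :≤ m ∷ m :≈ C :* D ∷ c 0 :< h ∷ d :≈ D :* h ∷ []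
                            ⊢ n :* h :≤ C :* d by # 0 ⊠ # 2 ∷ h ⊡ # 1 ∷ C ⊡ # 3 ∷ [])
                            (fromℕ n) C (x j - x i) h (fromℕ (suc δ)) _ (fromℕ-mono n≤Cδ) (fromℕ-* Cₙ (suc δ)) h>0 (x-step i (suc δ)))
                   (x-near (proj₁ (e-near i∈)) (proj₂ (e-near i∈)))
            back : Φ-Increment s (- (x j - x i)) (φ j) (Φ j) (Φ i)
            back with Φ-step (<N j∈) (<N i∈)
            ... | v , w , V , W , eq = v , w , V , W , trans eq
              (lin 6 (λ v w φ s a b → [] ⊢ v :* (φ :* (a :- b)) :+ w :* (s :* ((a :- b) :* (a :- b)))
                  :≈ v :* (φ :* :- (b :- a)) :+ w :* (s :* (:- (b :- a) :* :- (b :- a)))) v w (φ j) s (x i) (x j))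

          -- The tiny points are split by the sign of φ, as `far` requires. Each class contributes
          -- at most n + C by `count-spread`, and C ≤ n by `long`; hence the 4.
          sparse-from : Cₙ ℕ.* count (TinyAt Φ φ s) a n ℕ.≤ 4 ℕ.* n
          sparse-from with em {∃[ i ] i ∈[ a ,+ n ⟩ × TinyAt Φ φ s i}
          ... | no ¬t rewrite count-∅ {TinyAt Φ φ s} a n (λ {i} i∈ t → ¬t (i , i∈ , t)) | ℕP.*-zeroʳ Cₙ = ℕ.z≤n
          ... | yes (_ , i∈₀ , t₀) =
            linℕ 5 (λ C p q r n → p :≤ q :+ r ∷ C :* q :≤ n :+ C ∷ C :* r :≤ n :+ C ∷ C :≤ n ∷ c 0 :≤ C ∷ []
                ⊢ C :* p :≤ c 4 :* n by # 0 ⊠ # 4 ∷ [])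
              Cₙ (count (TinyAt Φ φ s) a n) (count P a n) (count Q a n) n split
              (count-spread P Cₙ n a n (λ i∈ j∈ p q → close-together i∈ j∈ (inj₁ (proj₂ p , proj₂ q)) (proj₁ p) (proj₁ q)))
              (count-spread Q Cₙ n a n (λ i∈ j∈ p q → close-together i∈ j∈ (inj₂ (proj₂ p , proj₂ q)) (proj₁ p) (proj₁ q)))
              (long i∈₀ t₀) ℕ.z≤n
            where
            P Q : ℕ → Set
            P i = TinyAt Φ φ s i × 0# ≤ φ i
            Q i = TinyAt Φ φ s i × φ i ≤ 0#
            split : count (TinyAt Φ φ s) a n ℕ.≤ count P a n ℕ.+ count Q a n
            split = count-⊎ a n (λ {i} _ t → Sum.map (t ,_) (t ,_) (≤-total 0# (φ i)))

        sparse : ∀ {a n} → a ℕ.+ n ℕ.≤ N →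
                 (∃[ a′ ] a ≡ suc a′ × ¬ ShortAt Φ φ s a′) ⊎ (a ℕ.+ n ℕ.< N × ¬ ShortAt Φ φ s (a ℕ.+ n)) →
                 Cₙ ℕ.* count (TinyAt Φ φ s) a n ℕ.≤ 4 ℕ.* n
        sparse {a} {n} a+n≤N (inj₂ (lt , ¬short)) = sparse-from a+n≤N lt
          (λ {i} (p , q) → linℕ 3 (λ a i n → a :≤ i ∷ [] ⊢ a :+ n :≤ i :+ n) a i n p
                         , linℕ 3 (λ a i n → i :< a :+ n ∷ [] ⊢ i :≤ a :+ n :+ n) a i n q) ¬short
        sparse {a} {n} a+n≤N (inj₁ (a′ , ≡.refl , ¬short)) with n
        ... | zero rewrite ℕP.*-zeroʳ Cₙ = ℕ.z≤n
        ... | suc n′ = sparse-from a+n≤N (ℕP.≤-trans (ℕP.m≤m+n a _) a+n≤N)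
          (λ {i} (p , q) → linℕ 3 (λ a i n → one :+ a :≤ i ∷ [] ⊢ a :≤ i :+ n) a′ i (suc n′) p
                         , linℕ 3 (λ a i n → i :< one :+ a :+ n ∷ [] ⊢ i :≤ a :+ n) a′ i (suc n′) q) ¬short

-- Integer vectors

open ℕ-Linear using (module ℤL)

record ℤ³ : Set where
  constructor ⟪_⨾_⨾_⟫
  field
    x y z : ℤ

infix  7 _·_ _⨯_ _•_
infix  4 _⟂_

_·_ : ℤ³ → ℤ³ → ℤ
⟪ a ⨾ b ⨾ c ⟫ · ⟪ a′ ⨾ b′ ⨾ c′ ⟫ = a ℤ.* a′ ℤ.+ b ℤ.* b′ ℤ.+ c ℤ.* c′

_⨯_ : ℤ³ → ℤ³ → ℤ³
⟪ a ⨾ b ⨾ c ⟫ ⨯ ⟪ a′ ⨾ b′ ⨾ c′ ⟫ =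
  ⟪ b ℤ.* c′ ℤ.- c ℤ.* b′ ⨾ c ℤ.* a′ ℤ.- a ℤ.* c′ ⨾ a ℤ.* b′ ℤ.- b ℤ.* a′ ⟫

_•_ : ℤ → ℤ³ → ℤ³
k • ⟪ a ⨾ b ⨾ c ⟫ = ⟪ k ℤ.* a ⨾ k ℤ.* b ⨾ k ℤ.* c ⟫

0³ : ℤ³
0³ = ⟪ + 0 ⨾ + 0 ⨾ + 0 ⟫

ext : ∀ {a b c a′ b′ c′} → a ≡ a′ → b ≡ b′ → c ≡ c′ → ⟪ a ⨾ b ⨾ c ⟫ ≡ ⟪ a′ ⨾ b′ ⨾ c′ ⟫
ext ≡.refl ≡.refl ≡.refl = ≡.refl

-- Primitivity as a Bézout relation: pairing with `dualvec` reads off the factor of any integer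
-- multiple of `vector`.
record Primitive : Set where
  field
    vector  : ℤ³
    dualvec : ℤ³
    unit    : dualvec · vector ≡ + 1

_⟂_ : Primitive → Primitive → Set
u ⟂ v = Primitive.vector u · Primitive.vector v ≡ + 0

0·-zero : ∀ a → a · 0³ ≡ + 0
0·-zero ⟪ a ⨾ b ⨾ c′ ⟫ = ℤL.lin 3 (λ x y z → [] ⊢ x :* c 0 :+ y :* c 0 :+ z :* c 0 :≈ c 0) a b c′

primitive≢0 : ∀ u → ¬ Primitive.vector u ≡ 0³
primitive≢0 u e with ≡.trans (≡.sym (0·-zero (Primitive.dualvec u))) (≡.trans (cong (Primitive.dualvec u ·_) (≡.sym e)) (Primitive.unit u))
... | ()

-- a ⨯ (v ⨯ w) = (a · w) v - (a · v) w, with a · v = 1.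
parallel : ∀ v {w} → Primitive.vector v ⨯ w ≡ 0³ → w ≡ (Primitive.dualvec v · w) • Primitive.vector v
parallel record { vector = ⟪ a ⨾ b ⨾ d ⟫ ; dualvec = ⟪ x ⨾ y ⨾ z ⟫ ; unit = u } {⟪ a′ ⨾ b′ ⨾ d′ ⟫} e = ext
  (ℤL.lin 9 (λ a b d x y z a′ b′ d′ → b :* d′ :- d :* b′ :≈ c 0 ∷ d :* a′ :- a :* d′ :≈ c 0 ∷ a :* b′ :- b :* a′ :≈ c 0 ∷ x :* a :+ y :* b :+ z :* d :≈ one ∷ []
     ⊢ a′ :≈ (x :* a′ :+ y :* b′ :+ z :* d′) :* a by a′ ⊡ # 3 ∷ y ⊡ # 2 ∷ z ⊡ # 1 ∷ []) a b d x y z a′ b′ d′ e₁ e₂ e₃ u)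
  (ℤL.lin 9 (λ a b d x y z a′ b′ d′ → b :* d′ :- d :* b′ :≈ c 0 ∷ d :* a′ :- a :* d′ :≈ c 0 ∷ a :* b′ :- b :* a′ :≈ c 0 ∷ x :* a :+ y :* b :+ z :* d :≈ one ∷ []
     ⊢ b′ :≈ (x :* a′ :+ y :* b′ :+ z :* d′) :* b by b′ ⊡ # 3 ∷ x ⊡ # 2 ∷ z ⊡ # 0 ∷ []) a b d x y z a′ b′ d′ e₁ e₂ e₃ u)
  (ℤL.lin 9 (λ a b d x y z a′ b′ d′ → b :* d′ :- d :* b′ :≈ c 0 ∷ d :* a′ :- a :* d′ :≈ c 0 ∷ a :* b′ :- b :* a′ :≈ c 0 ∷ x :* a :+ y :* b :+ z :* d :≈ one ∷ []
     ⊢ d′ :≈ (x :* a′ :+ y :* b′ :+ z :* d′) :* d by d′ ⊡ # 3 ∷ x ⊡ # 1 ∷ y ⊡ # 0 ∷ []) a b d x y z a′ b′ d′ e₁ e₂ e₃ u)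
  where
  e₁ = cong ℤ³.x e
  e₂ = cong ℤ³.y e
  e₃ = cong ℤ³.z e

⨯-⟂ˡ : ∀ u w → (u ⨯ w) · u ≡ + 0
⨯-⟂ˡ ⟪ a ⨾ b ⨾ d ⟫ ⟪ a′ ⨾ b′ ⨾ d′ ⟫ = ℤL.lin 6 (λ a b d a′ b′ d′ → []
  ⊢ (b :* d′ :- d :* b′) :* a :+ (d :* a′ :- a :* d′) :* b :+ (a :* b′ :- b :* a′) :* d :≈ c 0) a b d a′ b′ d′

-- u ⨯ (v ⨯ w) = (u · w) v - (u · v) w.
⨯-⨯-zero : ∀ u v w → v · u ≡ + 0 → w · u ≡ + 0 → u ⨯ (v ⨯ w) ≡ 0³
⨯-⨯-zero ⟪ x ⨾ y ⨾ z ⟫ ⟪ a ⨾ b ⨾ d ⟫ ⟪ a′ ⨾ b′ ⨾ d′ ⟫ p q = ext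
  (ℤL.lin 9 (λ a b d x y z a′ b′ d′ → a :* x :+ b :* y :+ d :* z :≈ c 0 ∷ a′ :* x :+ b′ :* y :+ d′ :* z :≈ c 0 ∷ []
    ⊢ y :* (a :* b′ :- b :* a′) :- z :* (d :* a′ :- a :* d′) :≈ c 0 by a′ ⊡ # 0 ∷ a ⊡ # 1 ∷ []) a b d x y z a′ b′ d′ p q)
  (ℤL.lin 9 (λ a b d x y z a′ b′ d′ → a :* x :+ b :* y :+ d :* z :≈ c 0 ∷ a′ :* x :+ b′ :* y :+ d′ :* z :≈ c 0 ∷ []
    ⊢ z :* (b :* d′ :- d :* b′) :- x :* (a :* b′ :- b :* a′) :≈ c 0 by b′ ⊡ # 0 ∷ b ⊡ # 1 ∷ []) a b d x y z a′ b′ d′ p q)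
  (ℤL.lin 9 (λ a b d x y z a′ b′ d′ → a :* x :+ b :* y :+ d :* z :≈ c 0 ∷ a′ :* x :+ b′ :* y :+ d′ :* z :≈ c 0 ∷ []
    ⊢ x :* (d :* a′ :- a :* d′) :- y :* (b :* d′ :- d :* b′) :≈ c 0 by d′ ⊡ # 0 ∷ d ⊡ # 1 ∷ []) a b d x y z a′ b′ d′ p q)

•-· : ∀ k v u → (k • v) · u ≡ k ℤ.* (v · u)
•-· k ⟪ a ⨾ b ⨾ d ⟫ ⟪ x ⨾ y ⨾ z ⟫ = ℤL.lin 7 (λ k a b d x y z → []
  ⊢ k :* a :* x :+ k :* b :* y :+ k :* d :* z :≈ k :* (a :* x :+ b :* y :+ d :* z)) k a b d x y z

·-• : ∀ a k v → a · (k • v) ≡ k ℤ.* (a · v)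
·-• ⟪ a ⨾ b ⨾ d ⟫ k ⟪ x ⨾ y ⨾ z ⟫ = ℤL.lin 7 (λ k a b d x y z → []
  ⊢ a :* (k :* x) :+ b :* (k :* y) :+ d :* (k :* z) :≈ k :* (a :* x :+ b :* y :+ d :* z)) k a b d x y z

0• : ∀ v → + 0 • v ≡ 0³
0• ⟪ _ ⨾ _ ⨾ _ ⟫ = ≡.refl

nonzero-factor : ∀ {k v w} → w ≡ k • v → ¬ w ≡ 0³ → ¬ k ≡ + 0
nonzero-factor {v = v} e w≢0 ≡.refl = w≢0 (≡.trans e (0• v))

-- From (u ⨯ w) · u = 0 follows m (v · u) = 0, and ℤ has no zero divisors.
⟂-of-multiple : ∀ u w v m → ¬ m ≡ + 0 → Primitive.vector u ⨯ w ≡ m • Primitive.vector v → v ⟂ u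
⟂-of-multiple u w v m m≢0 e = [ (λ m≡0 → ⊥-elim (m≢0 m≡0)) , (λ z → z) ]
  (ℤP.i*j≡0⇒i≡0∨j≡0 m {vector v · vector u}
    (≡.trans (≡.sym (•-· m (vector v) (vector u))) (≡.trans (cong (_· vector u) (≡.sym e)) (⨯-⟂ˡ (vector u) w))))
  where open Primitive

module _ (em : ExcludedMiddle 0ℓ) where

  least : ∀ (P : ℕ → Set) {n} → P n → ∃[ m ] P m × (∀ {k} → k ℕ.< m → ¬ P k)
  least P {n} p = go n p
    where
    below : ∀ n → (∃[ m ] P m × (∀ {k} → k ℕ.< m → ¬ P k)) ⊎ (∀ {k} → k ℕ.< n → ¬ P k)
    below zero = inj₂ λ ()
    below (suc n) with below n
    ... | inj₁ r = inj₁ r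
    ... | inj₂ h with em {P n}
    ...   | yes p = inj₁ (n , p , h)
    ...   | no ¬p = inj₂ λ {k} k< → [ h , (λ { ≡.refl → ¬p }) ] (ℕP.m≤n⇒m<n∨m≡n (ℕP.≤-pred k<))
    go : ∀ n → P n → ∃[ m ] P m × (∀ {k} → k ℕ.< m → ¬ P k)
    go n p with below n
    ... | inj₁ r = r
    ... | inj₂ h = n , p , h

  -- The least positive value d = a · w divides the coordinates of w.
  primitive-part : ∀ w → ¬ w ≡ 0³ → ∃[ v ] ∃[ k ] ¬ k ≡ + 0 × w ≡ k • Primitive.vector v
  primitive-part w@(⟪ x ⨾ y ⨾ z ⟫) w≢0 = result (least Value (proj₂ start))
    where
    Value : ℕ → Set
    Value n = ∃[ a ] a · w ≡ + suc n

    scaled : ∀ i a → ¬ i ≡ + 0 → a · w ≡ i → ∃ Value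
    scaled (+ zero)  a i≢0 e = ⊥-elim (i≢0 ≡.refl)
    scaled (+ suc n) a i≢0 e = n , a , e
    scaled -[1+ n ]  a i≢0 e = n , -[1+ 0 ] • a , ≡.trans (•-· -[1+ 0 ] a w) (≡.trans (cong (-[1+ 0 ] ℤ.*_) e)
                                 (ℤP.-1*i≡-i -[1+ n ]))

    i₁ i₂ i₃ : ℤ³
    i₁ = ⟪ + 1 ⨾ + 0 ⨾ + 0 ⟫
    i₂ = ⟪ + 0 ⨾ + 1 ⨾ + 0 ⟫
    i₃ = ⟪ + 0 ⨾ + 0 ⨾ + 1 ⟫

    e₁ : ∀ x y z → i₁ · ⟪ x ⨾ y ⨾ z ⟫ ≡ x
    e₁ = ℤL.lin 3 (λ x y z → [] ⊢ c 1 :* x :+ c 0 :* y :+ c 0 :* z :≈ x)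
    e₂ : ∀ x y z → i₂ · ⟪ x ⨾ y ⨾ z ⟫ ≡ y
    e₂ = ℤL.lin 3 (λ x y z → [] ⊢ c 0 :* x :+ c 1 :* y :+ c 0 :* z :≈ y)
    e₃ : ∀ x y z → i₃ · ⟪ x ⨾ y ⨾ z ⟫ ≡ z
    e₃ = ℤL.lin 3 (λ x y z → [] ⊢ c 0 :* x :+ c 0 :* y :+ c 1 :* z :≈ z)

    start : ∃ Value
    start with x ℤP.≟ + 0 | y ℤP.≟ + 0 | z ℤP.≟ + 0
    ... | no x≢0 | _ | _ = scaled x i₁ x≢0 (e₁ x y z)
    ... | yes _ | no y≢0 | _ = scaled y i₂ y≢0 (e₂ x y z)
    ... | yes _ | yes _ | no z≢0 = scaled z i₃ z≢0 (e₃ x y z)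
    ... | yes p | yes q | yes r = ⊥-elim (w≢0 (ext p q r))

    result : (∃[ n ] Value n × (∀ {k} → k ℕ.< n → ¬ Value k)) →
             ∃[ v ] ∃[ k ] ¬ k ≡ + 0 × w ≡ k • Primitive.vector v
    result (n , (a , e) , minimal) = record
      { vector = ⟪ quot x ⨾ quot y ⨾ quot z ⟫ ; dualvec = a ; unit = one-unit } , d , (λ ()) , w≡
      where
      d : ℤ
      d = + suc n
      quot : ℤ → ℤ
      quot i = i ℤD./ℕ suc n

      -- r = i - (i / d) d = (b - (i / d) a) · w
      divides : ∀ i b → b · w ≡ i → i ≡ d ℤ.* quot i
      divides i b e′ with i ℤD.%ℕ suc n in r≡ | ℤD.n%ℕd<d i (suc n) | ℤD.a≡a%ℕn+[a/ℕn]*n i (suc n)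
      ... | zero  | _   | i≡ = ≡.trans i≡ (≡.trans (ℤP.+-identityˡ _) (ℤP.*-comm (quot i) d))
      ... | suc r | r<d | i≡ = ⊥-elim (minimal (ℕP.≤-pred r<d) (sub b a , value))
        where
        sub : ℤ³ → ℤ³ → ℤ³
        sub ⟪ b₁ ⨾ b₂ ⨾ b₃ ⟫ ⟪ a₁ ⨾ a₂ ⨾ a₃ ⟫ = ⟪ b₁ ℤ.- quot i ℤ.* a₁ ⨾ b₂ ℤ.- quot i ℤ.* a₂ ⨾ b₃ ℤ.- quot i ℤ.* a₃ ⟫
        sub-· : ∀ b a → sub b a · w ≡ b · w ℤ.- quot i ℤ.* (a · w)
        sub-· ⟪ b₁ ⨾ b₂ ⨾ b₃ ⟫ ⟪ a₁ ⨾ a₂ ⨾ a₃ ⟫ = ℤL.lin 10 (λ b₁ b₂ b₃ a₁ a₂ a₃ x y z t → []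
          ⊢ (b₁ :- t :* a₁) :* x :+ (b₂ :- t :* a₂) :* y :+ (b₃ :- t :* a₃) :* z
              :≈ b₁ :* x :+ b₂ :* y :+ b₃ :* z :- t :* (a₁ :* x :+ a₂ :* y :+ a₃ :* z))
          b₁ b₂ b₃ a₁ a₂ a₃ x y z (quot i)
        value : sub b a · w ≡ + suc r
        value = ≡.trans (sub-· b a) (ℤL.lin 6 (λ bw aw i t d r → bw :≈ i ∷ aw :≈ d ∷ i :≈ r :+ t :* d ∷ [] ⊢ bw :- t :* aw :≈ r
                  by t ⊡ # 1 ∷ []) (b · w) (a · w) i (quot i) d (+ suc r) e′ e i≡)

      w≡ : w ≡ d • ⟪ quot x ⨾ quot y ⨾ quot z ⟫
      w≡ = ext (divides x i₁ (e₁ x y z)) (divides y i₂ (e₂ x y z)) (divides z i₃ (e₃ x y z))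

      one-unit : a · ⟪ quot x ⨾ quot y ⨾ quot z ⟫ ≡ + 1
      one-unit = ℤP.*-cancelˡ-≡ d _ _ (≡.trans (≡.sym (·-• a d ⟪ quot x ⨾ quot y ⨾ quot z ⟫))
                   (≡.trans (cong (a ·_) (≡.sym w≡)) (≡.trans e (≡.sym (ℤP.*-identityʳ d)))))

-- Nondivergence

data Side : Set where
  point line : Side

dual : Side → Side
dual point = line
dual line  = point

sides : ∀ T T′ → T′ ≡ T ⊎ T′ ≡ dual T
sides point point = inj₁ ≡.refl
sides point line  = inj₂ ≡.refl
sides line  point = inj₂ ≡.refl
sides line  line  = inj₁ ≡.refl

module PointsAndLines (em : ExcludedMiddle 0ℓ) (R : CompleteOrderedField) where

  open Real em R
  open Counting em
  open Grids em R

  fromℤ-det : ∀ a b c′ d → fromℤ (a ℤ.* b ℤ.- c′ ℤ.* d) ≈ fromℤ a * fromℤ b - fromℤ c′ * fromℤ d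
  fromℤ-det a b c′ d = trans (fromℤ-sub (a ℤ.* b) (c′ ℤ.* d)) (+-cong (fromℤ-* a b) (-‿cong (fromℤ-* c′ d)))

  fromℤ-dot : ∀ a b c′ a′ b′ d′ → fromℤ (a ℤ.* a′ ℤ.+ b ℤ.* b′ ℤ.+ c′ ℤ.* d′) ≈
              fromℤ a * fromℤ a′ + fromℤ b * fromℤ b′ + fromℤ c′ * fromℤ d′
  fromℤ-dot a b c′ a′ b′ d′ = trans (fromℤ-+ (a ℤ.* a′ ℤ.+ b ℤ.* b′) (c′ ℤ.* d′))
    (+-cong (trans (fromℤ-+ (a ℤ.* a′) (b ℤ.* b′)) (+-cong (fromℤ-* a a′) (fromℤ-* b b′))) (fromℤ-* c′ d′))

  small-integer : ∀ {k b} → b < 1# → fromℤ k ∥ b → k ≡ + 0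
  small-integer {k} {b} b<1 (p , q) with k ℤP.≟ + 0
  ... | yes e = e
  ... | no ne with fromℤ-≥1 k ne
  ...   | inj₁ 1≤k = ⊥-elim (≤⇒≯ (lin 2 (λ k b → one :≤ k ∷ k :≤ b ∷ [] ⊢ one :≤ b) _ _ 1≤k q) b<1)
  ...   | inj₂ k≤-1 = ⊥-elim (≤⇒≯ (lin 2 (λ k b → k :≤ :- one ∷ :- b :≤ k ∷ [] ⊢ one :≤ b) _ _ k≤-1 p) b<1)

  module Nondivergence
    (μ : ℝ) (1≤μ : 1# ≤ μ) (Cₙ : ℕ) (1≤Cₙ : 1 ℕ.≤ Cₙ)
    (ζ : ℝ) (0≤ζ : 0# ≤ ζ) (ζ-small : fromℕ 42 * (μ * (μ * μ) * (fromℕ Cₙ * fromℕ Cₙ) * ζ) ≤ 1#)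
    (x₀ ψ K Q : ℝ) (ψ>0 : 0# < ψ) (K>0 : 0# < K) (Q>0 : 0# < Q) (ψKQ≈1 : ψ * (K * Q) ≈ 1#) (K≤1 : K ≤ 1#) (ψ≤1 : ψ ≤ 1#)
    (k : ℕ) where

    -- As ψ K Q = 1, ψ K² is K / Q, the distance from `x i` of a rational point with |B| ≤ ζ K and q
    -- ≥ ζ Q. The step also satisfies h ≤ 4 α / β and h ≤ 4 β / γ on both sides, as `near` requires.
    h : ℝ
    h = fromℕ 4 * (ψ * (K * K))

    ψK>0 : 0# < ψ * K
    ψK>0 = *-pos ψ>0 K>0

    abstract
      h>0 : 0# < h
      h>0 = lin 2 (λ p K → c 0 :< p :* K ∷ c 0 :< K ∷ [] ⊢ c 0 :< c 4 :* (p :* (K :* K)) by # 0 ⊠ # 1 ∷ []) ψ K ψK>0 K>0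

    -- An odd number of points, so that `x k` is the midpoint; `nonshort` moves from it in either
    -- direction.
    N : ℕ
    N = suc (k ℕ.+ k)

    open Grid μ 1≤μ Cₙ 1≤Cₙ ζ 0≤ζ ζ-small x₀ h h>0 N public

    module Curve (g g′ : ℕ → ℝ)
      (slope  : ∀ {i j} → i ℕ.< N → j ℕ.< N → ∃[ w ] Weight w × g′ j - g′ i ≈ w * (x j - x i))
      (taylor : ∀ {i j} → i ℕ.< N → j ℕ.< N →
                ∃[ w ] Weight w × g j - g i ≈ g′ i * (x j - x i) + w * ((x j - x i) * (x j - x i)))
      (wide   : μ * ψ < fromℕ k * h) (wide² : μ * ψ < (fromℕ k * h) * (fromℕ k * h)) where

      -- A point (q , p₁ , p₂) stands for (p₁/q , p₂/q), and a line
      -- (n₀ , n₁ , n₂) for n₀ + n₁ X + n₂ Y = 0.  For a point, φ and Φ are q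
      -- times the distances to x i and to the tangent at x i; for a line, they
      -- are the derivative and the value at x i of n₀ + n₁ x + n₂ g(x).
      Φ φ : Side → ℤ³ → ℕ → ℝ
      s   : Side → ℤ³ → ℝ
      Φ point ⟪ q ⨾ p₁ ⨾ p₂ ⟫ i = fromℤ p₂ - fromℤ q * g i + g′ i * (fromℤ q * x i - fromℤ p₁)
      Φ line  ⟪ n₀ ⨾ n₁ ⨾ n₂ ⟫ i = fromℤ n₀ + fromℤ n₁ * x i + fromℤ n₂ * g i
      φ point ⟪ q ⨾ p₁ ⨾ p₂ ⟫ i = fromℤ q * x i - fromℤ p₁
      φ line  ⟪ n₀ ⨾ n₁ ⨾ n₂ ⟫ i = fromℤ n₁ + fromℤ n₂ * g′ i
      s point ⟪ q ⨾ p₁ ⨾ p₂ ⟫   = fromℤ q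
      s line  ⟪ n₀ ⨾ n₁ ⨾ n₂ ⟫   = fromℤ n₂

      -- By ψ K Q = 1 the box of lines has the sides 1/Q, 1/K, 1/ψ, dual to the sides ψ, K, Q for
      -- points. On either side the products α β, α γ, β γ are the α, β, γ of the other, which is
      -- what cross products need.
      α β γ : Side → ℝ
      α point = ψ
      α line  = ψ * K
      β point = K
      β line  = ψ * Q
      γ point = Q
      γ line  = K * Q

      abstract
        0≤α : ∀ T → 0# ≤ α T
        0≤α point = <⇒≤ ψ>0
        0≤α line  = <⇒≤ ψK>0
        0≤β : ∀ T → 0# ≤ β T
        0≤β point = <⇒≤ K>0
        0≤β line  = <⇒≤ (*-pos ψ>0 Q>0)
        0≤γ : ∀ T → 0# ≤ γ T
        0≤γ point = <⇒≤ Q>0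
        0≤γ line  = <⇒≤ (*-pos K>0 Q>0)

        K³≤1 : K * (K * K) ≤ 1#
        K³≤1 = lin 1 (λ K → c 0 :< K ∷ K :≤ one ∷ [] ⊢ K :* (K :* K) :≤ one by # 0 ⊠ # 0 ⊠ # 1 ∷ # 0 ⊠ # 1 ∷ []) K K>0 K≤1

        βh≤4α : ∀ T → β T * h ≤ fromℕ 4 * α T
        βh≤4α point = lin 2 (λ p K → c 0 :< p ∷ K :* (K :* K) :≤ one ∷ [] ⊢ K :* (c 4 :* (p :* (K :* K))) :≤ c 4 :* p by # 0 ⊠ # 1 ∷ [])
                        ψ K ψ>0 K³≤1
        βh≤4α line = ≈⇒≤ (lin 3 (λ p K Q → p :* (K :* Q) :≈ one ∷ [] ⊢ p :* Q :* (c 4 :* (p :* (K :* K))) :≈ c 4 :* (p :* K)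
                        by p :* K ⊡ # 0 ∷ []) ψ K Q ψKQ≈1)

        γh≤4β : ∀ T → γ T * h ≤ fromℕ 4 * β T
        γh≤4β point = ≈⇒≤ (lin 3 (λ p K Q → p :* (K :* Q) :≈ one ∷ [] ⊢ Q :* (c 4 :* (p :* (K :* K))) :≈ c 4 :* K
                        by K ⊡ # 0 ∷ []) ψ K Q ψKQ≈1)
        γh≤4β line = lin 3 (λ p K Q → c 0 :< p :* Q ∷ K :* (K :* K) :≤ one ∷ [] ⊢ K :* Q :* (c 4 :* (p :* (K :* K))) :≤ c 4 :* (p :* Q)
                        by # 0 ⊠ # 1 ∷ []) ψ K Q (*-pos ψ>0 Q>0) K³≤1

      module Scaleᵀ (T : Side) = Scale (α T) (β T) (γ T) (0≤α T) (0≤β T) (0≤γ T) (βh≤4α T) (γh≤4β T)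

      ShortV TinyV : Side → ℤ³ → ℕ → Set
      ShortV T v = Scaleᵀ.ShortAt T (Φ T v) (φ T v) (s T v)
      TinyV  T v = Scaleᵀ.TinyAt T (Φ T v) (φ T v) (s T v)

      quad : ∀ T v → QuadraticPair (Φ T v) (φ T v) (s T v)
      quad point ⟪ q ⨾ p₁ ⨾ p₂ ⟫ = record
        { φ-step = λ {i} {j} _ _ → 1# , weight-1 ,
            lin 4 (λ q p a b → [] ⊢ q :* b :- p :- (q :* a :- p) :≈ q :* (one :* (b :- a))) (fromℤ q) (fromℤ p₁) (x i) (x j)
        -- Expanding `g` backwards from `x j` turns the tangent term at `x j` into `g′ j * φ i`, so
        -- that the linear part of the increment is `(g′ j - g′ i) * φ i`.
        ; Φ-step = λ {i} {j} i< j< → step (slope i< j<) (taylor j< i<) }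
        where
        step : ∀ {i j} → ∃[ w ] Weight w × g′ j - g′ i ≈ w * (x j - x i) →
               ∃[ w ] Weight w × g i - g j ≈ g′ j * (x i - x j) + w * ((x i - x j) * (x i - x j)) →
               Φ-Increment (fromℤ q) (x j - x i) (φ point ⟪ q ⨾ p₁ ⨾ p₂ ⟫ i) (Φ point ⟪ q ⨾ p₁ ⨾ p₂ ⟫ i) (Φ point ⟪ q ⨾ p₁ ⨾ p₂ ⟫ j)
        step {i} {j} (v , V , e) (w , W , e′) = v , w , V , W ,
          lin 11 (λ q p₁ p₂ a b g G g′ G′ v w → G′ :- g′ :≈ v :* (b :- a) ∷ g :- G :≈ G′ :* (a :- b) :+ w :* ((a :- b) :* (a :- b)) ∷ []
            ⊢ p₂ :- q :* G :+ G′ :* (q :* b :- p₁) :- (p₂ :- q :* g :+ g′ :* (q :* a :- p₁))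
              :≈ v :* ((q :* a :- p₁) :* (b :- a)) :+ w :* (q :* ((b :- a) :* (b :- a)))
            by q :* a :- p₁ ⊡ # 0 ∷ q ⊡ # 1 ∷ [])
            (fromℤ q) (fromℤ p₁) (fromℤ p₂) (x i) (x j) (g i) (g j) (g′ i) (g′ j) v w e e′
      quad line ⟪ n₀ ⨾ n₁ ⨾ n₂ ⟫ = record
        { φ-step = λ {i} {j} i< j< → φ-step (slope i< j<)
        ; Φ-step = λ {i} {j} i< j< → Φ-step (taylor i< j<) }
        where
        φ-step : ∀ {i j} → ∃[ w ] Weight w × g′ j - g′ i ≈ w * (x j - x i) →
                 φ-Increment (fromℤ n₂) (x j - x i) (fromℤ n₁ + fromℤ n₂ * g′ i) (fromℤ n₁ + fromℤ n₂ * g′ j)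
        φ-step {i} {j} (w , W , e) = w , W ,
          lin 6 (λ n m g G w d → G :- g :≈ w :* d ∷ [] ⊢ n :+ m :* G :- (n :+ m :* g) :≈ m :* (w :* d) by m ⊡ # 0 ∷ [])
            (fromℤ n₁) (fromℤ n₂) (g′ i) (g′ j) w (x j - x i) e
        Φ-step : ∀ {i j} → ∃[ w ] Weight w × g j - g i ≈ g′ i * (x j - x i) + w * ((x j - x i) * (x j - x i)) →
                 Φ-Increment (fromℤ n₂) (x j - x i) (fromℤ n₁ + fromℤ n₂ * g′ i)
                   (fromℤ n₀ + fromℤ n₁ * x i + fromℤ n₂ * g i) (fromℤ n₀ + fromℤ n₁ * x j + fromℤ n₂ * g j)
        Φ-step {i} {j} (w , W , e) = 1# , w , weight-1 , W ,
          lin 9 (λ l n m a b g G g′ w → G :- g :≈ g′ :* (b :- a) :+ w :* ((b :- a) :* (b :- a)) ∷ []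
            ⊢ l :+ n :* b :+ m :* G :- (l :+ n :* a :+ m :* g) :≈ one :* ((n :+ m :* g′) :* (b :- a)) :+ w :* (m :* ((b :- a) :* (b :- a)))
            by m ⊡ # 0 ∷ [])
            (fromℤ n₀) (fromℤ n₁) (fromℤ n₂) (x i) (x j) (g i) (g j) (g′ i) w e

      -- At each grid point, (Φ , φ , s) are coordinates obtained by a matrix of determinant 1, for
      -- points as well as for lines. In them the cross product has the 2 × 2 minors as coordinates,
      -- and `dot` pairs the two frames.
      Cross : Side → ℤ³ → ℤ³ → ℕ → Set
      Cross T u v i =
        (Φ (dual T) (u ⨯ v) i ≈ Φ T u i * φ T v i - φ T u i * Φ T v i) ×
        (φ (dual T) (u ⨯ v) i ≈ Φ T u i * s T v - s T u * Φ T v i) ×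
        (s (dual T) (u ⨯ v) ≈ φ T u i * s T v - s T u * φ T v i)

      cross : ∀ T u v i → Cross T u v i
      cross point ⟪ q ⨾ p₁ ⨾ p₂ ⟫ ⟪ q′ ⨾ p₁′ ⨾ p₂′ ⟫ i =
          lin 12 (λ q p r q′ p′ r′ x g d A B D → A :≈ p :* r′ :- r :* p′ ∷ B :≈ r :* q′ :- q :* r′ ∷ D :≈ q :* p′ :- p :* q′ ∷ []
            ⊢ A :+ B :* x :+ D :* g :≈ (r :- q :* g :+ d :* (q :* x :- p)) :* (q′ :* x :- p′) :- (q :* x :- p) :* (r′ :- q′ :* g :+ d :* (q′ :* x :- p′))
            by x ⊡ # 1 ∷ g ⊡ # 2 ∷ [])
            (fromℤ q) (fromℤ p₁) (fromℤ p₂) (fromℤ q′) (fromℤ p₁′) (fromℤ p₂′) (x i) (g i) (g′ i) _ _ _ d₁ d₂ d₃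
        , lin 11 (λ q p r q′ p′ r′ x g d B D → B :≈ r :* q′ :- q :* r′ ∷ D :≈ q :* p′ :- p :* q′ ∷ []
            ⊢ B :+ D :* d :≈ (r :- q :* g :+ d :* (q :* x :- p)) :* q′ :- q :* (r′ :- q′ :* g :+ d :* (q′ :* x :- p′))
            by d ⊡ # 1 ∷ [])
            (fromℤ q) (fromℤ p₁) (fromℤ p₂) (fromℤ q′) (fromℤ p₁′) (fromℤ p₂′) (x i) (g i) (g′ i) _ _ d₂ d₃
        , lin 6 (λ q p q′ p′ x D → D :≈ q :* p′ :- p :* q′ ∷ [] ⊢ D :≈ (q :* x :- p) :* q′ :- q :* (q′ :* x :- p′))
            (fromℤ q) (fromℤ p₁) (fromℤ q′) (fromℤ p₁′) (x i) _ d₃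
        where
        d₁ = fromℤ-det p₁ p₂′ p₂ p₁′
        d₂ = fromℤ-det p₂ q′ q p₂′
        d₃ = fromℤ-det q p₁′ p₁ q′
      cross line ⟪ n₀ ⨾ n₁ ⨾ n₂ ⟫ ⟪ n₀′ ⨾ n₁′ ⨾ n₂′ ⟫ i =
          lin 12 (λ l n m l′ n′ m′ x g d A B D → A :≈ n :* m′ :- m :* n′ ∷ B :≈ m :* l′ :- l :* m′ ∷ D :≈ l :* n′ :- n :* l′ ∷ []
            ⊢ D :- A :* g :+ d :* (A :* x :- B) :≈ (l :+ n :* x :+ m :* g) :* (n′ :+ m′ :* d) :- (n :+ m :* d) :* (l′ :+ n′ :* x :+ m′ :* g)
            by g ⊡ # 0 ∷ d :* x ⊡ # 0 ∷ d ⊡ # 1 ∷ [])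
            (fromℤ n₀) (fromℤ n₁) (fromℤ n₂) (fromℤ n₀′) (fromℤ n₁′) (fromℤ n₂′) (x i) (g i) (g′ i) _ _ _ d₁ d₂ d₃
        , lin 10 (λ l n m l′ n′ m′ x g A B → A :≈ n :* m′ :- m :* n′ ∷ B :≈ m :* l′ :- l :* m′ ∷ []
            ⊢ A :* x :- B :≈ (l :+ n :* x :+ m :* g) :* m′ :- m :* (l′ :+ n′ :* x :+ m′ :* g)
            by x ⊡ # 0 ∷ [])
            (fromℤ n₀) (fromℤ n₁) (fromℤ n₂) (fromℤ n₀′) (fromℤ n₁′) (fromℤ n₂′) (x i) (g i) _ _ d₁ d₂
        , lin 6 (λ n m n′ m′ d A → A :≈ n :* m′ :- m :* n′ ∷ [] ⊢ A :≈ (n :+ m :* d) :* m′ :- m :* (n′ :+ m′ :* d))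
            (fromℤ n₁) (fromℤ n₂) (fromℤ n₁′) (fromℤ n₂′) (g′ i) _ d₁
        where
        d₁ = fromℤ-det n₁ n₂′ n₂ n₁′
        d₂ = fromℤ-det n₂ n₀′ n₀ n₂′
        d₃ = fromℤ-det n₀ n₁′ n₁ n₀′

      αβ≈ : ∀ T → α T * β T ≈ α (dual T)
      αβ≈ point = refl
      αβ≈ line  = lin 3 (λ p K Q → p :* (K :* Q) :≈ one ∷ [] ⊢ p :* K :* (p :* Q) :≈ p by p ⊡ # 0 ∷ []) ψ K Q ψKQ≈1
      αγ≈ : ∀ T → α T * γ T ≈ β (dual T)
      αγ≈ point = refl
      αγ≈ line  = lin 3 (λ p K Q → p :* (K :* Q) :≈ one ∷ [] ⊢ p :* K :* (K :* Q) :≈ K by K ⊡ # 0 ∷ []) ψ K Q ψKQ≈1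
      βγ≈ : ∀ T → β T * γ T ≈ γ (dual T)
      βγ≈ point = refl
      βγ≈ line  = lin 3 (λ p K Q → p :* (K :* Q) :≈ one ∷ [] ⊢ p :* Q :* (K :* Q) :≈ Q by Q ⊡ # 0 ∷ []) ψ K Q ψKQ≈1

      det-bound : ∀ {a b a′ b′ y A B E} → a + a ∥ A → b + b ∥ B → a′ ∥ ζ * A → b′ ∥ ζ * B →
                  A * B ≈ E → y ≈ a * b′ - b * a′ → y ∥ ζ * E
      det-bound {a} {b} {a′} {b′} {y} {A} {B} {E} sa sb ta tb e e′ with ∥-+ (∥-* sa tb) (∥-neg (∥-* sb ta))
      ... | lo , hi =
          lin 9 (λ a b a′ b′ y A B E z → :- (A :* (z :* B) :+ B :* (z :* A)) :≤ (a :+ a) :* b′ :+ :- ((b :+ b) :* a′) ∷ A :* B :≈ E ∷ y :≈ a :* b′ :- b :* a′ ∷ []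
            ⊢ :- (z :* E) :≤ y by z ⊡ # 1 ∷ []) a b a′ b′ y A B E ζ lo e e′
        , lin 9 (λ a b a′ b′ y A B E z → (a :+ a) :* b′ :+ :- ((b :+ b) :* a′) :≤ A :* (z :* B) :+ B :* (z :* A) ∷ A :* B :≈ E ∷ y :≈ a :* b′ :- b :* a′ ∷ []
            ⊢ y :≤ z :* E by z ⊡ # 1 ∷ []) a b a′ b′ y A B E ζ hi e e′

      cross-tiny : ∀ T u v i → ShortV T u i → TinyV T v i → TinyV (dual T) (u ⨯ v) i
      cross-tiny T u v i (sΦ , sφ , ss) (tΦ , tφ , ts) with cross T u v i
      ... | eΦ , eφ , es =
          det-bound sΦ sφ tΦ tφ (αβ≈ T) eΦ
        , det-bound sΦ ss tΦ ts (αγ≈ T) eφ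
        , det-bound sφ ss tφ ts (βγ≈ T) es

      dot : ∀ T u v i → fromℤ (u · v) ≈ Φ T u i * s (dual T) v - φ T u i * φ (dual T) v i + s T u * Φ (dual T) v i
      dot point ⟪ q ⨾ p₁ ⨾ p₂ ⟫ ⟪ n₀ ⨾ n₁ ⨾ n₂ ⟫ i = trans (fromℤ-dot q p₁ p₂ n₀ n₁ n₂)
        (lin 9 (λ q p r l n m x g d → [] ⊢ q :* l :+ p :* n :+ r :* m :≈
           (r :- q :* g :+ d :* (q :* x :- p)) :* m :- (q :* x :- p) :* (n :+ m :* d) :+ q :* (l :+ n :* x :+ m :* g))
          (fromℤ q) (fromℤ p₁) (fromℤ p₂) (fromℤ n₀) (fromℤ n₁) (fromℤ n₂) (x i) (g i) (g′ i))
      dot line ⟪ n₀ ⨾ n₁ ⨾ n₂ ⟫ ⟪ q ⨾ p₁ ⨾ p₂ ⟫ i = trans (fromℤ-dot n₀ n₁ n₂ q p₁ p₂)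
        (lin 9 (λ q p r l n m x g d → [] ⊢ l :* q :+ n :* p :+ m :* r :≈
           (l :+ n :* x :+ m :* g) :* q :- (n :+ m :* d) :* (q :* x :- p) :+ m :* (r :- q :* g :+ d :* (q :* x :- p)))
          (fromℤ q) (fromℤ p₁) (fromℤ p₂) (fromℤ n₀) (fromℤ n₁) (fromℤ n₂) (x i) (g i) (g′ i))

      αγ≈1 : ∀ T → α T * γ (dual T) ≈ 1#
      αγ≈1 point = ψKQ≈1
      αγ≈1 line  = trans (*-assoc ψ K Q) ψKQ≈1
      ββ≈1 : ∀ T → β T * β (dual T) ≈ 1#
      ββ≈1 point = lin 3 (λ p K Q → p :* (K :* Q) :≈ one ∷ [] ⊢ K :* (p :* Q) :≈ one) ψ K Q ψKQ≈1
      ββ≈1 line  = lin 3 (λ p K Q → p :* (K :* Q) :≈ one ∷ [] ⊢ p :* Q :* K :≈ one) ψ K Q ψKQ≈1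
      γα≈1 : ∀ T → γ T * α (dual T) ≈ 1#
      γα≈1 point = lin 3 (λ p K Q → p :* (K :* Q) :≈ one ∷ [] ⊢ Q :* (p :* K) :≈ one) ψ K Q ψKQ≈1
      γα≈1 line  = lin 3 (λ p K Q → p :* (K :* Q) :≈ one ∷ [] ⊢ K :* Q :* p :≈ one) ψ K Q ψKQ≈1

      42ζ≤1 : fromℕ 42 * ζ ≤ 1#
      42ζ≤1 = lin 2 (λ z G → c 42 :* (G :* (z :* one)) :≤ one ∷ one :≤ G ∷ c 0 :≤ z ∷ [] ⊢ c 42 :* z :≤ one by # 1 ⊠ # 2 ∷ [])
                ζ G (42Gζ≤ (<⇒≤ 0<1)) 1≤G 0≤ζ

      short-term : ∀ {a A b B} → a + a ∥ A → b ∥ ζ * B → A * B ≈ 1# → (a + a) * b ∥ ζ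
      short-term {a} {A} {b} {B} p q e = ∥-mono
        (≈⇒≤ (lin 3 (λ A B z → A :* B :≈ one ∷ [] ⊢ A :* (z :* B) :≈ z by z ⊡ # 0 ∷ []) A B ζ e)) (∥-* p q)

      -- By `dot` the integer u · v is a sum of three terms of absolute value at most ζ / 2, hence
      -- less than 1 in absolute value.
      dot-zero : ∀ T u v i → ShortV T u i → TinyV (dual T) v i → u · v ≡ + 0
      dot-zero T u v i (sΦ , sφ , ss) (tΦ , tφ , ts) = small-integer {b = fromℕ 2 * ζ}
        (lin 1 (λ z → c 42 :* z :≤ one ∷ [] ⊢ c 2 :* z :< one) ζ 42ζ≤1)
        (halve (∥-+ (∥-+ (short-term sΦ ts (αγ≈1 T)) (∥-neg (short-term sφ tφ (ββ≈1 T)))) (short-term ss tΦ (γα≈1 T))))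
        where
        halve : (Φ T u i + Φ T u i) * s (dual T) v + - ((φ T u i + φ T u i) * φ (dual T) v i) +
                (s T u + s T u) * Φ (dual T) v i ∥ ζ + ζ + ζ → fromℤ (u · v) ∥ fromℕ 2 * ζ
        halve (lo , hi) =
            lin 8 (λ y a b d a′ b′ d′ z → y :≈ a :* d′ :- b :* b′ :+ d :* a′ ∷ :- (z :+ z :+ z) :≤ (a :+ a) :* d′ :+ :- ((b :+ b) :* b′) :+ (d :+ d) :* a′ ∷ c 0 :≤ z ∷ []
               ⊢ :- (c 2 :* z) :≤ y) _ (Φ T u i) (φ T u i) (s T u) (Φ (dual T) v i) (φ (dual T) v i) (s (dual T) v) ζ (dot T u v i) lo 0≤ζ
          , lin 8 (λ y a b d a′ b′ d′ z → y :≈ a :* d′ :- b :* b′ :+ d :* a′ ∷ (a :+ a) :* d′ :+ :- ((b :+ b) :* b′) :+ (d :+ d) :* a′ :≤ z :+ z :+ z ∷ c 0 :≤ z ∷ []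
               ⊢ y :≤ c 2 :* z) _ (Φ T u i) (φ T u i) (s T u) (Φ (dual T) v i) (φ (dual T) v i) (s (dual T) v) ζ (dot T u v i) hi 0≤ζ

      Scaled : Side → ℤ → ℤ³ → ℕ → Set
      Scaled T m v i = (Φ T (m • v) i ≈ fromℤ m * Φ T v i) × (φ T (m • v) i ≈ fromℤ m * φ T v i) × (s T (m • v) ≈ fromℤ m * s T v)

      scaled : ∀ T m v i → Scaled T m v i
      scaled point m ⟪ q ⨾ p₁ ⨾ p₂ ⟫ i =
          lin 10 (λ m q p r x g d A B D → A :≈ m :* q ∷ B :≈ m :* p ∷ D :≈ m :* r ∷ []
            ⊢ D :- A :* g :+ d :* (A :* x :- B) :≈ m :* (r :- q :* g :+ d :* (q :* x :- p))
            by g ⊡ # 0 ∷ d :* x ⊡ # 0 ∷ d ⊡ # 1 ∷ [])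
            (fromℤ m) (fromℤ q) (fromℤ p₁) (fromℤ p₂) (x i) (g i) (g′ i) _ _ _ (fromℤ-* m q) (fromℤ-* m p₁) (fromℤ-* m p₂)
        , lin 6 (λ m q p x A B → A :≈ m :* q ∷ B :≈ m :* p ∷ [] ⊢ A :* x :- B :≈ m :* (q :* x :- p) by x ⊡ # 0 ∷ [])
            (fromℤ m) (fromℤ q) (fromℤ p₁) (x i) _ _ (fromℤ-* m q) (fromℤ-* m p₁)
        , fromℤ-* m q
      scaled line m ⟪ n₀ ⨾ n₁ ⨾ n₂ ⟫ i =
          lin 9 (λ m l n r x g A B D → A :≈ m :* l ∷ B :≈ m :* n ∷ D :≈ m :* r ∷ []
            ⊢ A :+ B :* x :+ D :* g :≈ m :* (l :+ n :* x :+ r :* g) by x ⊡ # 1 ∷ g ⊡ # 2 ∷ [])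
            (fromℤ m) (fromℤ n₀) (fromℤ n₁) (fromℤ n₂) (x i) (g i) _ _ _ (fromℤ-* m n₀) (fromℤ-* m n₁) (fromℤ-* m n₂)
        , lin 6 (λ m n r d B D → B :≈ m :* n ∷ D :≈ m :* r ∷ [] ⊢ B :+ D :* d :≈ m :* (n :+ r :* d) by d ⊡ # 1 ∷ [])
            (fromℤ m) (fromℤ n₁) (fromℤ n₂) (g′ i) _ _ (fromℤ-* m n₁) (fromℤ-* m n₂)
        , fromℤ-* m n₂

      unscale : ∀ {m y z b} → 1# ≤ m ⊎ m ≤ - 1# → z ≈ m * y → z ∥ b → y ∥ b
      unscale {m} {y} {z} {b} (inj₁ 1≤m) e (p , q) =
          lin 4 (λ m y z b → one :≤ m ∷ z :≈ m :* y ∷ :- b :≤ z ∷ z :≤ b ∷ [] ⊢ :- b :≤ y by # 0 ⊠ ¬g ∷ # 0 ⊠ # 2 ∷ # 0 ⊠ # 3 ∷ []) m y z b 1≤m e p q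
        , lin 4 (λ m y z b → one :≤ m ∷ z :≈ m :* y ∷ :- b :≤ z ∷ z :≤ b ∷ [] ⊢ y :≤ b by # 0 ⊠ ¬g ∷ # 0 ⊠ # 2 ∷ # 0 ⊠ # 3 ∷ []) m y z b 1≤m e p q
      unscale {m} {y} {z} {b} (inj₂ m≤-1) e (p , q) =
          lin 4 (λ m y z b → m :≤ :- one ∷ z :≈ m :* y ∷ :- b :≤ z ∷ z :≤ b ∷ [] ⊢ :- b :≤ y by # 0 ⊠ ¬g ∷ # 0 ⊠ # 2 ∷ # 0 ⊠ # 3 ∷ []) m y z b m≤-1 e p q
        , lin 4 (λ m y z b → m :≤ :- one ∷ z :≈ m :* y ∷ :- b :≤ z ∷ z :≤ b ∷ [] ⊢ y :≤ b by # 0 ⊠ ¬g ∷ # 0 ⊠ # 2 ∷ # 0 ⊠ # 3 ∷ []) m y z b m≤-1 e p q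

      -- A nonzero integer has absolute value at least 1, so division by it lengthens nothing.
      divide-tiny : ∀ T {m v w} i → ¬ m ≡ + 0 → w ≡ m • v → TinyV T w i → TinyV T v i
      divide-tiny T {m} {v} i m≢0 ≡.refl (tΦ , tφ , ts) with scaled T m v i | fromℤ-≥1 m m≢0
      ... | eΦ , eφ , es | one≤ = unscale one≤ eΦ tΦ , unscale one≤ eφ tφ , unscale one≤ es ts

      open Primitive

      Short Tiny : Side → Primitive → ℕ → Set
      Short T u = ShortV T (vector u)
      Tiny  T u = TinyV T (vector u)

      same-side : ∀ {T u w i} → i ℕ.< N → Short T u i → Tiny T w i →
                  Tiny T u i ⊎ (∃[ v ] v ⟂ u × Tiny (dual T) v i)
      same-side {T} {u} {w} {i} _ su tw = decide em
        where
        decide : Dec (vector u ⨯ vector w ≡ 0³) → Tiny T u i ⊎ (∃[ v ] v ⟂ u × Tiny (dual T) v i)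
        decide (yes z) = inj₁ (divide-tiny T {dualvec u · vector w} {vector u} i (nonzero-factor {v = vector u} (parallel u z) (primitive≢0 w)) (parallel u z) tw)
        decide (no nz) = inj₂ (make (primitive-part em (vector u ⨯ vector w) nz))
          where
          make : (∃[ v ] ∃[ m ] ¬ m ≡ + 0 × vector u ⨯ vector w ≡ m • vector v) → ∃[ v ] v ⟂ u × Tiny (dual T) v i
          make (v , m , m≢0 , e) =
            v , ⟂-of-multiple u (vector w) v m m≢0 e , divide-tiny (dual T) {m} {vector v} i m≢0 e (cross-tiny T (vector u) (vector w) i su tw)

      dual-side : ∀ {T u w i} → i ℕ.< N → Short T u i → Tiny (dual T) w i → w ⟂ u
      dual-side {T} {u} {w} {i} _ su tw = ≡.trans (·-comm (vector w) (vector u)) (dot-zero T (vector u) (vector w) i su tw)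
        where
        ·-comm : ∀ u v → u · v ≡ v · u
        ·-comm ⟪ a ⨾ b ⨾ d ⟫ ⟪ a′ ⨾ b′ ⨾ d′ ⟫ = ℕ-Linear.ℤL.lin 6 (λ a b d a′ b′ d′ → []
          ⊢ a :* a′ :+ b :* b′ :+ d :* d′ :≈ a′ :* a :+ b′ :* b :+ d′ :* d) a b d a′ b′ d′

      dual-dual : ∀ T → dual (dual T) ≡ T
      dual-dual point = ≡.refl
      dual-dual line  = ≡.refl

      second : ∀ {T u v w i} → i ℕ.< N → v ⟂ u → w ⟂ u → Short (dual T) v i → Tiny (dual T) w i →
               Tiny (dual T) v i ⊎ Tiny T u i
      second {T} {u} {v} {w} {i} _ v⟂u w⟂u sv tw = decide em
        where
        decide : Dec (vector v ⨯ vector w ≡ 0³) → Tiny (dual T) v i ⊎ Tiny T u i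
        decide (yes z) = inj₁ (divide-tiny (dual T) {dualvec v · vector w} {vector v} i (nonzero-factor {v = vector v} (parallel v z) (primitive≢0 w)) (parallel v z) tw)
        decide (no nz) = inj₂ (divide-tiny T {dualvec u · (vector v ⨯ vector w)} {vector u} i (nonzero-factor {v = vector u} e nz) e
          (≡.subst (λ T → TinyV T (vector v ⨯ vector w) i) (dual-dual T) (cross-tiny (dual T) (vector v) (vector w) i sv tw)))
          where
          e : vector v ⨯ vector w ≡ (dualvec u · (vector v ⨯ vector w)) • vector u
          e = parallel u (⨯-⨯-zero (vector u) (vector v) (vector w) v⟂u w⟂u)

      sparseᵀ : ∀ {T u a n} → a ℕ.+ n ℕ.≤ N → (∀ {i} → i ∈[ a ,+ n ⟩ → Short T u i) →
                (∃[ a′ ] a ≡ suc a′ × ¬ Short T u a′) ⊎ (a ℕ.+ n ℕ.< N × ¬ Short T u (a ℕ.+ n)) →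
                Cₙ ℕ.* count (Tiny T u) a n ℕ.≤ 4 ℕ.* n
      sparseᵀ {T} {u} a+n≤N _ = Scaleᵀ.sparse T (quad T (vector u)) a+n≤N

      α≤ψ : ∀ T → α T ≤ ψ
      α≤ψ point = ≤-refl
      α≤ψ line  = lin 2 (λ p K → c 0 :< p ∷ K :≤ one ∷ [] ⊢ p :* K :≤ p by # 0 ⊠ # 1 ∷ []) ψ K ψ>0 K≤1

      module _ {Φ₁ φ₁ : ℕ → ℝ} {s₁ : ℝ} (quad : QuadraticPair Φ₁ φ₁ s₁)
               {A : ℝ} (A≤ψ : A ≤ ψ) (short : ∀ {i} → i ℕ.< N → Φ₁ i + Φ₁ i ∥ A) where

        open QuadraticPair quad

        k<N : k ℕ.< N
        k<N = ℕ.s≤s (ℕP.m≤m+n k k)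

        L : ℝ
        L = fromℕ k * h

        0≤L : 0# ≤ L
        0≤L = lin 2 (λ n h → c 0 :≤ n ∷ c 0 :< h ∷ [] ⊢ c 0 :≤ n :* h by # 0 ⊠ # 1 ∷ []) (fromℕ k) h (0≤fromℕ k) h>0

        μA≤μψ : μ * A ≤ μ * ψ
        μA≤μψ = lin 3 (λ μ A p → one :≤ μ ∷ A :≤ p ∷ [] ⊢ μ :* A :≤ μ :* p by # 0 ⊠ # 1 ∷ []) μ A ψ 1≤μ A≤ψ

        right-end : x (k ℕ.+ k) - x k ≈ L
        right-end = x-step k k

        left-end : x 0 - x k ≈ - L
        left-end = lin 3 (λ x₀ n h → [] ⊢ x₀ :+ c 0 :* h :- (x₀ :+ n :* h) :≈ :- (n :* h)) x₀ (fromℕ k) h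

        Split : ℝ → Set
        Split d = (φ₁ k * d ∥ μ * A) × (s₁ * (d * d) ∥ μ * A)

        split : ∀ {e d} → e ℕ.< N → x e - x k ≈ d → SameSign (φ₁ k * d) (s₁ * (d * d)) → Split d
        split {e} {d} e<N e≈ ss with Φ-step k<N e<N
        ... | v , w , V , W , eq = no-cancel V W ss (∥-resp
          (lin 8 (λ a b v w f s y d → a :- b :≈ v :* (f :* y) :+ w :* (s :* (y :* y)) ∷ y :≈ d ∷ []
              ⊢ a :- b :≈ v :* (f :* d) :+ w :* (s :* (d :* d)) by v :* f ⊡ # 1 ∷ w :* s :* y ⊡ # 1 ∷ w :* s :* d ⊡ # 1 ∷ [])
            (Φ₁ e) (Φ₁ k) v w (φ₁ k) s₁ (x e - x k) d eq e≈)
          (halve (∥-+ (short e<N) (∥-neg (short k<N)))))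
          where
          halve : ∀ {a b} → (a + a) + - (b + b) ∥ A + A → a - b ∥ A
          halve {a} {b} (p , q) = lin 3 (λ a b A → :- (A :+ A) :≤ (a :+ a) :+ :- (b :+ b) ∷ [] ⊢ :- A :≤ a :- b) a b A p
                                , lin 3 (λ a b A → (a :+ a) :+ :- (b :+ b) :≤ A :+ A ∷ [] ⊢ a :- b :≤ A) a b A q

        -- From the midpoint, move in the direction in which the two terms of
        -- the increment of Φ₁ have the same sign.
        some-split : Split L ⊎ Split (- L)
        some-split with ≤-total 0# s₁ | ≤-total 0# (φ₁ k)
        ... | inj₁ p | inj₁ q = inj₁ (split ℕP.≤-refl right-end (inj₁
            ( lin 2 (λ f L → c 0 :≤ f ∷ c 0 :≤ L ∷ [] ⊢ c 0 :≤ f :* L by # 0 ⊠ # 1 ∷ []) _ L q 0≤L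
            , lin 2 (λ f L → c 0 :≤ f ∷ [] ⊢ c 0 :≤ f :* (L :* L) by # 0 ⊠ sq L ∷ []) _ L p)))
        ... | inj₂ p | inj₂ q = inj₁ (split ℕP.≤-refl right-end (inj₂
            ( lin 2 (λ f L → f :≤ c 0 ∷ c 0 :≤ L ∷ [] ⊢ f :* L :≤ c 0 by # 0 ⊠ # 1 ∷ []) _ L q 0≤L
            , lin 2 (λ f L → f :≤ c 0 ∷ [] ⊢ f :* (L :* L) :≤ c 0 by # 0 ⊠ sq L ∷ []) _ L p)))
        ... | inj₁ p | inj₂ q = inj₂ (split (ℕ.s≤s ℕ.z≤n) left-end (inj₁
            ( lin 2 (λ f L → f :≤ c 0 ∷ c 0 :≤ L ∷ [] ⊢ c 0 :≤ f :* :- L by # 0 ⊠ # 1 ∷ []) _ L q 0≤L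
            , lin 2 (λ f L → c 0 :≤ f ∷ [] ⊢ c 0 :≤ f :* (:- L :* :- L) by # 0 ⊠ sq L ∷ []) _ L p)))
        ... | inj₂ p | inj₁ q = inj₂ (split (ℕ.s≤s ℕ.z≤n) left-end (inj₂
            ( lin 2 (λ f L → c 0 :≤ f ∷ c 0 :≤ L ∷ [] ⊢ f :* :- L :≤ c 0 by # 0 ⊠ # 1 ∷ []) _ L q 0≤L
            , lin 2 (λ f L → f :≤ c 0 ∷ [] ⊢ f :* (:- L :* :- L) :≤ c 0 by # 0 ⊠ sq L ∷ []) _ L p)))

        L-bounds : (φ₁ k * L ∥ μ * A) × (s₁ * (L * L) ∥ μ * A)
        L-bounds with some-split
        ... | inj₁ b = b
        ... | inj₂ (b , b′) = ∥-resp (lin 2 (λ f L → [] ⊢ :- (f :* :- L) :≈ f :* L) _ L) (∥-neg b)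
                            , ∥-resp (lin 2 (λ f L → [] ⊢ f :* (:- L :* :- L) :≈ f :* (L :* L)) _ L) b′

        s-small : ¬ (1# ≤ s₁ ⊎ s₁ ≤ - 1#)
        s-small (inj₁ p) = ≤⇒≯ (lin 4 (λ s L X Y → one :≤ s ∷ s :* (L :* L) :≤ X ∷ X :≤ Y ∷ [] ⊢ L :* L :≤ Y by # 0 ⊠ sq L ∷ [])
                             s₁ L (μ * A) (μ * ψ) p (proj₂ (proj₂ L-bounds)) μA≤μψ) wide²
        s-small (inj₂ p) = ≤⇒≯ (lin 4 (λ s L X Y → s :≤ :- one ∷ :- X :≤ s :* (L :* L) ∷ X :≤ Y ∷ [] ⊢ L :* L :≤ Y by # 0 ⊠ sq L ∷ [])
                             s₁ L (μ * A) (μ * ψ) p (proj₁ (proj₂ L-bounds)) μA≤μψ) wide²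

        φ-small : ¬ (1# ≤ φ₁ k ⊎ φ₁ k ≤ - 1#)
        φ-small (inj₁ p) = ≤⇒≯ (lin 4 (λ s L X Y → one :≤ s ∷ s :* L :≤ X ∷ X :≤ Y ∷ c 0 :≤ L ∷ [] ⊢ L :≤ Y by # 0 ⊠ # 3 ∷ [])
                             (φ₁ k) L (μ * A) (μ * ψ) p (proj₂ (proj₁ L-bounds)) μA≤μψ 0≤L) wide
        φ-small (inj₂ p) = ≤⇒≯ (lin 4 (λ s L X Y → s :≤ :- one ∷ :- X :≤ s :* L ∷ X :≤ Y ∷ c 0 :≤ L ∷ [] ⊢ L :≤ Y by # 0 ⊠ # 3 ∷ [])
                             (φ₁ k) L (μ * A) (μ * ψ) p (proj₁ (proj₁ L-bounds)) μA≤μψ 0≤L) wide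

      by-cases : ∀ m {y} → y ≈ fromℤ m → ¬ (1# ≤ y ⊎ y ≤ - 1#) → m ≡ + 0
      by-cases m {y} e ns with m ℤP.≟ + 0
      ... | yes z = z
      ... | no nz = ⊥-elim (ns (Sum.map (λ p → lin 2 (λ m y → y :≈ m ∷ one :≤ m ∷ [] ⊢ one :≤ y) _ _ e p)
                                        (λ p → lin 2 (λ m y → y :≈ m ∷ m :≤ :- one ∷ [] ⊢ y :≤ :- one) _ _ e p) (fromℤ-≥1 m nz)))

      halves : ∀ {a m} → a ≈ fromℤ m → a + a ∥ ψ → m ≡ + 0
      halves {a} {m} e (p , q) = by-cases m e λ
        { (inj₁ 1≤) → ≤⇒≯ ψ≤1 (lin 2 (λ a p → one :≤ a ∷ a :+ a :≤ p ∷ [] ⊢ one :< p) a ψ 1≤ q)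
        ; (inj₂ ≤1) → ≤⇒≯ ψ≤1 (lin 2 (λ a p → a :≤ :- one ∷ :- p :≤ a :+ a ∷ [] ⊢ one :< p) a ψ ≤1 p) }

      -- A vector short on the whole grid has |s| < 1 and, at the midpoint, |φ| < 1. Now s is an
      -- integer coordinate and vanishes; then φ is one up to sign and vanishes; then so does Φ,
      -- leaving the zero vector, which is not primitive.
      nonshort : ∀ {T u} → ¬ (∀ {i} → i ∈[ 0 ,+ N ⟩ → Short T u i)
      nonshort {T} {u} all = primitive≢0 u (zero-vector T (vector u) (λ i< → all (ℕ.z≤n , i<)))
        where
        zero-vector : ∀ T v → (∀ {i} → i ℕ.< N → ShortV T v i) → v ≡ 0³
        zero-vector T v short with quad T v | s-small (quad T v) (α≤ψ T) (λ i< → proj₁ (short i<))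
                                            | φ-small (quad T v) (α≤ψ T) (λ i< → proj₁ (short i<))
        zero-vector point ⟪ q ⨾ p₁ ⨾ p₂ ⟫ short | _ | ¬s | ¬φ with by-cases q refl ¬s
        ... | ≡.refl with by-cases (ℤ.- p₁) (trans (lin 2 (λ p x → [] ⊢ c 0 :* x :- p :≈ :- p) (fromℤ p₁) (x k)) (sym (fromℤ-neg p₁))) ¬φ
        ...   | p₁≡ with ≡.trans (≡.sym (ℤP.neg-involutive p₁)) (cong ℤ.-_ p₁≡)
        ...     | ≡.refl with halves {m = p₂} (lin 4 (λ p x g d → [] ⊢ p :- c 0 :* g :+ d :* (c 0 :* x :- c 0) :≈ p) (fromℤ p₂) (x 0) (g 0) (g′ 0))
                               (proj₁ (short (ℕ.s≤s ℕ.z≤n)))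
        ...       | ≡.refl = ≡.refl
        zero-vector line ⟪ n₀ ⨾ n₁ ⨾ n₂ ⟫ short | _ | ¬s | ¬φ with by-cases n₂ refl ¬s
        ... | ≡.refl with by-cases n₁ (lin 2 (λ p x → [] ⊢ p :+ c 0 :* x :≈ p) (fromℤ n₁) (g′ k)) ¬φ
        ...   | ≡.refl with halves {m = n₀} (lin 3 (λ p x g → [] ⊢ p :+ c 0 :* x :+ c 0 :* g :≈ p) (fromℤ n₀) (x 0) (g 0))
                               (∥-mono (α≤ψ line) (proj₁ (short (ℕ.s≤s ℕ.z≤n))))
        ...     | ≡.refl = ≡.refl

      open TwoLevel Side dual sides Primitive _⟂_ Short Tiny N Cₙ using (few-bad)

      few-tiny : Cₙ ℕ.* count (λ i → ∃[ T ] ∃[ u ] Tiny T u i) 0 N ℕ.≤ 12 ℕ.* (N ℕ.+ N)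
      few-tiny = few-bad (λ {T} {u} {i} → Scaleᵀ.tiny⇒short T {Φ T (vector u)} {φ T (vector u)} {s T (vector u)} {i}) (λ {T} {u} {w} → same-side {T} {u} {w}) (λ {T} {u} {w} → dual-side {T} {u} {w})
        (λ {T} {u} {v} {w} → second {T} {u} {v} {w}) (λ {T} {u} → sparseᵀ {T} {u}) (λ {T} {u} → nonshort {T} {u})

-- Dirichlet's theorem

module Approximations (em : ExcludedMiddle 0ℓ) (R : CompleteOrderedField) where

  open Real em R

  Cell : ℕ → ℝ → Set
  Cell M y = ∃[ p ] ∃[ i ] fromℕ (toℕ {suc M} i) ≤ fromℕ (suc M) * (y - fromℤ p) ×
                           fromℕ (suc M) * (y - fromℤ p) < fromℕ (toℕ i) + 1#

  abstract

    cell : ∀ M y → Cell M y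
    cell M y with floor y
    ... | p , p≤y , y<p+1 with floorℕ (fromℕ (suc M) * (y - fromℤ p))
            (lin 3 (λ M y p → c 0 :≤ M ∷ p :≤ y ∷ [] ⊢ c 0 :≤ M :* (y :- p) by # 0 ⊠ # 1 ∷ []) _ _ _ (0≤fromℕ (suc M)) p≤y)
    ... | n , n≤ , <n+1 = p , fromℕ< n<M , ≡.subst (λ m → fromℕ m ≤ _ × _ < fromℕ m + 1#) (≡.sym (FinP.toℕ-fromℕ< n<M)) (n≤ , <n+1)
      where
      n<M : n ℕ.< suc M
      n<M = fromℕ-cancel-< (lin 4 (λ M y p n → c 0 :≤ M ∷ y :< p :+ one ∷ n :≤ (one :+ M) :* (y :- p) ∷ [] ⊢ n :< one :+ M by # 0 ⊠ # 1 ∷ [])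
              (fromℕ M) y (fromℤ p) (fromℕ n) (0≤fromℕ M) y<p+1 n≤)

  same-cell : ∀ {M i y y′ b} → 1# ≤ M * b → 0# < M →
              i ≤ M * y × M * y < i + 1# → i ≤ M * y′ × M * y′ < i + 1# → y′ - y ∥ b
  same-cell {M} {i} {y} {y′} {b} Mb M>0 (p , q) (p′ , q′) =
      lin 5 (λ M i y z b → one :≤ M :* b ∷ c 0 :< M ∷ i :≤ M :* z ∷ M :* y :< i :+ one ∷ [] ⊢ :- b :≤ z :- y by # 1 ⊠ ¬g ∷ [])
        M i y y′ b Mb M>0 p′ q
    , lin 5 (λ M i y z b → one :≤ M :* b ∷ c 0 :< M ∷ i :≤ M :* y ∷ M :* z :< i :+ one ∷ [] ⊢ z :- y :≤ b by # 1 ⊠ ¬g ∷ [])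
        M i y y′ b Mb M>0 p q′

  index : ∀ {M y} → Cell M y → Fin (suc M)
  index C = proj₁ (proj₂ C)

  cell-difference : ∀ {M y y′ b} (C : Cell M y) (C′ : Cell M y′) → 1# ≤ fromℕ (suc M) * b → index C ≡ index C′ →
                    (y′ - fromℤ (proj₁ C′)) - (y - fromℤ (proj₁ C)) ∥ b
  cell-difference {M} (p , i , r) (p′ , _ , r′) Mb ≡.refl = same-cell Mb (0<fromℕ-suc M) r r′

  -- With M = ⌊1 / b⌋ the M + 1 cells are no wider than b, yet at most 2 / b in number.
  fineness : ∀ b → 0# < b → b ≤ 1# → ∃[ M ] 1# ≤ fromℕ (suc M) * b × fromℕ (suc M) * b ≤ fromℕ 2
  fineness b b>0 b≤1 with floorℕ (b ⁻¹) (<⇒≤ (⁻¹-pos b>0))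
  ... | M , M≤ , <M+1 = M
    , lin 3 (λ M b r → r :< M :+ one ∷ b :* r :≈ one ∷ c 0 :< b ∷ [] ⊢ one :≤ (one :+ M) :* b by # 0 ⊠ # 2 ∷ [])
        _ b _ <M+1 (⁻¹-inverse b>0) b>0
    , lin 3 (λ M b r → M :≤ r ∷ b :* r :≈ one ∷ c 0 :< b ∷ b :≤ one ∷ [] ⊢ (one :+ M) :* b :≤ c 2 by # 0 ⊠ # 2 ∷ [])
        _ b _ M≤ (⁻¹-inverse b>0) b>0 b≤1

  record Approximation (x g d a b Q : ℝ) : Set where
    field
      q     : ℕ
      p₁ p₂ : ℤ
      1≤q   : 1 ℕ.≤ q
      q≤Q   : fromℕ q ≤ Q
      near-x       : fromℕ q * x - fromℤ p₁ ∥ b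
      near-tangent : fromℤ p₂ - fromℕ q * g + d * (fromℕ q * x - fromℤ p₁) ∥ a

  module Boxes (x g d a b Q : ℝ) (a>0 : 0# < a) (b>0 : 0# < b) (4≤abQ : fromℕ 4 ≤ a * (b * Q)) (M₁ M₂ : ℕ)
    (1≤M₁b : 1# ≤ fromℕ (suc M₁) * b) (M₁b≤2 : fromℕ (suc M₁) * b ≤ fromℕ 2)
    (1≤M₂a : 1# ≤ fromℕ (suc M₂) * a) (M₂a≤2 : fromℕ (suc M₂) * a ≤ fromℕ 2) where

    -- There are at most (2 / b) (2 / a) boxes, which is the origin of the 4 in `4≤abQ`.
    product≤ : fromℕ (suc M₁) * fromℕ (suc M₂) ≤ Q
    product≤ = lin 5 (λ M m a b Q → M :* b :≤ c 2 ∷ m :* a :≤ c 2 ∷ one :≤ M :* b ∷ c 4 :≤ a :* (b :* Q) ∷ c 0 :< a :* b ∷ c 0 :≤ a ∷ c 0 :≤ m ∷ []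
      ⊢ M :* m :≤ Q by # 4 ⊠ ¬g ∷ # 0 ⊠ # 5 ⊠ # 6 ∷ # 1 ∷ [])
      (fromℕ (suc M₁)) (fromℕ (suc M₂)) a b Q M₁b≤2 M₂a≤2 1≤M₁b 4≤abQ (*-pos a>0 b>0) (<⇒≤ a>0) (0≤fromℕ (suc M₂))

    0≤Q : 0# ≤ Q
    0≤Q = ≤-trans (lin 2 (λ M m → c 0 :≤ M ∷ c 0 :≤ m ∷ [] ⊢ c 0 :≤ M :* m by # 0 ⊠ # 1 ∷ []) _ _ (0≤fromℕ (suc M₁)) (0≤fromℕ (suc M₂))) product≤

    N = proj₁ (floorℕ Q 0≤Q)
    N≤Q : fromℕ N ≤ Q
    N≤Q = proj₁ (proj₂ (floorℕ Q 0≤Q))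

    few : suc M₁ ℕ.* suc M₂ ℕ.< suc N
    few = fromℕ-cancel-< (lin 4 (λ p P Q n → p :≈ P ∷ P :≤ Q ∷ Q :< n :+ one ∷ [] ⊢ p :< one :+ n) _ _ Q _
            (fromℕ-* (suc M₁) (suc M₂)) product≤ (proj₂ (proj₂ (floorℕ Q 0≤Q))))

    bcell : ∀ n → Cell M₁ (fromℕ n * x)
    bcell n = cell M₁ (fromℕ n * x)
    pp₁ : ℕ → ℤ
    pp₁ n = proj₁ (bcell n)
    B : ℕ → ℝ
    B n = fromℕ n * x - fromℤ (pp₁ n)
    -- The correction by d B makes equal cells bound the quantity of `near-tangent`, which up to
    -- sign is a difference of the numbers n g - d B - p₂.
    acell : ∀ n → Cell M₂ (fromℕ n * g - d * B n)
    acell n = cell M₂ (fromℕ n * g - d * B n)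
    pp₂ : ℕ → ℤ
    pp₂ n = proj₁ (acell n)

    boxes : Fin (suc N) → Fin (suc M₁ ℕ.* suc M₂)
    boxes n = combine (proj₁ (proj₂ (bcell (toℕ n)))) (proj₁ (proj₂ (acell (toℕ n))))

    collision : ∀ n δ → 1 ℕ.≤ δ → n ℕ.+ δ ℕ.≤ N → index (bcell n) ≡ index (bcell (n ℕ.+ δ)) →
                index (acell n) ≡ index (acell (n ℕ.+ δ)) → Approximation x g d a b Q
    collision n δ 1≤δ n+δ≤N same₁ same₂ = record
      { q = δ ; p₁ = pp₁ (n ℕ.+ δ) ℤ.- pp₁ n ; p₂ = pp₂ (n ℕ.+ δ) ℤ.- pp₂ n
      ; 1≤q = 1≤δ
      ; q≤Q = ≤-trans (fromℕ-mono (linℕ 3 (λ n δ N → n :+ δ :≤ N ∷ [] ⊢ δ :≤ N) n δ N n+δ≤N)) N≤Q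
      ; near-x = ∥-resp
          (lin 7 (λ i j δ x p q P → j :≈ i :+ δ ∷ P :≈ q :- p ∷ [] ⊢ j :* x :- q :- (i :* x :- p) :≈ δ :* x :- P by x ⊡ # 0 ∷ [])
             (fromℕ n) (fromℕ (n ℕ.+ δ)) (fromℕ δ) x (fromℤ (pp₁ n)) (fromℤ (pp₁ (n ℕ.+ δ))) (fromℤ (pp₁ (n ℕ.+ δ) ℤ.- pp₁ n))
             (fromℕ-+ n δ) (fromℤ-sub (pp₁ (n ℕ.+ δ)) (pp₁ n)))
          (cell-difference (bcell n) (bcell (n ℕ.+ δ)) 1≤M₁b same₁)
      ; near-tangent = ∥-resp
          (lin 12 (λ i j δ x p q P g d r s S → j :≈ i :+ δ ∷ P :≈ q :- p ∷ S :≈ s :- r ∷ []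
             ⊢ :- ((j :* g :- d :* (j :* x :- q) :- s) :- (i :* g :- d :* (i :* x :- p) :- r)) :≈ S :- δ :* g :+ d :* (δ :* x :- P)
             by g ⊡ # 0 ∷ d :* x ⊡ # 0 ∷ d ⊡ # 1 ∷ [])
             (fromℕ n) (fromℕ (n ℕ.+ δ)) (fromℕ δ) x (fromℤ (pp₁ n)) (fromℤ (pp₁ (n ℕ.+ δ))) (fromℤ (pp₁ (n ℕ.+ δ) ℤ.- pp₁ n)) g d
             (fromℤ (pp₂ n)) (fromℤ (pp₂ (n ℕ.+ δ))) (fromℤ (pp₂ (n ℕ.+ δ) ℤ.- pp₂ n))
             (fromℕ-+ n δ) (fromℤ-sub (pp₁ (n ℕ.+ δ)) (pp₁ n)) (fromℤ-sub (pp₂ (n ℕ.+ δ)) (pp₂ n)))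
          (∥-neg (cell-difference (acell n) (acell (n ℕ.+ δ)) 1≤M₂a same₂))
      }

    approximation : (∃[ i ] ∃[ j ] i Fin.< j × boxes i ≡ boxes j) → Approximation x g d a b Q
    approximation (i , j , i<j , same) = from-gap (ℕP.m≤n⇒∃[o]m+o≡n (ℕP.<⇒≤ i<j))
      where
      indices : index (bcell (toℕ i)) ≡ index (bcell (toℕ j)) × index (acell (toℕ i)) ≡ index (acell (toℕ j))
      indices = FinP.combine-injective (index (bcell (toℕ i))) (index (acell (toℕ i)))
                  (index (bcell (toℕ j))) (index (acell (toℕ j))) same
      from-gap : (∃[ δ ] toℕ i ℕ.+ δ ≡ toℕ j) → Approximation x g d a b Q
      from-gap (δ , e) = collision (toℕ i) δ
        (linℕ 3 (λ i j δ → i :+ δ :≈ j ∷ i :< j ∷ [] ⊢ one :≤ δ) (toℕ i) (toℕ j) δ e i<j)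
        (linℕ 4 (λ i j δ N → i :+ δ :≈ j ∷ j :< one :+ N ∷ [] ⊢ i :+ δ :≤ N) (toℕ i) (toℕ j) δ N e (FinP.toℕ<n j))
        (≡.subst (λ m → index (bcell (toℕ i)) ≡ index (bcell m)) (≡.sym e) (proj₁ indices))
        (≡.subst (λ m → index (acell (toℕ i)) ≡ index (acell m)) (≡.sym e) (proj₂ indices))

    approx : Approximation x g d a b Q
    approx = approximation (FinP.pigeonhole few boxes)

  dirichlet : ∀ x g d a b Q → 0# < a → a ≤ 1# → 0# < b → b ≤ 1# → fromℕ 4 ≤ a * (b * Q) →
              Approximation x g d a b Q
  dirichlet x g d a b Q a>0 a≤1 b>0 b≤1 4≤abQ with fineness b b>0 b≤1 | fineness a a>0 a≤1
  ... | M₁ , p , q | M₂ , r , s = Boxes.approx x g d a b Q a>0 b>0 4≤abQ M₁ M₂ p q r s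

-- Taylor bounds

module Calculus (em : ExcludedMiddle 0ℓ) (R : CompleteOrderedField) where

  open Real em R
  open Quadratic em R

  half : ℝ → ℝ
  half x = x * (1# + 1#) ⁻¹

  half+half : ∀ x → half x + half x ≈ x
  half+half x = lin 2 (λ x r → (one :+ one) :* r :≈ one ∷ [] ⊢ x :* r :+ x :* r :≈ x by x ⊡ # 0 ∷ []) x ((1# + 1#) ⁻¹)
    (⁻¹-inverse (lin 0 ([] ⊢ c 0 :< one :+ one)))

  0<half : ∀ {x} → 0# < x → 0# < half x
  0<half {x} = lin 2 (λ x h → h :+ h :≈ x ∷ c 0 :< x ∷ [] ⊢ c 0 :< h) x _ (half+half x)

  minimum : ∀ {x y} → 0# < x → 0# < y → ∃[ z ] 0# < z × z ≤ x × z ≤ y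
  minimum {x} {y} p q with ≤-total x y
  ... | inj₁ r = x , p , ≤-refl , r
  ... | inj₂ r = y , q , r , ≤-refl

  -- Cousin's lemma: consider the supremum of the points reached from a.
  module Chain (a b : ℝ) (a≤b : a ≤ b) (_∼_ : ℝ → ℝ → Set)
    (a∼a : a ∼ a) (∼-trans : ∀ {u v w} → u ∼ v → v ∼ w → u ∼ w)
    (local : ∀ {t} → a ≤ t → t ≤ b → ∃[ δ ] 0# < δ ×
       (∀ {u v} → a ≤ u → u ≤ t → t ≤ v → v ≤ b → t - δ < u → v < t + δ → u ∼ v)) where

    S : ℝ → Set
    S t = a ≤ t × t ≤ b × a ∼ t

    chain : a ∼ b
    chain with supremum S (a , ≤-refl , a≤b , a∼a) (b , λ p → proj₁ (proj₂ p))
    ... | s , upper , least with upper (≤-refl , a≤b , a∼a) | least (λ p → proj₁ (proj₂ p))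
    ... | a≤s | s≤b with local a≤s s≤b
    ... | δ , δ>0 , near with em {∃[ t ] S t × s - δ < t}
    ...   | no ¬t = ⊥-elim (≤⇒≯ (least (λ {t} St → [ (λ p → ⊥-elim (¬t (t , St , p))) , (λ p → p) ] (<-or-≥ (s - δ) t)))
                      (lin 2 (λ s δ → c 0 :< δ ∷ [] ⊢ s :- δ :< s) s δ δ>0))
    ...   | yes (t , St@(a≤t , t≤b , a∼t) , s-δ<t) with <-or-≥ b (s + δ)
    ...     | inj₁ b<s+δ = ∼-trans a∼t (near a≤t (upper St) s≤b ≤-refl s-δ<t b<s+δ)
    ...     | inj₂ s+δ≤b = ⊥-elim (≤⇒≯ (upper (a≤s′ , s′≤b , ∼-trans a∼t (near a≤t (upper St) s≤s′ s′≤b s-δ<t s′<)))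
                             (lin 2 (λ s h → c 0 :< h ∷ [] ⊢ s :< s :+ h) s (half δ) (0<half δ>0)))
      where
      s≤s′ : s ≤ s + half δ
      s≤s′ = lin 2 (λ s h → c 0 :< h ∷ [] ⊢ s :≤ s :+ h) s (half δ) (0<half δ>0)
      a≤s′ : a ≤ s + half δ
      a≤s′ = ≤-trans a≤s s≤s′
      s′< : s + half δ < s + δ
      s′< = lin 3 (λ s h d → c 0 :< h ∷ h :+ h :≈ d ∷ [] ⊢ s :+ h :< s :+ d) s (half δ) δ (0<half δ>0) (half+half δ)
      s′≤b : s + half δ ≤ b
      s′≤b = ≤-trans (<⇒≤ s′<) s+δ≤b

  negate : Function → Function
  negate f = record { to = λ x → - (f ⟨$⟩ x) ; cong = λ e → -‿cong (Func.cong f e) }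

  negate-derivative : ∀ {D f g} → IsDerivativeOn D f g → IsDerivativeOn D (negate f) (negate g)
  negate-derivative {D} {f} {g} deriv {x} Dx {ε} ε>0 with deriv Dx ε>0
  ... | δ , δ>0 , near = δ , δ>0 , λ {y} Dy p q → flip y (∣∣<-elim (near Dy p q))
    where
    flip : ∀ y → (((f ⟨$⟩ y) - (f ⟨$⟩ x)) ÷ (y - x) - (g ⟨$⟩ x)) < ε × - ε < (((f ⟨$⟩ y) - (f ⟨$⟩ x)) ÷ (y - x) - (g ⟨$⟩ x)) →
           ∣ (- (f ⟨$⟩ y) - - (f ⟨$⟩ x)) ÷ (y - x) - - (g ⟨$⟩ x) ∣ < ε
    flip y (p , q) = ∣∣<-intro
      (lin 5 (λ a b r g e → :- e :< (a :- b) :* r :- g ∷ [] ⊢ (:- a :- :- b) :* r :- :- g :< e) (f ⟨$⟩ y) (f ⟨$⟩ x) ((y - x) ⁻¹) (g ⟨$⟩ x) ε q)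
      (lin 5 (λ a b r g e → (a :- b) :* r :- g :< e ∷ [] ⊢ :- e :< (:- a :- :- b) :* r :- :- g) (f ⟨$⟩ y) (f ⟨$⟩ x) ((y - x) ⁻¹) (g ⟨$⟩ x) ε p)

  -- The derivative in the form of lower bounds for increments on either side of t, free of
  -- division, so that they can be added along a chain.
  difference-quotient : ∀ {D f g} → IsDerivativeOn D f g → ∀ {t ε} → D t → 0# < ε → ∃[ δ ] 0# < δ ×
    (∀ {y} → D y → t < y → y < t + δ → ((g ⟨$⟩ t) - ε) * (y - t) ≤ (f ⟨$⟩ y) - (f ⟨$⟩ t)) ×
    (∀ {y} → D y → y < t → t - δ < y → ((g ⟨$⟩ t) - ε) * (t - y) ≤ (f ⟨$⟩ t) - (f ⟨$⟩ y))
  difference-quotient {D} {f} {g} deriv {t} {ε} Dt ε>0 with deriv Dt ε>0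
  ... | δ , δ>0 , near = δ , δ>0 , right , left
    where
    right : ∀ {y} → D y → t < y → y < t + δ → ((g ⟨$⟩ t) - ε) * (y - t) ≤ (f ⟨$⟩ y) - (f ⟨$⟩ t)
    right {y} Dy t<y y<t+δ with ∣∣-cases (y - t)
    ... | inj₂ (neg , _) = ⊥-elim (≤⇒≯ (<⇒≤ t<y) (lin 2 (λ y t → y :- t :< c 0 ∷ [] ⊢ y :< t) y t neg))
    ... | inj₁ (_ , e) with ∣∣<-elim (near Dy
            (lin 3 (λ a y t → a :≈ y :- t ∷ t :< y ∷ [] ⊢ c 0 :< a) _ y t e t<y)
            (lin 4 (λ a y t d → a :≈ y :- t ∷ y :< t :+ d ∷ [] ⊢ a :< d) _ y t δ e y<t+δ))
    ...   | _ , lower = lin 7 (λ z g e y t F G → z :* (y :- t) :≈ F :- G ∷ :- e :< z :- g ∷ t :< y ∷ [] ⊢ (g :- e) :* (y :- t) :≤ F :- G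
                            by # 1 ⊠ # 2 ∷ []) _ (g ⟨$⟩ t) ε y t (f ⟨$⟩ y) (f ⟨$⟩ t)
                            (÷-* ((f ⟨$⟩ y) - (f ⟨$⟩ t)) (lin 2 (λ y t → t :< y ∷ [] ⊢ c 0 :< y :- t) y t t<y)) lower t<y
    left : ∀ {y} → D y → y < t → t - δ < y → ((g ⟨$⟩ t) - ε) * (t - y) ≤ (f ⟨$⟩ t) - (f ⟨$⟩ y)
    left {y} Dy y<t t-δ<y with ∣∣-cases (y - t)
    ... | inj₁ (pos , _) = ⊥-elim (≤⇒≯ (lin 2 (λ y t → c 0 :≤ y :- t ∷ [] ⊢ t :≤ y) y t pos) y<t)
    ... | inj₂ (_ , e) with ∣∣<-elim (near Dy
            (lin 3 (λ a y t → a :≈ :- (y :- t) ∷ y :< t ∷ [] ⊢ c 0 :< a) _ y t e y<t)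
            (lin 4 (λ a y t d → a :≈ :- (y :- t) ∷ t :- d :< y ∷ [] ⊢ a :< d) _ y t δ e t-δ<y))
    ...   | _ , lower = lin 7 (λ r g e y t F G → (y :- t) :* r :≈ one ∷ :- e :< (F :- G) :* r :- g ∷ y :< t ∷ [] ⊢ (g :- e) :* (t :- y) :≤ G :- F
                            by # 1 ⊠ # 2 ∷ F :- G ⊡ # 0 ∷ []) ((y - t) ⁻¹) (g ⟨$⟩ t) ε y t (f ⟨$⟩ y) (f ⟨$⟩ t)
                            (⁻¹-inverseʳ (λ z → pos⇒≉0 (lin 2 (λ y t → y :< t ∷ [] ⊢ c 0 :< t :- y) y t y<t)
                               (lin 2 (λ y t → y :- t :≈ c 0 ∷ [] ⊢ t :- y :≈ c 0) y t z))) lower y<t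

  -- If Y < X, the slack with ε = (X - Y) / (l + 1) is too small to bridge the gap.
  no-slack : ∀ {X Y l} → 0# ≤ l → (∀ {ε} → 0# < ε → X - ε * l ≤ Y) → X ≤ Y
  no-slack {X} {Y} {l} 0≤l h with <-or-≥ Y X
  ... | inj₂ p = p
  ... | inj₁ Y<X = ⊥-elim (≤⇒≯ (h ε>0) (lin 4 (λ X Y l e → e :* (l :+ one) :≈ X :- Y ∷ c 0 :< e ∷ [] ⊢ Y :< X :- e :* l) X Y l ε εl ε>0))
    where
    l+1>0 : 0# < l + 1#
    l+1>0 = lin 1 (λ l → c 0 :≤ l ∷ [] ⊢ c 0 :< l :+ one) l 0≤l
    ε : ℝ
    ε = (X - Y) ÷ (l + 1#)
    εl : ε * (l + 1#) ≈ X - Y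
    εl = ÷-* (X - Y) l+1>0
    ε>0 : 0# < ε
    ε>0 = *-pos (lin 2 (λ X Y → Y :< X ∷ [] ⊢ c 0 :< X :- Y) X Y Y<X) (⁻¹-pos l+1>0)

  module Growth (a₀ b₀ : ℝ) where

    D : ℝ → Set
    D = ⟨ a₀ , b₀ ⟩

    between : ∀ {a b t} → D a → D b → a ≤ t → t ≤ b → D t
    between {a} {b} {t} (p , _) (_ , q) r s =
        lin 3 (λ z a t → z :< a ∷ a :≤ t ∷ [] ⊢ z :< t) a₀ a t p r
      , lin 3 (λ z b t → b :< z ∷ t :≤ b ∷ [] ⊢ t :< z) b₀ b t q s

    -- The left side is twice the integral of α + β t from a to b. Integration itself is avoided:
    -- with a slack ε per unit of length the inequality is additive and holds locally, so `Chain`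
    -- spreads it over the interval.
    affine-below : ∀ {f g a b α β} → IsDerivativeOn D f g → D a → D b → a ≤ b →
      (∀ {t} → a ≤ t → t ≤ b → α + β * t ≤ g ⟨$⟩ t) →
      (α + α) * (b - a) + β * (b * b - a * a) ≤ ((f ⟨$⟩ b) - (f ⟨$⟩ a)) + ((f ⟨$⟩ b) - (f ⟨$⟩ a))
    affine-below {f} {g} {a} {b} {α} {β} deriv Da Db a≤b below =
      no-slack (lin 2 (λ a b → a :≤ b ∷ [] ⊢ c 0 :≤ b :- a) a b a≤b) λ {ε} ε>0 → with-slack ε ε>0
      where
      module _ (ε : ℝ) (ε>0 : 0# < ε) where
        _∼_ : ℝ → ℝ → Set
        u ∼ v = (α + α) * (v - u) + β * (v * v - u * u) - ε * (v - u) ≤ ((f ⟨$⟩ v) - (f ⟨$⟩ u)) + ((f ⟨$⟩ v) - (f ⟨$⟩ u))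

        ∼-≈ : ∀ {u v} → u ≈ v → u ∼ v
        ∼-≈ {u} {v} e = lin 7 (λ a b e u v F G → u :≈ v ∷ F :≈ G ∷ []
          ⊢ (a :+ a) :* (v :- u) :+ b :* (v :* v :- u :* u) :- e :* (v :- u) :≤ (G :- F) :+ (G :- F)
          by a ⊡ # 0 ∷ b :* u ⊡ # 0 ∷ b :* v ⊡ # 0 ∷ e ⊡ # 0 ∷ []) α β ε u v (f ⟨$⟩ u) (f ⟨$⟩ v) e (Func.cong f e)

        ∼-trans : ∀ {u v w} → u ∼ v → v ∼ w → u ∼ w
        ∼-trans {u} {v} {w} = lin 9 (λ a b e u v w F G H →
            (a :+ a) :* (v :- u) :+ b :* (v :* v :- u :* u) :- e :* (v :- u) :≤ (G :- F) :+ (G :- F) ∷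
            (a :+ a) :* (w :- v) :+ b :* (w :* w :- v :* v) :- e :* (w :- v) :≤ (H :- G) :+ (H :- G) ∷ []
          ⊢ (a :+ a) :* (w :- u) :+ b :* (w :* w :- u :* u) :- e :* (w :- u) :≤ (H :- F) :+ (H :- F))
          α β ε u v w (f ⟨$⟩ u) (f ⟨$⟩ v) (f ⟨$⟩ w)

        -- Of the slack ε, the doubled error of the difference quotient takes one half, and the
        -- variation of β t over a distance below `η` the other.
        ε′ = half (half ε)

        B : ℝ
        B = 1# + β * β

        B>0 : 0# < B
        B>0 = lin 1 (λ b → [] ⊢ c 0 :< one :+ b :* b by sq b ∷ []) β

        η = half ε ÷ B

        ηB : η * B ≈ half ε
        ηB = ÷-* (half ε) B>0

        -- |β| ≤ 1 + β²
        small : ∀ {d} → 0# ≤ d → d < η → β * d ≤ half ε × - half ε ≤ β * d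
        small {d} 0≤d d<η =
            lin 4 (λ b d n h → n :* (one :+ b :* b) :≈ h ∷ c 0 :≤ d ∷ d :< n ∷ [] ⊢ b :* d :≤ h
              by sq (b :- one) ⊠ # 1 ∷ sq b ⊠ # 1 ∷ # 2 ∷ # 2 ⊠ sq b ∷ []) β d η (half ε) ηB 0≤d d<η
          , lin 4 (λ b d n h → n :* (one :+ b :* b) :≈ h ∷ c 0 :≤ d ∷ d :< n ∷ [] ⊢ :- h :≤ b :* d
              by sq (b :+ one) ⊠ # 1 ∷ sq b ⊠ # 1 ∷ # 2 ∷ # 2 ⊠ sq b ∷ []) β d η (half ε) ηB 0≤d d<η

        η>0 : 0# < η
        η>0 = *-pos (0<half ε>0) (⁻¹-pos B>0)

        local : ∀ {t} → a ≤ t → t ≤ b → ∃[ δ ] 0# < δ ×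
          (∀ {u v} → a ≤ u → u ≤ t → t ≤ v → v ≤ b → t - δ < u → v < t + δ → u ∼ v)
        local {t} a≤t t≤b with difference-quotient {f = f} {g = g} deriv (between Da Db a≤t t≤b) (0<half (0<half ε>0))
        ... | δ₁ , δ₁>0 , right , left with minimum δ₁>0 η>0
        ...   | δ , δ>0 , δ≤δ₁ , δ≤η = δ , δ>0 , λ a≤u u≤t t≤v v≤b p q → ∼-trans (before a≤u u≤t p) (after t≤v v≤b q)
          where
          after : ∀ {v} → t ≤ v → v ≤ b → v < t + δ → t ∼ v
          after (inj₂ t≈v) _ _ = ∼-≈ t≈v
          after {v} (inj₁ t<v) v≤b v<t+δ = lin 10 (λ a b e t v F G g h q →
              (g :- q) :* (v :- t) :≤ G :- F ∷ a :+ b :* t :≤ g ∷ b :* (v :- t) :≤ h ∷ t :< v ∷ q :+ q :≈ h ∷ h :+ h :≈ e ∷ []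
            ⊢ (a :+ a) :* (v :- t) :+ b :* (v :* v :- t :* t) :- e :* (v :- t) :≤ (G :- F) :+ (G :- F)
            by # 1 ⊠ # 3 ∷ # 2 ⊠ # 3 ∷ v :- t ⊡ # 4 ∷ v :- t ⊡ # 5 ∷ [])
            α β ε t v (f ⟨$⟩ t) (f ⟨$⟩ v) (g ⟨$⟩ t) (half ε) ε′
            (right (between Da Db (≤-trans a≤t (<⇒≤ t<v)) v≤b) t<v (lin 4 (λ v t d D → v :< t :+ d ∷ d :≤ D ∷ [] ⊢ v :< t :+ D) v t δ δ₁ v<t+δ δ≤δ₁))
            (below a≤t t≤b)
            (proj₁ (small (lin 2 (λ v t → t :< v ∷ [] ⊢ c 0 :≤ v :- t) v t t<v)
                          (lin 4 (λ v t d n → v :< t :+ d ∷ d :≤ n ∷ [] ⊢ v :- t :< n) v t δ η v<t+δ δ≤η)))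
            t<v (half+half (half ε)) (half+half ε)
          before : ∀ {u} → a ≤ u → u ≤ t → t - δ < u → u ∼ t
          before _ (inj₂ u≈t) _ = ∼-≈ u≈t
          before {u} a≤u (inj₁ u<t) t-δ<u = lin 10 (λ a b e t v F G g h q →
              (g :- q) :* (t :- v) :≤ F :- G ∷ a :+ b :* t :≤ g ∷ :- h :≤ b :* (t :- v) ∷ v :< t ∷ q :+ q :≈ h ∷ h :+ h :≈ e ∷ []
            ⊢ (a :+ a) :* (t :- v) :+ b :* (t :* t :- v :* v) :- e :* (t :- v) :≤ (F :- G) :+ (F :- G)
            by # 1 ⊠ # 3 ∷ # 2 ⊠ # 3 ∷ t :- v ⊡ # 4 ∷ t :- v ⊡ # 5 ∷ [])
            α β ε t u (f ⟨$⟩ t) (f ⟨$⟩ u) (g ⟨$⟩ t) (half ε) ε′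
            (left (between Da Db a≤u (≤-trans (<⇒≤ u<t) t≤b)) u<t (lin 4 (λ v t d D → t :- d :< v ∷ d :≤ D ∷ [] ⊢ t :- D :< v) u t δ δ₁ t-δ<u δ≤δ₁))
            (below a≤t t≤b)
            (proj₂ (small (lin 2 (λ v t → v :< t ∷ [] ⊢ c 0 :≤ t :- v) u t u<t)
                          (lin 4 (λ v t d n → t :- d :< v ∷ d :≤ n ∷ [] ⊢ t :- v :< n) u t δ η t-δ<u δ≤η)))
            u<t (half+half (half ε)) (half+half ε)

        with-slack : (α + α) * (b - a) + β * (b * b - a * a) - ε * (b - a) ≤ ((f ⟨$⟩ b) - (f ⟨$⟩ a)) + ((f ⟨$⟩ b) - (f ⟨$⟩ a))
        with-slack = Chain.chain a b a≤b _∼_ (∼-≈ refl) ∼-trans local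

    affine-above : ∀ {f g a b α β} → IsDerivativeOn D f g → D a → D b → a ≤ b →
      (∀ {t} → a ≤ t → t ≤ b → g ⟨$⟩ t ≤ α + β * t) →
      ((f ⟨$⟩ b) - (f ⟨$⟩ a)) + ((f ⟨$⟩ b) - (f ⟨$⟩ a)) ≤ (α + α) * (b - a) + β * (b * b - a * a)
    affine-above {f} {g} {a} {b} {α} {β} deriv Da Db a≤b above =
      lin 6 (λ α β a b F G → (:- α :+ :- α) :* (b :- a) :+ (:- β) :* (b :* b :- a :* a) :≤ (:- G :- :- F) :+ (:- G :- :- F) ∷ []
        ⊢ (G :- F) :+ (G :- F) :≤ (α :+ α) :* (b :- a) :+ β :* (b :* b :- a :* a)) α β a b (f ⟨$⟩ a) (f ⟨$⟩ b)
        (affine-below {negate f} {negate g} (negate-derivative {f = f} {g = g} deriv) Da Db a≤b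
          λ {t} p q → lin 4 (λ α β t g → g :≤ α :+ β :* t ∷ [] ⊢ :- α :+ :- β :* t :≤ :- g) α β t (g ⟨$⟩ t) (above p q))

    module Convex {f f′ f″ : Function} (df : IsDerivativeOn D f f′) (df′ : IsDerivativeOn D f′ f″)
      {m M : ℝ} (m>0 : 0# < m) (f″-bounds : ∀ {t} → D t → m ≤ f″ ⟨$⟩ t × f″ ⟨$⟩ t ≤ M)
      (μ : ℝ) (1≤μ : 1# ≤ μ) (2≤μm : 1# + 1# ≤ μ * m) (M≤μ : M ≤ μ) where

      open Weights μ 1≤μ

      slope-bounds : ∀ {a b} → D a → D b → a ≤ b →
                     m * (b - a) ≤ (f′ ⟨$⟩ b) - (f′ ⟨$⟩ a) × (f′ ⟨$⟩ b) - (f′ ⟨$⟩ a) ≤ M * (b - a)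
      slope-bounds {a} {b} Da Db a≤b =
          lin 5 (λ m a b F G → (m :+ m) :* (b :- a) :+ c 0 :* (b :* b :- a :* a) :≤ (G :- F) :+ (G :- F) ∷ [] ⊢ m :* (b :- a) :≤ G :- F)
            m a b (f′ ⟨$⟩ a) (f′ ⟨$⟩ b) (affine-below {f′} {f″} df′ Da Db a≤b
              λ {t} p q → lin 3 (λ m t g → m :≤ g ∷ [] ⊢ m :+ c 0 :* t :≤ g) m t _ (proj₁ (f″-bounds (between Da Db p q))))
        , lin 5 (λ m a b F G → (G :- F) :+ (G :- F) :≤ (m :+ m) :* (b :- a) :+ c 0 :* (b :* b :- a :* a) ∷ [] ⊢ G :- F :≤ m :* (b :- a))
            M a b (f′ ⟨$⟩ a) (f′ ⟨$⟩ b) (affine-above {f′} {f″} df′ Da Db a≤b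
              λ {t} p q → lin 3 (λ m t g → g :≤ m ∷ [] ⊢ g :≤ m :+ c 0 :* t) M t _ (proj₂ (f″-bounds (between Da Db p q))))

      Remainder : ℝ → ℝ → ℝ
      Remainder a b = (f ⟨$⟩ b) - (f ⟨$⟩ a) - (f′ ⟨$⟩ a) * (b - a)

      TaylorBounds : ℝ → ℝ → Set
      TaylorBounds a b = m * ((b - a) * (b - a)) ≤ Remainder a b + Remainder a b ×
                         Remainder a b + Remainder a b ≤ M * ((b - a) * (b - a))

      -- Integrates the slope bounds: to the right of a, the function f′ lies between the lines of
      -- slopes m and M through (a , f′(a)).
      forward : ∀ {a b} → D a → D b → a ≤ b → TaylorBounds a b
      forward {a} {b} Da Db a≤b =
          lin 6 (λ m a b F G s → (s :- m :* a :+ (s :- m :* a)) :* (b :- a) :+ m :* (b :* b :- a :* a) :≤ (G :- F) :+ (G :- F) ∷ []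
            ⊢ m :* ((b :- a) :* (b :- a)) :≤ (G :- F :- s :* (b :- a)) :+ (G :- F :- s :* (b :- a)))
            m a b (f ⟨$⟩ a) (f ⟨$⟩ b) (f′ ⟨$⟩ a) (affine-below {f} {f′} df Da Db a≤b
              λ {t} p q → lin 5 (λ m a t s g → m :* (t :- a) :≤ g :- s ∷ [] ⊢ s :- m :* a :+ m :* t :≤ g)
                m a t (f′ ⟨$⟩ a) (f′ ⟨$⟩ t) (proj₁ (slope-bounds Da (between Da Db p q) p)))
        , lin 6 (λ m a b F G s → (G :- F) :+ (G :- F) :≤ (s :- m :* a :+ (s :- m :* a)) :* (b :- a) :+ m :* (b :* b :- a :* a) ∷ []
            ⊢ (G :- F :- s :* (b :- a)) :+ (G :- F :- s :* (b :- a)) :≤ m :* ((b :- a) :* (b :- a)))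
            M a b (f ⟨$⟩ a) (f ⟨$⟩ b) (f′ ⟨$⟩ a) (affine-above {f} {f′} df Da Db a≤b
              λ {t} p q → lin 5 (λ m a t s g → g :- s :≤ m :* (t :- a) ∷ [] ⊢ g :≤ s :- m :* a :+ m :* t)
                M a t (f′ ⟨$⟩ a) (f′ ⟨$⟩ t) (proj₂ (slope-bounds Da (between Da Db p q) p)))

      backward : ∀ {a b} → D a → D b → a ≤ b → TaylorBounds b a
      backward {a} {b} Da Db a≤b =
          lin 6 (λ m a b F G s → (G :- F) :+ (G :- F) :≤ (s :- m :* b :+ (s :- m :* b)) :* (b :- a) :+ m :* (b :* b :- a :* a) ∷ []
            ⊢ m :* ((a :- b) :* (a :- b)) :≤ (F :- G :- s :* (a :- b)) :+ (F :- G :- s :* (a :- b)))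
            m a b (f ⟨$⟩ a) (f ⟨$⟩ b) (f′ ⟨$⟩ b) (affine-above {f} {f′} df Da Db a≤b
              λ {t} p q → lin 5 (λ m b t s g → m :* (b :- t) :≤ s :- g ∷ [] ⊢ g :≤ s :- m :* b :+ m :* t)
                m b t (f′ ⟨$⟩ b) (f′ ⟨$⟩ t) (proj₁ (slope-bounds (between Da Db p q) Db q)))
        , lin 6 (λ m a b F G s → (s :- m :* b :+ (s :- m :* b)) :* (b :- a) :+ m :* (b :* b :- a :* a) :≤ (G :- F) :+ (G :- F) ∷ []
            ⊢ (F :- G :- s :* (a :- b)) :+ (F :- G :- s :* (a :- b)) :≤ m :* ((a :- b) :* (a :- b)))
            M a b (f ⟨$⟩ a) (f ⟨$⟩ b) (f′ ⟨$⟩ b) (affine-below {f} {f′} df Da Db a≤b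
              λ {t} p q → lin 5 (λ m b t s g → s :- g :≤ m :* (b :- t) ∷ [] ⊢ s :- m :* b :+ m :* t :≤ g)
                M b t (f′ ⟨$⟩ b) (f′ ⟨$⟩ t) (proj₂ (slope-bounds (between Da Db p q) Db q)))

      -- Slopes lie between m and M, Taylor coefficients between m / 2 and M / 2. Both are in
      -- [m / 2 , M], which `2≤μm` and `M≤μ` place inside [1/μ , μ].
      ratio-weight : ∀ {y z} → 0# < z → m * z ≤ y + y → y + y ≤ (M + M) * z → ∃[ w ] Weight w × y ≈ w * z
      ratio-weight {y} {z} z>0 p q = y ÷ z , (low , high) , sym (÷-* y z>0)
        where
        m≤2w : m ≤ y ÷ z + y ÷ z
        m≤2w = lin 4 (λ m y z w → w :* z :≈ y ∷ c 0 :< z ∷ m :* z :≤ y :+ y ∷ [] ⊢ m :≤ w :+ w by # 1 ⊠ ¬g ∷ []) m y z (y ÷ z) (÷-* y z>0) z>0 p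
        low : 1# ≤ μ * (y ÷ z)
        low = lin 3 (λ μ m w → m :≤ w :+ w ∷ one :≤ μ ∷ one :+ one :≤ μ :* m ∷ [] ⊢ one :≤ μ :* w by # 1 ⊠ # 0 ∷ # 0 ∷ []) μ m (y ÷ z) m≤2w 1≤μ 2≤μm
        high : y ÷ z ≤ μ
        high = lin 5 (λ M y z w μ → w :* z :≈ y ∷ c 0 :< z ∷ y :+ y :≤ (M :+ M) :* z ∷ M :≤ μ ∷ [] ⊢ w :≤ μ by # 1 ⊠ ¬g ∷ # 1 ⊠ # 3 ∷ [])
                 M y z (y ÷ z) μ (÷-* y z>0) z>0 q M≤μ

      increasing-slope : ∀ {x y} → D x → D y → x < y → ∃[ w ] Weight w × (f′ ⟨$⟩ y) - (f′ ⟨$⟩ x) ≈ w * (y - x)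
      increasing-slope {x} {y} Dx Dy x<y = from (slope-bounds Dx Dy (<⇒≤ x<y))
        where
        Δ = (f′ ⟨$⟩ y) - (f′ ⟨$⟩ x)
        0<d : 0# < y - x
        0<d = lin 2 (λ x y → x :< y ∷ [] ⊢ c 0 :< y :- x) x y x<y
        from : m * (y - x) ≤ Δ × Δ ≤ M * (y - x) → ∃[ w ] Weight w × Δ ≈ w * (y - x)
        from (p , q) = ratio-weight {Δ} {y - x} 0<d
          (lin 2 (λ p F → p :≤ F ∷ c 0 :< p ∷ [] ⊢ p :≤ F :+ F) (m * (y - x)) Δ p (*-pos m>0 0<d))
          (lin 3 (λ M d F → F :≤ M :* d ∷ [] ⊢ F :+ F :≤ (M :+ M) :* d) M (y - x) Δ q)

      slope : ∀ {x y} → D x → D y → ∃[ w ] Weight w × (f′ ⟨$⟩ y) - (f′ ⟨$⟩ x) ≈ w * (y - x)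
      slope {x} {y} Dx Dy with compare x y
      ... | tri≈ _ e _ = 1# , weight-1 , lin 4 (λ x y F G → x :≈ y ∷ F :≈ G ∷ [] ⊢ G :- F :≈ one :* (y :- x))
                           x y (f′ ⟨$⟩ x) (f′ ⟨$⟩ y) e (Func.cong f′ e)
      ... | tri< x<y _ _ = increasing-slope Dx Dy x<y
      ... | tri> _ _ y<x = reverse (increasing-slope Dy Dx y<x)
        where
        reverse : ∃[ w ] Weight w × (f′ ⟨$⟩ x) - (f′ ⟨$⟩ y) ≈ w * (x - y) → ∃[ w ] Weight w × (f′ ⟨$⟩ y) - (f′ ⟨$⟩ x) ≈ w * (y - x)
        reverse (w , W , e) = w , W , lin 5 (λ x y F G w → F :- G :≈ w :* (x :- y) ∷ [] ⊢ G :- F :≈ w :* (y :- x))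
                                x y (f′ ⟨$⟩ x) (f′ ⟨$⟩ y) w e

      TaylorWeight : ℝ → ℝ → Set
      TaylorWeight x y = ∃[ w ] Weight w × (f ⟨$⟩ y) - (f ⟨$⟩ x) ≈ (f′ ⟨$⟩ x) * (y - x) + w * ((y - x) * (y - x))

      from-bounds : ∀ {x y} → 0# < (y - x) * (y - x) → TaylorBounds x y → TaylorWeight x y
      from-bounds {x} {y} d²>0 (p , q) with ratio-weight d²>0 p
        (lin 3 (λ M z r → r :≤ M :* z ∷ c 0 :≤ M :* z ∷ [] ⊢ r :≤ (M :+ M) :* z) M ((y - x) * (y - x)) _ q
          (lin 3 (λ m p r → c 0 :< m :* p ∷ m :* p :≤ r ∷ [] ⊢ c 0 :≤ r) m ((y - x) * (y - x)) _ (*-pos m>0 d²>0) (≤-trans p q)))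
      ... | w , W , e = w , W , lin 5 (λ F G s d w → G :- F :- s :* d :≈ w :* (d :* d) ∷ [] ⊢ G :- F :≈ s :* d :+ w :* (d :* d))
                          (f ⟨$⟩ x) (f ⟨$⟩ y) (f′ ⟨$⟩ x) (y - x) w e

      taylor : ∀ {x y} → D x → D y → TaylorWeight x y
      taylor {x} {y} Dx Dy with compare x y
      ... | tri≈ _ e _ = 1# , weight-1 ,
              lin 5 (λ x y F G s → x :≈ y ∷ F :≈ G ∷ [] ⊢ G :- F :≈ s :* (y :- x) :+ one :* ((y :- x) :* (y :- x))
                by s ⊡ # 0 ∷ x ⊡ # 0 ∷ y ⊡ # 0 ∷ []) x y (f ⟨$⟩ x) (f ⟨$⟩ y) (f′ ⟨$⟩ x) e (Func.cong f e)
      ... | tri< x<y _ _ = from-bounds (*-pos 0<d 0<d) (forward Dx Dy (<⇒≤ x<y))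
        where 0<d = lin 2 (λ x y → x :< y ∷ [] ⊢ c 0 :< y :- x) x y x<y
      ... | tri> _ _ y<x = from-bounds (lin 2 (λ x y → y :< x ∷ [] ⊢ c 0 :< (y :- x) :* (y :- x) by # 0 ⊠ # 0 ∷ []) x y y<x)
                             (backward Dy Dx (<⇒≤ y<x))

    -- |f″| ≥ m leaves the sign of f″ open. Being differentiable, f″ cannot jump between -m and m,
    -- and the local constancy of its sign is spread over the interval by `Chain`.
    module ConstantSign {f″ f‴ : Function} (df″ : IsDerivativeOn D f″ f‴) {m : ℝ} (m>0 : 0# < m)
      (m≤ : ∀ {t} → D t → m ≤ ∣ f″ ⟨$⟩ t ∣) where

      -- Strict signs, since a relation that admits 0 would not be transitive.
      StrictSameSign : ℝ → ℝ → Set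
      StrictSameSign u v = (0# < f″ ⟨$⟩ u × 0# < f″ ⟨$⟩ v) ⊎ (f″ ⟨$⟩ u < 0# × f″ ⟨$⟩ v < 0#)

      SSS-trans : ∀ {u v w} → StrictSameSign u v → StrictSameSign v w → StrictSameSign u w
      SSS-trans (inj₁ (p , _)) (inj₁ (_ , r)) = inj₁ (p , r)
      SSS-trans (inj₂ (p , _)) (inj₂ (_ , r)) = inj₂ (p , r)
      SSS-trans (inj₁ (_ , q)) (inj₂ (q′ , _)) = ⊥-elim (≤⇒≯ (<⇒≤ q) q′)
      SSS-trans (inj₂ (_ , q)) (inj₁ (q′ , _)) = ⊥-elim (≤⇒≯ (<⇒≤ q′) q)

      signed : ∀ {t} → D t → m ≤ f″ ⟨$⟩ t ⊎ f″ ⟨$⟩ t ≤ - m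
      signed {t} Dt with ∣∣-cases (f″ ⟨$⟩ t)
      ... | inj₁ (_ , e) = inj₁ (lin 3 (λ m a y → m :≤ a ∷ a :≈ y ∷ [] ⊢ m :≤ y) m _ (f″ ⟨$⟩ t) (m≤ Dt) e)
      ... | inj₂ (_ , e) = inj₂ (lin 3 (λ m a y → m :≤ a ∷ a :≈ :- y ∷ [] ⊢ y :≤ :- m) m _ (f″ ⟨$⟩ t) (m≤ Dt) e)

      refl-sign : ∀ {t} → D t → StrictSameSign t t
      refl-sign Dt with signed Dt
      ... | inj₁ p = inj₁ (q , q) where q = lin 2 (λ m y → c 0 :< m ∷ m :≤ y ∷ [] ⊢ c 0 :< y) m _ m>0 p
      ... | inj₂ p = inj₂ (q , q) where q = lin 2 (λ m y → c 0 :< m ∷ y :≤ :- m ∷ [] ⊢ y :< c 0) m _ m>0 p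

      -- Near t the function f″ varies by less than m.
      nearby : ∀ {t} → D t → ∃[ δ ] 0# < δ × (∀ {y} → D y → t - δ < y → y < t + δ → StrictSameSign t y)
      nearby {t} Dt with df″ Dt 0<1
      ... | δ₁ , δ₁>0 , near with minimum δ₁>0 (*-pos m>0 (⁻¹-pos B>0))
        where
        B : ℝ
        B = ∣ f‴ ⟨$⟩ t ∣ + 1#
        B>0 : 0# < B
        B>0 with ∣∣-cases (f‴ ⟨$⟩ t)
        ... | inj₁ (p , e) = lin 2 (λ a y → a :≈ y ∷ c 0 :≤ y ∷ [] ⊢ c 0 :< a :+ one) _ (f‴ ⟨$⟩ t) e p
        ... | inj₂ (p , e) = lin 2 (λ a y → a :≈ :- y ∷ y :< c 0 ∷ [] ⊢ c 0 :< a :+ one) _ (f‴ ⟨$⟩ t) e p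
      ...   | δ , δ>0 , δ≤δ₁ , δ≤η = δ , δ>0 , same
        where
        F : ℝ → ℝ
        F y = f″ ⟨$⟩ y
        A : ℝ
        A = ∣ f‴ ⟨$⟩ t ∣
        A≥ : - A ≤ f‴ ⟨$⟩ t × f‴ ⟨$⟩ t ≤ A
        A≥ with ∣∣-cases (f‴ ⟨$⟩ t)
        ... | inj₁ (p , e) = lin 2 (λ a y → a :≈ y ∷ c 0 :≤ y ∷ [] ⊢ :- a :≤ y) A (f‴ ⟨$⟩ t) e p , ≈⇒≤ (sym e)
        ... | inj₂ (p , e) = lin 2 (λ a y → a :≈ :- y ∷ y :< c 0 ∷ [] ⊢ :- a :≤ y) A (f‴ ⟨$⟩ t) e p
                           , lin 2 (λ a y → a :≈ :- y ∷ y :< c 0 ∷ [] ⊢ y :≤ a) A (f‴ ⟨$⟩ t) e p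
        A+1>0 : 0# < A + 1#
        A+1>0 = lin 2 (λ a y → :- a :≤ y ∷ y :≤ a ∷ [] ⊢ c 0 :< a :+ one) A (f‴ ⟨$⟩ t) (proj₁ A≥) (proj₂ A≥)
        Bδ≤m : (A + 1#) * δ ≤ m
        Bδ≤m = lin 4 (λ B d m r → d :≤ m :* r ∷ B :* r :≈ one ∷ c 0 :< B ∷ [] ⊢ B :* d :≤ m by # 0 ⊠ # 2 ∷ m ⊡ # 1 ∷ [])
                 (A + 1#) δ m ((A + 1#) ⁻¹) δ≤η (⁻¹-inverse A+1>0) A+1>0
        variation : ∀ {y} → D y → 0# < ∣ y - t ∣ → ∣ y - t ∣ < δ → (F y - F t < m) × (- m < F y - F t)
        variation {y} Dy p q with ∣∣<-elim (near Dy p (lin 3 (λ a d D → a :< d ∷ d :≤ D ∷ [] ⊢ a :< D) _ δ δ₁ q δ≤δ₁)) | ∣∣-cases (y - t)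
        ... | hi , lo | inj₁ (_ , e) =
            lin 7 (λ a d z g A X m → a :< d ∷ c 0 :< a ∷ z :* a :≈ X ∷ z :- g :< one ∷ g :≤ A ∷ (A :+ one) :* d :≤ m ∷ c 0 :< A :+ one ∷ [] ⊢ X :< m
              by # 3 ⊠ # 1 ∷ # 4 ⊠ # 1 ∷ # 6 ⊠ # 0 ∷ [])
              _ δ ((F y - F t) ÷ (y - t)) (f‴ ⟨$⟩ t) A (F y - F t) m q p (za e) hi (proj₂ A≥) Bδ≤m A+1>0
          , lin 7 (λ a d z g A X m → a :< d ∷ c 0 :< a ∷ z :* a :≈ X ∷ :- one :< z :- g ∷ :- A :≤ g ∷ (A :+ one) :* d :≤ m ∷ c 0 :< A :+ one ∷ [] ⊢ :- m :< X
              by # 3 ⊠ # 1 ∷ # 4 ⊠ # 1 ∷ # 6 ⊠ # 0 ∷ [])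
              _ δ ((F y - F t) ÷ (y - t)) (f‴ ⟨$⟩ t) A (F y - F t) m q p (za e) lo (proj₁ A≥) Bδ≤m A+1>0
          where
          za : ∣ y - t ∣ ≈ y - t → (F y - F t) ÷ (y - t) * ∣ y - t ∣ ≈ F y - F t
          za e = trans (*-congˡ e) (÷-* (F y - F t) (lin 2 (λ a b → a :≈ b ∷ c 0 :< a ∷ [] ⊢ c 0 :< b) _ (y - t) e p))
        ... | hi , lo | inj₂ (neg , e) =
            lin 7 (λ a d z g A X m → a :< d ∷ c 0 :< a ∷ z :* a :≈ :- X ∷ :- one :< z :- g ∷ :- A :≤ g ∷ (A :+ one) :* d :≤ m ∷ c 0 :< A :+ one ∷ [] ⊢ X :< m
              by # 3 ⊠ # 1 ∷ # 4 ⊠ # 1 ∷ # 6 ⊠ # 0 ∷ [])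
              _ δ ((F y - F t) ÷ (y - t)) (f‴ ⟨$⟩ t) A (F y - F t) m q p (za e) lo (proj₁ A≥) Bδ≤m A+1>0
          , lin 7 (λ a d z g A X m → a :< d ∷ c 0 :< a ∷ z :* a :≈ :- X ∷ z :- g :< one ∷ g :≤ A ∷ (A :+ one) :* d :≤ m ∷ c 0 :< A :+ one ∷ [] ⊢ :- m :< X
              by # 3 ⊠ # 1 ∷ # 4 ⊠ # 1 ∷ # 6 ⊠ # 0 ∷ [])
              _ δ ((F y - F t) ÷ (y - t)) (f‴ ⟨$⟩ t) A (F y - F t) m q p (za e) hi (proj₂ A≥) Bδ≤m A+1>0
          where
          za : ∣ y - t ∣ ≈ - (y - t) → (F y - F t) ÷ (y - t) * ∣ y - t ∣ ≈ - (F y - F t)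
          za e = lin 4 (λ a d r X → a :≈ :- d ∷ d :* r :≈ one ∷ [] ⊢ X :* r :* a :≈ :- X by X :* r ⊡ # 0 ∷ X ⊡ # 1 ∷ [])
            ∣ y - t ∣ (y - t) ((y - t) ⁻¹) (F y - F t) e
            (⁻¹-inverseʳ (λ z → pos⇒≉0 p (lin 2 (λ a d → a :≈ :- d ∷ d :≈ c 0 ∷ [] ⊢ a :≈ c 0) ∣ y - t ∣ (y - t) e z)))

        decide : ∀ {y} → D y → (F y - F t < m) × (- m < F y - F t) → StrictSameSign t y
        decide {y} Dy (hi , lo) with signed Dt
        ... | inj₁ p = inj₁ (lin 2 (λ m y → c 0 :< m ∷ m :≤ y ∷ [] ⊢ c 0 :< y) m (F t) m>0 p
                           , lin 3 (λ m y t → m :≤ t ∷ :- m :< y :- t ∷ [] ⊢ c 0 :< y) m (F y) (F t) p lo)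
        ... | inj₂ p = inj₂ (lin 2 (λ m y → c 0 :< m ∷ y :≤ :- m ∷ [] ⊢ y :< c 0) m (F t) m>0 p
                           , lin 3 (λ m y t → t :≤ :- m ∷ y :- t :< m ∷ [] ⊢ y :< c 0) m (F y) (F t) p hi)

        same : ∀ {y} → D y → t - δ < y → y < t + δ → StrictSameSign t y
        same {y} Dy p q with compare y t
        ... | tri≈ _ e _ = decide Dy
            ( lin 3 (λ F G m → F :≈ G ∷ c 0 :< m ∷ [] ⊢ F :- G :< m) (F y) (F t) m (Func.cong f″ e) m>0
            , lin 3 (λ F G m → F :≈ G ∷ c 0 :< m ∷ [] ⊢ :- m :< F :- G) (F y) (F t) m (Func.cong f″ e) m>0)
        ... | tri< y<t _ _ = decide Dy (variation Dy
            (∣∣-pos (inj₂ y<t))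
            (∣∣<-intro (lin 3 (λ y t d → y :< t :+ d ∷ [] ⊢ y :- t :< d) y t δ q) (lin 3 (λ y t d → t :- d :< y ∷ [] ⊢ :- d :< y :- t) y t δ p)))
          where
          ∣∣-pos : t < y ⊎ y < t → 0# < ∣ y - t ∣
          ∣∣-pos _ with ∣∣-cases (y - t)
          ... | inj₁ (r , e) = ⊥-elim (≤⇒≯ (lin 2 (λ y t → c 0 :≤ y :- t ∷ [] ⊢ t :≤ y) y t r) y<t)
          ... | inj₂ (r , e) = lin 2 (λ a d → a :≈ :- d ∷ d :< c 0 ∷ [] ⊢ c 0 :< a) _ (y - t) e r
        ... | tri> _ _ t<y = decide Dy (variation Dy ∣∣-pos
            (∣∣<-intro (lin 3 (λ y t d → y :< t :+ d ∷ [] ⊢ y :- t :< d) y t δ q) (lin 3 (λ y t d → t :- d :< y ∷ [] ⊢ :- d :< y :- t) y t δ p)))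
          where
          ∣∣-pos : 0# < ∣ y - t ∣
          ∣∣-pos with ∣∣-cases (y - t)
          ... | inj₁ (r , e) = lin 3 (λ a y t → a :≈ y :- t ∷ t :< y ∷ [] ⊢ c 0 :< a) _ y t e t<y
          ... | inj₂ (r , e) = ⊥-elim (≤⇒≯ (<⇒≤ t<y) (lin 2 (λ y t → y :- t :< c 0 ∷ [] ⊢ y :< t) y t r))

      flip-sign : ∀ {u v} → StrictSameSign u v → StrictSameSign v u
      flip-sign (inj₁ (p , q)) = inj₁ (q , p)
      flip-sign (inj₂ (p , q)) = inj₂ (q , p)

      constant-sign-≤ : ∀ {a b} → D a → D b → a ≤ b → StrictSameSign a b
      constant-sign-≤ {a} {b} Da Db a≤b = Chain.chain a b a≤b StrictSameSign (refl-sign Da) SSS-trans local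
        where
        local : ∀ {t} → a ≤ t → t ≤ b → ∃[ δ ] 0# < δ ×
          (∀ {u v} → a ≤ u → u ≤ t → t ≤ v → v ≤ b → t - δ < u → v < t + δ → StrictSameSign u v)
        local {t} a≤t t≤b with nearby (between Da Db a≤t t≤b)
        ... | δ , δ>0 , same = δ , δ>0 , λ {u} {v} a≤u u≤t t≤v v≤b p q →
          SSS-trans (flip-sign (same (between Da Db a≤u (≤-trans u≤t t≤b)) p (lin 3 (λ u t d → u :≤ t ∷ c 0 :< d ∷ [] ⊢ u :< t :+ d) u t δ u≤t δ>0)))
                    (same (between Da Db (≤-trans a≤t t≤v) v≤b) (lin 3 (λ v t d → t :≤ v ∷ c 0 :< d ∷ [] ⊢ t :- d :< v) v t δ t≤v δ>0) q)

      constant-sign : ∀ {a b} → D a → D b → StrictSameSign a b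
      constant-sign {a} {b} Da Db = [ constant-sign-≤ Da Db , (λ p → flip-sign (constant-sign-≤ Db Da p)) ] (≤-total a b)

      one-signed : ∀ {a} → D a → (∀ {t} → D t → m ≤ f″ ⟨$⟩ t) ⊎ (∀ {t} → D t → f″ ⟨$⟩ t ≤ - m)
      one-signed {a} Da = Sum.map
        (λ p {t} Dt → [ (λ q → q) , (λ q → ⊥-elim (clash p (constant-sign Da Dt) (lin 2 (λ m y → c 0 :< m ∷ y :≤ :- m ∷ [] ⊢ y :< c 0) m (f″ ⟨$⟩ t) m>0 q))) ] (signed Dt))
        (λ p {t} Dt → [ (λ q → ⊥-elim (clash′ p (constant-sign Da Dt) (lin 2 (λ m y → c 0 :< m ∷ m :≤ y ∷ [] ⊢ c 0 :< y) m (f″ ⟨$⟩ t) m>0 q))) , (λ q → q) ] (signed Dt))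
        (signed Da)
        where
        clash : ∀ {t} → m ≤ f″ ⟨$⟩ a → StrictSameSign a t → f″ ⟨$⟩ t < 0# → ⊥
        clash _ (inj₁ (_ , q)) r = ≤⇒≯ (<⇒≤ q) r
        clash p (inj₂ (q , _)) r = ≤⇒≯ p (lin 2 (λ m y → c 0 :< m ∷ y :< c 0 ∷ [] ⊢ y :< m) m (f″ ⟨$⟩ a) m>0 q)
        clash′ : ∀ {t} → f″ ⟨$⟩ a ≤ - m → StrictSameSign a t → 0# < f″ ⟨$⟩ t → ⊥
        clash′ _ (inj₂ (_ , q)) r = ≤⇒≯ (<⇒≤ q) r
        clash′ p (inj₁ (q , _)) r = ≤⇒≯ p (lin 2 (λ m y → c 0 :< m ∷ c 0 :< y ∷ [] ⊢ :- m :< y) m (f″ ⟨$⟩ a) m>0 q)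

-- Rational points

unique-length : ∀ {A : Set} {zs ys : List A} → Unique zs → (∀ {z} → z ∈ zs → z ∈ ys) → length zs ℕ.≤ length ys
unique-length {zs = []} _ _ = ℕ.z≤n
unique-length {zs = z ∷ zs} {ys} (z∉ AllPairs.∷ u) sub with ∈-∃++ (sub (here ≡.refl))
... | as , bs , ≡.refl = ℕP.≤-trans (ℕ.s≤s (unique-length {zs = zs} {as ++ bs} u sub′)) (ℕP.≤-reflexive eq)
  where
  eq : suc (length (as ++ bs)) ≡ length (as ++ z ∷ bs)
  eq = ≡.trans (cong suc (ListP.length-++ as)) (≡.trans (≡.sym (ℕP.+-suc (length as) (length bs))) (≡.sym (ListP.length-++ as)))
  sub′ : ∀ {y} → y ∈ zs → y ∈ as ++ bs
  sub′ {y} y∈ with ∈-++⁻ as (sub (there y∈))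
  ... | inj₁ p = ∈-++⁺ˡ p
  ... | inj₂ (here ≡.refl) = ⊥-elim (All.lookup z∉ y∈ ≡.refl)
  ... | inj₂ (there p) = ∈-++⁺ʳ as p

-- The reduced denominator divides q times the numerator and is coprime to the numerator, so it
-- divides q.
denominator-divides : ∀ {q} {x : ℚ} {p} → 0 ℕ.< q → (+ q / 1) ℚ.* x ≡ p / 1 → ↧ₙ x ℕ.≤ q
denominator-divides {suc q} {x@(mkℚ n d c)} {p} _ e = ℕD.∣⇒≤ (Coprimality.coprime-divisor
    (Coprimality.sym (Coprimality.recompute c)) (≡.subst (suc d ℕD.∣_) (ℕP.*-comm (suc q) ℤ.∣ n ∣) divides))
  where
  unnormalised : mkℚᵘ (+ suc q) 0 ℚᵘ.* mkℚᵘ n d ℚᵘ.≃ mkℚᵘ p 0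
  unnormalised = ℚᵘP.≃-trans (ℚᵘP.*-congʳ (ℚᵘP.≃-sym (ℚP.toℚᵘ-fromℚᵘ (mkℚᵘ (+ suc q) 0))))
    (ℚᵘP.≃-trans (ℚᵘP.≃-sym (ℚP.toℚᵘ-homo-* (+ suc q / 1) x))
      (ℚᵘP.≃-trans (ℚᵘP.≃-reflexive (cong ℚ.toℚᵘ e)) (ℚP.toℚᵘ-fromℚᵘ (mkℚᵘ p 0))))
  integers : + suc q ℤ.* n ℤ.* + 1 ≡ p ℤ.* (+ 1 ℤ.* + suc d)
  integers with unnormalised
  ... | *≡* e′ = e′
  divides : suc d ℕD.∣ suc q ℕ.* ℤ.∣ n ∣
  divides = ℕD.divides ℤ.∣ p ∣ (≡.trans (≡.sym (ℤP.abs-* (+ suc q) n))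
    (≡.trans (cong ℤ.∣_∣ (≡.trans (≡.sym (ℤP.*-identityʳ (+ suc q ℤ.* n))) (≡.trans integers (cong (p ℤ.*_) (ℤP.*-identityˡ (+ suc d))))))
      (ℤP.abs-* p (+ suc d))))

/-clears : ∀ q p → (+ suc q / 1) ℚ.* (p / suc q) ≡ p / 1
/-clears q p = ℚP.toℚᵘ-injective (ℚᵘP.≃-trans (ℚP.toℚᵘ-homo-* (+ suc q / 1) (p / suc q))
  (ℚᵘP.≃-trans (ℚᵘP.*-cong (ℚP.toℚᵘ-fromℚᵘ (mkℚᵘ (+ suc q) 0)) (ℚP.toℚᵘ-fromℚᵘ (mkℚᵘ p q)))
    (ℚᵘP.≃-trans (*≡* (≡.trans (ℤP.*-identityʳ _) (≡.trans (ℤP.*-comm (+ suc q) p) (cong (p ℤ.*_) (≡.sym (ℤP.*-identityˡ (+ suc q)))))))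
      (ℚᵘP.≃-sym (ℚP.toℚᵘ-fromℚᵘ (mkℚᵘ p 0))))))

range : ℕ → List ℤ
range B = map +_ (upTo (suc B)) ++ map -[1+_] (upTo B)

∈-range : ∀ {B} i → ℤ.∣ i ∣ ℕ.≤ B → i ∈ range B
∈-range (+ n)    p = ∈-++⁺ˡ (∈-map⁺ +_ (∈-upTo⁺ (ℕ.s≤s p)))
∈-range -[1+ n ] p = ∈-++⁺ʳ (map +_ (upTo _)) (∈-map⁺ -[1+_] (∈-upTo⁺ p))

module Enumeration (em : ExcludedMiddle 0ℓ) (R : CompleteOrderedField) where

  open Real em R
  open Counting em

  enumerate : ∀ {A : Set} (P : A → Set) (xs : List A) → (∀ {x} → P x → x ∈ xs) → ∃ (HasCardinality P)
  enumerate {A} P xs covers with select xs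
    where
    select : ∀ xs → ∃[ ys ] Unique ys × (∀ {x} → x ∈ ys → P x) × (∀ {x} → P x → x ∈ xs → x ∈ ys)
    select [] = [] , AllPairs.[] , (λ ()) , (λ _ ())
    select (x ∷ xs) with select xs
    ... | ys , u , sound , complete with em {P x} | em {x ∈ ys}
    ...   | yes p | no x∉ = x ∷ ys , All.tabulate (λ {y} y∈ x≡y → x∉ (≡.subst (_∈ ys) (≡.sym x≡y) y∈)) AllPairs.∷ u
                          , (λ { (here ≡.refl) → p ; (there q) → sound q })
                          , (λ { _ (here e) → here e ; q (there r) → there (complete q r) })
    ...   | yes p | yes x∈ = ys , u , sound , (λ { _ (here ≡.refl) → x∈ ; q (there r) → complete q r })
    ...   | no ¬p | _ = ys , u , sound , (λ { q (here ≡.refl) → ⊥-elim (¬p q) ; q (there r) → complete q r })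
  ... | ys , u , sound , complete = length ys , ys , u , (λ x → mk⇔ sound (λ p → complete p (covers p))) , ≡.refl

  cardinality-≥ : ∀ {A : Set} {P : A → Set} {n zs} → HasCardinality P n → Unique zs → (∀ {z} → z ∈ zs → P z) → length zs ℕ.≤ n
  cardinality-≥ {n = n} {zs} (ys , _ , iff , len) u sound = ≡.subst (length zs ℕ.≤_) len
    (unique-length u (λ {z} z∈ → Equivalence.from (iff z) (sound z∈)))

  -- No element is related to two indices, so one choice for each index yields a list without
  -- repetitions.
  choose : ∀ {A : Set} (P : ℕ → Set) (Rel : ℕ → A → Set) → ∀ a n →
    (∀ {i} → i ∈[ a ,+ n ⟩ → P i → ∃ (Rel i)) →
    (∀ {i j y} → i ∈[ a ,+ n ⟩ → j ∈[ a ,+ n ⟩ → Rel i y → Rel j y → i ≡ j) →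
    ∃[ ys ] length ys ≡ count P a n × Unique ys × (∀ {y} → y ∈ ys → ∃[ i ] i ∈[ a ,+ n ⟩ × Rel i y)
  choose P Rel a zero f inj = [] , ≡.refl , AllPairs.[] , (λ ())
  choose P Rel a (suc n) f inj
    with choose P Rel (suc a) n (λ i∈ → f (∈-tail i∈)) (λ i∈ j∈ → inj (∈-tail i∈) (∈-tail j∈)) | em {P a}
  ... | ys , len , u , from | no ¬p = ys , len , u , λ y∈ → let i , i∈ , r = from y∈ in i , ∈-tail i∈ , r
  ... | ys , len , u , from | yes p with f ∈-head p
  ...   | y , r = y ∷ ys , cong suc len , All.tabulate (λ z∈ y≡z → fresh (≡.subst (_∈ ys) (≡.sym y≡z) z∈)) AllPairs.∷ u
                , λ { (here ≡.refl) → a , ∈-head , r ; (there y∈) → let i , i∈ , r = from y∈ in i , ∈-tail i∈ , r }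
    where
    fresh : ¬ y ∈ ys
    fresh y∈ with from y∈
    ... | i , i∈ , r′ = ℕP.<-irrefl (inj ∈-head (∈-tail i∈) r r′) (proj₁ i∈)

  fromℚ-↥ : ∀ r → fromℚ r * fromℕ (↧ₙ r) ≈ fromℤ (↥ r)
  fromℚ-↥ (mkℚ n d _) = ÷-* (fromℤ n) (0<fromℕ-suc d)

  -- `p / suc q` is stored in lowest terms; multiplying by the gcd restores the given numerator and
  -- denominator.
  fromℚ-/ : ∀ p q → fromℚ (p / suc q) * fromℕ (suc q) ≈ fromℤ p
  fromℚ-/ p q = lin 6 (λ r u d g P Q → r :* d :≈ u ∷ u :* g :≈ P ∷ d :* g :≈ Q ∷ [] ⊢ r :* Q :≈ P by g ⊡ # 0 ∷ r ⊡ # 2 ∷ [])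
    (fromℚ (p / suc q)) (fromℤ (↥ (p / suc q))) (fromℕ (↧ₙ (p / suc q))) (fromℤ g) (fromℤ p) (fromℕ (suc q))
    (fromℚ-↥ (p / suc q))
    (trans (sym (fromℤ-* (↥ (p / suc q)) g)) (reflexive (cong fromℤ (ℚP.↥-/ p (suc q)))))
    (trans (sym (fromℤ-* (↧ (p / suc q)) g)) (reflexive (cong fromℤ (ℚP.↧-/ p (suc q)))))
    where g = ℤG.gcd p (+ suc q)

  bounded-integer : ∀ {B i} → fromℤ i ∥ fromℕ B → ℤ.∣ i ∣ ℕ.≤ B
  bounded-integer {B} {+ n}      (_ , q) = fromℕ-cancel-≤ q
  bounded-integer {B} { -[1+ n ]} (p , _) = fromℕ-cancel-≤ (lin 2 (λ b n → :- b :≤ :- n ∷ [] ⊢ n :≤ b) (fromℕ B) (fromℕ (suc n)) p)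

  abstract

    bounded-rationals : ∀ Qₙ b → ∃[ xs ] (∀ {r} → ↧ₙ r ℕ.≤ Qₙ → fromℚ r ∥ b → r ∈ xs)
    bounded-rationals Qₙ b with archimedean (b * fromℕ Qₙ)
    ... | B , bQ<B = cartesianProductWith (λ i d → i / suc d) (range B) (upTo Qₙ) , λ {r} → member r
      where
      member : ∀ r → ↧ₙ r ℕ.≤ Qₙ → fromℚ r ∥ b → r ∈ cartesianProductWith (λ i d → i / suc d) (range B) (upTo Qₙ)
      member r@(mkℚ n d _) d< bound = ≡.subst (_∈ _) (ℚP.↥p/↧p≡p r)
        (∈-cartesianProductWith⁺ (λ i d → i / suc d) (∈-range n (bounded-integer {B} {n} numerator)) (∈-upTo⁺ d<))
        where
        numerator : fromℤ n ∥ fromℕ B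
        numerator = ∥-resp (fromℚ-↥ r) (∥-mono (≤-trans
          (lin 3 (λ b D Q → c 0 :≤ b ∷ D :≤ Q ∷ [] ⊢ b :* D :≤ b :* Q by # 0 ⊠ # 1 ∷ []) b (fromℕ (suc d)) (fromℕ Qₙ) (∥-≥0 bound) (fromℕ-mono d<))
          (<⇒≤ bQ<B))
          (∥-* bound (lin 1 (λ d → c 0 :< d ∷ [] ⊢ :- d :≤ d) _ (0<fromℕ-suc d) , ≤-refl)))

    magnitude : ∀ x → ∃[ b ] x ∥ b × 0# ≤ b
    magnitude x with ≤-total 0# x
    ... | inj₁ p = x , (lin 1 (λ x → c 0 :≤ x ∷ [] ⊢ :- x :≤ x) x p , ≤-refl) , p
    ... | inj₂ p = - x , (lin 1 (λ x → [] ⊢ :- :- x :≤ x) x , lin 1 (λ x → x :≤ c 0 ∷ [] ⊢ x :≤ :- x) x p)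
                       , lin 1 (λ x → x :≤ c 0 ∷ [] ⊢ c 0 :≤ :- x) x p

  -- `HasCardinality` asks for a list. Denominators are bounded by Q and abscissae by the ends of I;
  -- the bound on ordinates depends on the abscissa, f being an arbitrary function here.
  near-curve-finite : ∀ f Q ψ {I} → IsInterval I → ∃[ n ] N[ f , Q , ψ , I ]≔ n
  near-curve-finite f Q ψ {I} isI with archimedean Q | magnitude (IsInterval.left isI) | magnitude (IsInterval.right isI)
  ... | Qₙ , Q<Qₙ | b , bl , _ | b′ , br , _ = enumerate (NearCurve f Q ψ I) candidates covers
    where
    open IsInterval isI
    xs = bounded-rationals Qₙ (b + b′)

    y-bound : ℚ → ℝ
    y-bound x = proj₁ (magnitude (f ⟨$⟩ fromℚ x)) + proj₁ (magnitude ((ψ ⟨$⟩ Q) ÷ Q))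

    ys : ∀ x → ∃[ ys ] (∀ {r} → ↧ₙ r ℕ.≤ Qₙ → fromℚ r ∥ y-bound x → r ∈ ys)
    ys x = bounded-rationals Qₙ (y-bound x)

    row : ℚ → List (ℚ × ℚ)
    row x = map (x ,_) (proj₁ (ys x))

    candidates : List (ℚ × ℚ)
    candidates = concatMap row (proj₁ xs)

    covers : ∀ {pt} → NearCurve f Q ψ I pt → pt ∈ candidates
    covers {x , y} near = ∈-concatMap⁺ row (Any.map (λ { ≡.refl → ∈-map⁺ (x ,_) y∈ }) x∈)
      where
      open NearCurve near
      open IsDenominator isDenominator
      q≤Qₙ : q ℕ.≤ Qₙ
      q≤Qₙ = fromℕ-cancel-≤ (≤-trans q≤Q (<⇒≤ Q<Qₙ))
      x∈ : x ∈ proj₁ xs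
      x∈ = proj₂ xs (ℕP.≤-trans (denominator-divides {q} {x} {proj₁ (proj₁ clears)} positive (proj₂ (proj₁ clears))) q≤Qₙ)
        ( lin 4 (λ l x b B → l :≤ x ∷ :- b :≤ l ∷ c 0 :≤ B ∷ [] ⊢ :- (b :+ B) :≤ x) left _ b b′ (proj₁ (outer abscissa∈I)) (proj₁ bl) (∥-≥0 br)
        , lin 4 (λ r x b B → x :≤ r ∷ r :≤ B ∷ c 0 :≤ b ∷ [] ⊢ x :≤ b :+ B) right _ b b′ (proj₂ (outer abscissa∈I)) (proj₂ br) (∥-≥0 bl))
      y∈ : y ∈ proj₁ (ys x)
      y∈ = proj₂ (ys x) (ℕP.≤-trans (denominator-divides {q} {y} {proj₁ (proj₂ clears)} positive (proj₂ (proj₂ clears))) q≤Qₙ)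
        ( lin 5 (λ f y w v e → f :- y :< w ∷ w :≤ e ∷ :- v :≤ f ∷ [] ⊢ :- (v :+ e) :≤ y) F Y W V E (proj₁ (∣∣<-elim close)) W≤E (proj₁ F∥V)
        , lin 5 (λ f y w v e → :- w :< f :- y ∷ w :≤ e ∷ f :≤ v ∷ [] ⊢ y :≤ v :+ e) F Y W V E (proj₂ (∣∣<-elim close)) W≤E (proj₂ F∥V))
        where
        F = f ⟨$⟩ fromℚ x
        Y = fromℚ y
        W = (ψ ⟨$⟩ Q) ÷ Q
        V = proj₁ (magnitude F)
        E = proj₁ (magnitude W)
        F∥V : F ∥ V
        F∥V = proj₁ (proj₂ (magnitude F))
        W≤E : W ≤ E
        W≤E = proj₂ (proj₁ (proj₂ (magnitude W)))

  -- The vector (q , p₁ , p₂) of Dirichlet's theorem may have a common factor; the least denominator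
  -- of the point is at most `suc q`, so it still satisfies the bound.
  near-curve-intro : ∀ {f Q ψ I} q p₁ p₂ → fromℕ (suc q) ≤ Q → I (fromℚ (p₁ / suc q)) →
    ∣ (f ⟨$⟩ fromℚ (p₁ / suc q)) - fromℚ (p₂ / suc q) ∣ < (ψ ⟨$⟩ Q) ÷ Q → NearCurve f Q ψ I (p₁ / suc q , p₂ / suc q)
  near-curve-intro {f} {Q} {ψ} {I} q p₁ p₂ q≤Q x∈I close = from-least (least em Clears {suc q} cleared)
    where
    Clears : ℕ → Set
    Clears r = 0 ℕ.< r × r ClearsDenominatorsOf (p₁ / suc q , p₂ / suc q)
    cleared : Clears (suc q)
    cleared = ℕ.s≤s ℕ.z≤n , (p₁ , /-clears q p₁) , (p₂ , /-clears q p₂)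
    from-least : (∃[ r ] Clears r × (∀ {k} → k ℕ.< r → ¬ Clears k)) → NearCurve f Q ψ I (p₁ / suc q , p₂ / suc q)
    from-least (r , (0<r , clears) , minimal) = record
      { q = r
      ; isDenominator = record { positive = 0<r ; clears = clears
          ; least = λ {s} 0<s cl → ℕP.≮⇒≥ (λ s<r → minimal s<r (0<s , cl)) }
      ; q≤Q = ≤-trans (fromℕ-mono (ℕP.≮⇒≥ (λ q<r → minimal {suc q} q<r cleared))) q≤Q
      ; abscissa∈I = x∈I
      ; close = close }

-- Distinct rational points near the curve from good grid points

module RationalPoints (em : ExcludedMiddle 0ℓ) (R : CompleteOrderedField) where

  open Real em R
  open Counting em
  open Quadratic em R
  open PointsAndLines em R
  open Approximations em R
  open Enumeration em R

  -- `g` stands for `f` or its negative, whichever is convex; `flip` and `transfer` carry rational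
  -- points near the graph of `g` back to that of `f`.
  record Setup : Set₁ where
    field
      μ       : ℝ
      1≤μ     : 1# ≤ μ
      Cₙ      : ℕ
      1≤Cₙ    : 1 ℕ.≤ Cₙ
      ζ       : ℝ
      ζ>0     : 0# < ζ
      ζ≤1     : ζ ≤ 1#
      ζ-small : fromℕ 42 * (μ * (μ * μ) * (fromℕ Cₙ * fromℕ Cₙ) * ζ) ≤ 1#
      x₀ ψ K Q : ℝ
      ψ>0     : 0# < ψ
      K>0     : 0# < K
      Q>0     : 0# < Q
      ψKQ≈1   : ψ * (K * Q) ≈ 1#
      K≤1     : K ≤ 1#
      ψ≤1     : ψ ≤ 1#
      μK³≤1   : μ * (K * (K * K)) ≤ 1#
      k       : ℕ
      D       : ℝ → Set
      g g′ f  : Function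
      flip    : ℤ → ℤ

    h : ℝ
    h = fromℕ 4 * (ψ * (K * K))

    x : ℕ → ℝ
    x i = x₀ + fromℕ i * h

    N : ℕ
    N = suc (k ℕ.+ k)

    open Weights μ 1≤μ using (Weight)

    field
      slope    : ∀ {x y} → D x → D y → ∃[ w ] Weight w × (g′ ⟨$⟩ y) - (g′ ⟨$⟩ x) ≈ w * (y - x)
      taylor   : ∀ {x y} → D x → D y →
                 ∃[ w ] Weight w × (g ⟨$⟩ y) - (g ⟨$⟩ x) ≈ (g′ ⟨$⟩ x) * (y - x) + w * ((y - x) * (y - x))
      transfer : ∀ {x q p b} → (g ⟨$⟩ x) - fromℚ (p / suc q) ∥ b → (f ⟨$⟩ x) - fromℚ (flip p / suc q) ∥ b
      near-D   : ∀ {i y} → i ℕ.< N → y - x i ∥ ψ * (K * K) → D y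
      wide     : μ * ψ < fromℕ k * h
      wide²    : μ * ψ < (fromℕ k * h) * (fromℕ k * h)
      Q̂        : ℝ
      Q̂≈       : ζ * ζ * Q̂ ≈ fromℕ 4 * Q

  module Approximating (S : Setup) where

    open Setup S
    open Nondivergence μ 1≤μ Cₙ 1≤Cₙ ζ (<⇒≤ ζ>0) ζ-small x₀ ψ K Q ψ>0 K>0 Q>0 ψKQ≈1 K≤1 ψ≤1 k
      using (h>0; ψK>0; module Curve)

    ψK²≥0 : 0# ≤ ψ * (K * K)
    ψK²≥0 = <⇒≤ (*-pos ψ>0 (*-pos K>0 K>0))

    grid-D : ∀ {i} → i ℕ.< N → D (x i)
    grid-D {i} i<N = near-D i<N (lin 2 (λ x b → c 0 :≤ b ∷ [] ⊢ :- b :≤ x :- x) (x i) _ ψK²≥0 , lin 2 (λ x b → c 0 :≤ b ∷ [] ⊢ x :- x :≤ b) (x i) _ ψK²≥0)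

    open Curve (λ i → g ⟨$⟩ x i) (λ i → g′ ⟨$⟩ x i) (λ i< j< → slope (grid-D i<) (grid-D j<)) (λ i< j< → taylor (grid-D i<) (grid-D j<)) wide wide²

    Bad : ℕ → Set
    Bad i = ∃[ T ] ∃[ u ] Tiny T u i

    record Point (i : ℕ) (pt : ℚ × ℚ) : Set where
      field
        q       : ℕ
        p₁ p₂   : ℤ
        pt≡     : pt ≡ (p₁ / suc q , flip p₂ / suc q)
        q≤Q̂     : fromℕ (suc q) ≤ Q̂
        near-x  : fromℚ (proj₁ pt) - x i ∥ ψ * (K * K)
        near-f  : (f ⟨$⟩ fromℚ (proj₁ pt)) - fromℚ (proj₂ pt) ∥ fromℕ 2 * (ψ * (ψ * K))

    nonzero : ∀ {q p₁ p₂} → ¬ ⟪ + suc q ⨾ p₁ ⨾ p₂ ⟫ ≡ 0³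
    nonzero ()

    -- An approximation at a good x i cannot have small denominator: it
    -- would be a multiple of a tiny primitive vector.
    large-denominator : ∀ {i q p₁ p₂} → ¬ Bad i → (fromℕ (suc q) * x i - fromℤ p₁ ∥ ζ * K) →
      (fromℤ p₂ - fromℕ (suc q) * (g ⟨$⟩ x i) + (g′ ⟨$⟩ x i) * (fromℕ (suc q) * x i - fromℤ p₁) ∥ ζ * ψ) → ζ * Q < fromℕ (suc q)
    large-denominator {i} {q} {p₁} {p₂} good b a = [ (λ p → p) , (λ q≤ → ⊥-elim (good (bad q≤))) ]′ (<-or-≥ (ζ * Q) (fromℕ (suc q)))
      where
      v = ⟪ + suc q ⨾ p₁ ⨾ p₂ ⟫
      bad : fromℕ (suc q) ≤ ζ * Q → Bad i
      bad q≤ = from (primitive-part em v nonzero)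
        where
        tiny : TinyV point v i
        tiny = a , b , (lin 2 (λ q z → c 0 :≤ q ∷ q :≤ z ∷ [] ⊢ :- z :≤ q) (fromℕ (suc q)) (ζ * Q) (0≤fromℕ (suc q)) q≤ , q≤)
        from : (∃[ u ] ∃[ m ] ¬ m ≡ + 0 × v ≡ m • Primitive.vector u) → Bad i
        from (u , m , m≢0 , e) = point , u , divide-tiny point {m} {Primitive.vector u} i m≢0 e tiny

    -- `Q̂` is 4 Q / ζ² for this purpose: by ψ K Q = 1 the product of the sides ζ ψ, ζ K, `Q̂` is
    -- the 4 that `dirichlet` asks for.
    ζψζKQ̂ : fromℕ 4 ≤ ζ * ψ * (ζ * K * Q̂)
    ζψζKQ̂ = ≈⇒≤ (lin 5 (λ z p K Q P → z :* z :* P :≈ c 4 :* Q ∷ p :* (K :* Q) :≈ one ∷ [] ⊢ c 4 :≈ z :* p :* (z :* K :* P)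
       by p :* K ⊡ # 0 ∷ []) ζ ψ K Q Q̂ Q̂≈ ψKQ≈1)

    shrink : ∀ {a} → 0# < a → a ≤ 1# → ζ * a ≤ 1#
    shrink {a} = lin 2 (λ z a → c 0 :< z ∷ z :≤ one ∷ c 0 :< a ∷ a :≤ one ∷ [] ⊢ z :* a :≤ one by # 1 ⊠ # 2 ∷ []) ζ a ζ>0 ζ≤1

    module _ {i q : ℕ} {p₁ p₂ : ℤ} (i<N : i ℕ.< N)
      (b : fromℕ (suc q) * x i - fromℤ p₁ ∥ ζ * K)
      (a : fromℤ p₂ - fromℕ (suc q) * (g ⟨$⟩ x i) + (g′ ⟨$⟩ x i) * (fromℕ (suc q) * x i - fromℤ p₁) ∥ ζ * ψ)
      (large : ζ * Q < fromℕ (suc q)) where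

      r y q# : ℝ
      r  = fromℚ (p₁ / suc q)
      y  = fromℚ (p₂ / suc q)
      q# = fromℕ (suc q)

      rq : r * q# ≈ fromℤ p₁
      rq = fromℚ-/ p₁ q
      yq : y * q# ≈ fromℤ p₂
      yq = fromℚ-/ p₂ q

      ψKK>0 : 0# < ψ * (K * K)
      ψKK>0 = *-pos ψ>0 (*-pos K>0 K>0)

      -- |B| / q < ζ K / (ζ Q) = K / Q = ψ K².
      close-x : r - x i ∥ ψ * (K * K)
      close-x =
          lin 8 (λ r x q P z p K Q → r :* q :≈ P ∷ q :* x :- P :≤ z :* K ∷ z :* Q :< q ∷ p :* (K :* Q) :≈ one ∷ c 0 :< p :* (K :* K) ∷ c 0 :< q ∷ []
            ⊢ :- (p :* (K :* K)) :≤ r :- x by # 5 ⊠ ¬g ∷ # 2 ⊠ # 4 ∷ z :* K ⊡ # 3 ∷ []) r (x i) q# (fromℤ p₁) ζ ψ K Q rq (proj₂ b) large ψKQ≈1 ψKK>0 (0<fromℕ-suc q)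
        , lin 8 (λ r x q P z p K Q → r :* q :≈ P ∷ :- (z :* K) :≤ q :* x :- P ∷ z :* Q :< q ∷ p :* (K :* Q) :≈ one ∷ c 0 :< p :* (K :* K) ∷ c 0 :< q ∷ []
            ⊢ r :- x :≤ p :* (K :* K) by # 5 ⊠ ¬g ∷ # 2 ⊠ # 4 ∷ z :* K ⊡ # 3 ∷ []) r (x i) q# (fromℤ p₁) ζ ψ K Q rq (proj₁ b) large ψKQ≈1 ψKK>0 (0<fromℕ-suc q)

      Dr : D r
      Dr = near-D i<N close-x

      G E : ℝ
      G = (g ⟨$⟩ r) - y
      E = ψ * (ψ * K)

      E>0 : 0# < E
      E>0 = *-pos ψ>0 ψK>0

      -- The point is at vertical distance |A| / q < ζ ψ / (ζ Q) = ψ² K = `E` from the tangent at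
      -- `x i`. From this tangent the curve deviates by at most μ (ψ K²)², which is at most `E`
      -- because μ K³ ≤ 1.
      from-taylor : (∃[ w ] Weights.Weight μ 1≤μ w × (g ⟨$⟩ r) - (g ⟨$⟩ x i) ≈ (g′ ⟨$⟩ x i) * (r - x i) + w * ((r - x i) * (r - x i))) →
                    G ∥ fromℕ 2 * E
      from-taylor (w , W , e) = ∥-resp (lin 2 (λ G v → [] ⊢ (G :- v) :+ v :≈ G) G (w * (d * d)))
          (∥-mono (lin 2 (λ E X → X :≤ E ∷ [] ⊢ E :+ X :≤ c 2 :* E) E _ quadratic) (∥-+ tangent (∥-* (Weights.weight-∥ μ 1≤μ W) (∥-* close-x close-x))))
        where
        d A : ℝ
        d = r - x i
        A = fromℤ p₂ - q# * (g ⟨$⟩ x i) + (g′ ⟨$⟩ x i) * (q# * x i - fromℤ p₁)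
        quadratic : μ * (ψ * (K * K) * (ψ * (K * K))) ≤ E
        quadratic = lin 3 (λ μ p K → μ :* (K :* (K :* K)) :≤ one ∷ c 0 :< p :* (p :* K) ∷ [] ⊢ μ :* (p :* (K :* K) :* (p :* (K :* K))) :≤ p :* (p :* K)
                      by # 0 ⊠ # 1 ∷ []) μ ψ K μK³≤1 E>0
        A≈ : q# * (G - w * (d * d)) ≈ - A
        A≈ = lin 10 (λ q gr gx g′ y x r w P S → gr :- gx :≈ g′ :* (r :- x) :+ w :* ((r :- x) :* (r :- x)) ∷ r :* q :≈ P ∷ y :* q :≈ S ∷ []
               ⊢ q :* (gr :- y :- w :* ((r :- x) :* (r :- x))) :≈ :- (S :- q :* gx :+ g′ :* (q :* x :- P))
               by q ⊡ # 0 ∷ g′ ⊡ # 1 ∷ []) q# (g ⟨$⟩ r) (g ⟨$⟩ x i) (g′ ⟨$⟩ x i) y (x i) r w (fromℤ p₁) (fromℤ p₂) e rq yq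
        tangent : G - w * (d * d) ∥ E
        tangent =
            lin 7 (λ q t A z p K Q → q :* t :≈ :- A ∷ A :≤ z :* p ∷ z :* Q :< q ∷ p :* (K :* Q) :≈ one ∷ c 0 :< p :* (p :* K) ∷ c 0 :< q ∷ []
              ⊢ :- (p :* (p :* K)) :≤ t by # 5 ⊠ ¬g ∷ # 2 ⊠ # 4 ∷ z :* p ⊡ # 3 ∷ []) q# (G - w * (d * d)) A ζ ψ K Q A≈ (proj₂ a) large ψKQ≈1 E>0 (0<fromℕ-suc q)
          , lin 7 (λ q t A z p K Q → q :* t :≈ :- A ∷ :- (z :* p) :≤ A ∷ z :* Q :< q ∷ p :* (K :* Q) :≈ one ∷ c 0 :< p :* (p :* K) ∷ c 0 :< q ∷ []
              ⊢ t :≤ p :* (p :* K) by # 5 ⊠ ¬g ∷ # 2 ⊠ # 4 ∷ z :* p ⊡ # 3 ∷ []) q# (G - w * (d * d)) A ζ ψ K Q A≈ (proj₁ a) large ψKQ≈1 E>0 (0<fromℕ-suc q)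

      close-g : G ∥ fromℕ 2 * E
      close-g = from-taylor (taylor (grid-D i<N) Dr)

    from-approximation : ∀ {i} → i ℕ.< N → ¬ Bad i →
      Approximation (x i) (g ⟨$⟩ x i) (g′ ⟨$⟩ x i) (ζ * ψ) (ζ * K) Q̂ → ∃ (Point i)
    from-approximation {i} i<N good record { q = suc q ; p₁ = p₁ ; p₂ = p₂ ; q≤Q = q≤Q ; near-x = b ; near-tangent = a } =
      (p₁ / suc q , flip p₂ / suc q) , record
        { q = q ; p₁ = p₁ ; p₂ = p₂ ; pt≡ = ≡.refl ; q≤Q̂ = q≤Q
        ; near-x = close-x {i} {q} {p₁} {p₂} i<N b a large
        ; near-f = transfer {fromℚ (p₁ / suc q)} {q} {p₂} (close-g {i} {q} {p₁} {p₂} i<N b a large) }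
      where
      large : ζ * Q < fromℕ (suc q)
      large = large-denominator {i} {q} {p₁} {p₂} good b a

    good-point : ∀ {i} → i ℕ.< N → ¬ Bad i → ∃ (Point i)
    good-point {i} i<N good = from-approximation i<N good
      (dirichlet (x i) (g ⟨$⟩ x i) (g′ ⟨$⟩ x i) (ζ * ψ) (ζ * K) Q̂ (*-pos ζ>0 ψ>0) (shrink ψ>0 ψ≤1) (*-pos ζ>0 K>0) (shrink K>0 K≤1) ζψζKQ̂)

    -- The grid step h is four times the distance of a point to its x i.
    far-apart : ∀ {i j pt} → i ℕ.< j → ¬ (Point i pt × Point j pt)
    far-apart {i} {j} {pt} i<j (P , P′) = ≤⇒≯ (proj₁ (Point.near-x P′))
      (lin 6 (λ x₀ i j h e r → i :+ one :≤ j ∷ r :- (x₀ :+ i :* h) :≤ e ∷ h :≈ c 4 :* e ∷ c 0 :< h ∷ [] ⊢ r :- (x₀ :+ j :* h) :< :- e by # 0 ⊠ # 3 ∷ [])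
        x₀ (fromℕ i) (fromℕ j) h (ψ * (K * K)) (fromℚ (proj₁ pt)) (fromℕ-mono-< i<j) (proj₂ (Point.near-x P)) refl h>0)

    distinct : ∀ {i j pt} → Point i pt → Point j pt → i ≡ j
    distinct {i} {j} P P′ with ℕP.<-cmp i j
    ... | tri< p _ _ = ⊥-elim (far-apart p (P , P′))
    ... | tri≈ _ e _ = e
    ... | tri> _ _ p = ⊥-elim (far-apart p (P′ , P))

    few-bad-points : Cₙ ℕ.* count Bad 0 N ℕ.≤ 12 ℕ.* (N ℕ.+ N)
    few-bad-points = few-tiny

    many-points : ∃[ pts ] length pts ≡ count (λ i → ¬ Bad i) 0 N × Unique pts × (∀ {pt} → pt ∈ pts → ∃[ i ] i ∈[ 0 ,+ N ⟩ × Point i pt)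
    many-points = choose (λ i → ¬ Bad i) Point 0 N (λ i∈ good → good-point (proj₂ i∈) good) (λ _ _ → distinct)

-- The lower bound

module CountBound (em : ExcludedMiddle 0ℓ) (R : CompleteOrderedField) where

  open Real em R
  open Counting em
  open Quadratic em R
  open Enumeration em R
  open RationalPoints em R
  open Calculus em R

  -- For H ≤ L this is met by k = ⌊2 L / H⌋: a grid with k steps of length H on each side of its
  -- midpoint has half-width between L and 2 L.
  Steps : ℝ → ℝ → Set
  Steps H L = ∃[ k ] fromℕ k * H ≤ L + L × L < fromℕ k * H × L + L < (fromℕ k + 1#) * H

  division-steps : ∀ {H L} → 0# < H → H ≤ L → Steps H L
  division-steps {H} {L} H>0 H≤L = from (floorℕ y (<⇒≤ (*-pos (lin 2 (λ H L → c 0 :< H ∷ H :≤ L ∷ [] ⊢ c 0 :< L :+ L) H L H>0 H≤L) (⁻¹-pos H>0))))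
    where
    y : ℝ
    y = (L + L) ÷ H
    yH : y * H ≈ L + L
    yH = ÷-* (L + L) H>0
    from : (∃[ k ] fromℕ k ≤ y × y < fromℕ k + 1#) → Steps H L
    from (k , p , q) = k
      , lin 4 (λ k y H l → k :≤ y ∷ y :* H :≈ l :+ l ∷ c 0 :< H ∷ [] ⊢ k :* H :≤ l :+ l by # 0 ⊠ # 2 ∷ []) (fromℕ k) y H L p yH H>0
      , lin 4 (λ k y H l → y :< k :+ one ∷ y :* H :≈ l :+ l ∷ c 0 :< H ∷ H :≤ l ∷ [] ⊢ l :< k :* H by # 0 ⊠ # 2 ∷ []) (fromℕ k) y H L q yH H>0 H≤L
      , lin 4 (λ k y H l → y :< k :+ one ∷ y :* H :≈ l :+ l ∷ c 0 :< H ∷ [] ⊢ l :+ l :< (k :+ one) :* H by # 0 ⊠ # 2 ∷ []) (fromℕ k) y H L q yH H>0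

  -- The reciprocals u = 1/8, w = 1/4, κ = 1/μ and θ = 1/ζ⁴ enter through their defining equations,
  -- which polynomial certificates can use.
  record Hypotheses : Set₁ where
    field
      μ       : ℝ
      1≤μ     : 1# ≤ μ
      ζ       : ℝ
      ζ>0     : 0# < ζ
      ζ≤1     : ζ ≤ 1#
      ζ-small : fromℕ 42 * (μ * (μ * μ) * (fromℕ 48 * fromℕ 48) * ζ) ≤ 1#
      D       : ℝ → Set
      g g′ f  : Function
      flip    : ℤ → ℤ

    open Weights μ 1≤μ using (Weight)

    field
      slope      : ∀ {x y} → D x → D y → ∃[ w ] Weight w × (g′ ⟨$⟩ y) - (g′ ⟨$⟩ x) ≈ w * (y - x)
      taylor     : ∀ {x y} → D x → D y →
                   ∃[ w ] Weight w × (g ⟨$⟩ y) - (g ⟨$⟩ x) ≈ (g′ ⟨$⟩ x) * (y - x) + w * ((y - x) * (y - x))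
      transfer   : ∀ {x q p b} → (g ⟨$⟩ x) - fromℚ (p / suc q) ∥ b → (f ⟨$⟩ x) - fromℚ (flip p / suc q) ∥ b
      I          : Pred ℝ 0ℓ
      isInterval : IsInterval I
      I⊆D        : ∀ {x} → I x → D x

    open IsInterval isInterval public using (left; right; inner; len)

    field
      len>0   : 0# < len
      u w     : ℝ
      8u≈1    : fromℕ 8 * u ≈ 1#
      4w≈1    : fromℕ 4 * w ≈ 1#
      ε       : ℝ
      ε>0     : 0# < ε
      ε≤1     : ε ≤ 1#
      4με≤λ   : fromℕ 4 * (μ * ε) ≤ len * u
      4με≤λλ  : fromℕ 4 * (μ * ε) ≤ (len * u) * (len * u)
      κ       : ℝ
      μκ≈1    : μ * κ ≈ 1#
      θ       : ℝ
      θζ⁴≈1   : θ * (ζ * ζ * (ζ * ζ)) ≈ 1#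

  module LowerBound (hypotheses : Hypotheses) where

    open Hypotheses hypotheses

    ƛ : ℝ
    ƛ = len * u

    -- At least ƛ / h grid points will be good. As h = 4 ψ₁ K₁² and ψ₁ K₁ Q₁ = 1, this number is ƛ w
    -- ψ₁ Q₁²; the constant is its quotient by Q̂² Ψ len.
    constant : ℝ
    constant = w * u * (ζ * ζ * (ζ * ζ) * (ζ * ζ)) * (w * w * (w * w))

    module _ (Q̂ Ψ z : ℝ) (Q̂>0 : 0# < Q̂) (Ψ>0 : 0# < Ψ) (z≈ : z * (Q̂ * Ψ) ≈ 1#) (z>0 : 0# < z)
             (Ψ≤ε : Ψ ≤ ε) (64zθ≤κ : fromℕ 64 * (z * θ) ≤ κ) where

      -- The box of Dirichlet's theorem is |A| ≤ ζψ₁, |B| ≤ ζK₁, q ≤ Q̂, where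
      -- ψ₁ K₁ Q₁ = 1; at a good grid point, q > ζQ₁ = ζ³Q̂/4.
      ψ₁ Q₁ K₁ : ℝ
      ψ₁ = ζ * ζ * Ψ * (w * w)
      Q₁ = ζ * ζ * Q̂ * w
      K₁ = fromℕ 64 * (z * θ)

      abstract

        w>0 : 0# < w
        w>0 = lin 1 (λ w → c 4 :* w :≈ one ∷ [] ⊢ c 0 :< w) w 4w≈1

        u>0 : 0# < u
        u>0 = lin 1 (λ w → c 8 :* w :≈ one ∷ [] ⊢ c 0 :< w) u 8u≈1

        64w³≈1 : fromℕ 64 * (w * w * w) ≈ 1#
        64w³≈1 = lin 1 (λ w → c 4 :* w :≈ one ∷ [] ⊢ c 64 :* (w :* w :* w) :≈ one by c 16 :* w :* w ⊡ # 0 ∷ c 4 :* w ⊡ # 0 ∷ # 0 ∷ []) w 4w≈1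

        ζζ>0 : 0# < ζ * ζ
        ζζ>0 = *-pos ζ>0 ζ>0

        θ>0 : 0# < θ
        θ>0 = lin 2 (λ t y → t :* y :≈ one ∷ c 0 :< y ∷ [] ⊢ c 0 :< t by ¬g ⊠ # 1 ∷ []) θ (ζ * ζ * (ζ * ζ)) θζ⁴≈1 (*-pos ζζ>0 ζζ>0)

        ψ₁>0 : 0# < ψ₁
        ψ₁>0 = *-pos (*-pos ζζ>0 Ψ>0) (*-pos w>0 w>0)

        Q₁>0 : 0# < Q₁
        Q₁>0 = *-pos (*-pos ζζ>0 Q̂>0) w>0

        K₁>0 : 0# < K₁
        K₁>0 = lin 1 (λ y → c 0 :< y ∷ [] ⊢ c 0 :< c 64 :* y) (z * θ) (*-pos z>0 θ>0)

        ψKQ≈1 : ψ₁ * (K₁ * Q₁) ≈ 1#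
        ψKQ≈1 = lin 6 (λ ζ Ψ w Q z θ → c 64 :* (w :* w :* w) :≈ one ∷ z :* (Q :* Ψ) :≈ one ∷ θ :* (ζ :* ζ :* (ζ :* ζ)) :≈ one ∷ []
          ⊢ ζ :* ζ :* Ψ :* (w :* w) :* (c 64 :* (z :* θ) :* (ζ :* ζ :* Q :* w)) :≈ one
          by ζ :* ζ :* ζ :* ζ :* θ :* z :* Ψ :* Q ⊡ # 0 ∷ z :* Ψ :* Q ⊡ # 2 ∷ []) ζ Ψ w Q̂ z θ 64w³≈1 z≈ θζ⁴≈1

        -- Here the decay of 1 / (t ψ(t)) enters: `K₁` is 64 θ times z = 1 / (Q̂ Ψ), with 64 = 1 /
        -- w³.
        μK≤1 : μ * K₁ ≤ 1#
        μK≤1 = lin 3 (λ μ K k → K :≤ k ∷ μ :* k :≈ one ∷ one :≤ μ ∷ [] ⊢ μ :* K :≤ one by # 0 ⊠ # 2 ∷ []) μ K₁ κ 64zθ≤κ μκ≈1 1≤μ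

        K≤1 : K₁ ≤ 1#
        K≤1 = lin 2 (λ μ K → μ :* K :≤ one ∷ one :≤ μ ∷ c 0 :< K ∷ [] ⊢ K :≤ one by # 1 ⊠ # 2 ∷ []) μ K₁ μK≤1 1≤μ K₁>0

        μK³≤1 : μ * (K₁ * (K₁ * K₁)) ≤ 1#
        μK³≤1 = lin 2 (λ μ K → μ :* K :≤ one ∷ K :≤ one ∷ c 0 :< K ∷ [] ⊢ μ :* (K :* (K :* K)) :≤ one
                  by # 0 ⊠ sq K ∷ # 1 ⊠ # 2 ∷ []) μ K₁ μK≤1 K≤1 K₁>0

        ψ₁≤ε : ψ₁ ≤ ε
        ψ₁≤ε = lin 4 (λ ζ Ψ w e → ζ :≤ one ∷ c 0 :< ζ ∷ c 4 :* w :≈ one ∷ c 0 :< Ψ ∷ Ψ :≤ e ∷ []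
          ⊢ ζ :* ζ :* Ψ :* (w :* w) :≤ e by ζ :* ζ :* Ψ :* w ⊡ # 2 ∷ ζ :* ζ :* Ψ ⊡ # 2 ∷ # 0 ⊠ # 1 ⊠ # 3 ∷ # 0 ⊠ # 3 ∷ []) ζ Ψ w ε ζ≤1 ζ>0 4w≈1 Ψ>0 Ψ≤ε

        ψ₁≤1 : ψ₁ ≤ 1#
        ψ₁≤1 = ≤-trans ψ₁≤ε ε≤1

        μψ₁≤με : μ * ψ₁ ≤ μ * ε
        μψ₁≤με = lin 3 (λ μ p e → p :≤ e ∷ one :≤ μ ∷ [] ⊢ μ :* p :≤ μ :* e by # 0 ⊠ # 1 ∷ []) μ ψ₁ ε ψ₁≤ε 1≤μ

        ƛ>0 : 0# < ƛ
        ƛ>0 = *-pos len>0 u>0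

        4ψ₁≤ƛ : fromℕ 4 * ψ₁ ≤ ƛ
        4ψ₁≤ƛ = lin 4 (λ μ p e l → μ :* p :≤ μ :* e ∷ c 4 :* (μ :* e) :≤ l ∷ one :≤ μ ∷ c 0 :< p ∷ [] ⊢ c 4 :* p :≤ l by # 2 ⊠ # 3 ∷ []) μ ψ₁ ε ƛ μψ₁≤με 4με≤λ 1≤μ ψ₁>0

        step>0 : 0# < fromℕ 4 * (ψ₁ * (K₁ * K₁))
        step>0 = lin 1 (λ y → c 0 :< y ∷ [] ⊢ c 0 :< c 4 :* y) (ψ₁ * (K₁ * K₁)) (*-pos ψ₁>0 (*-pos K₁>0 K₁>0))

        step≤ƛ : fromℕ 4 * (ψ₁ * (K₁ * K₁)) ≤ ƛ
        step≤ƛ = lin 3 (λ p K l → c 4 :* p :≤ l ∷ K :≤ one ∷ c 0 :< K ∷ c 0 :< p ∷ [] ⊢ c 4 :* (p :* (K :* K)) :≤ l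
                   by # 1 ⊠ # 2 ⊠ # 3 ∷ # 1 ⊠ # 3 ∷ []) ψ₁ K₁ ƛ 4ψ₁≤ƛ K≤1 K₁>0 ψ₁>0

        steps : Steps (fromℕ 4 * (ψ₁ * (K₁ * K₁))) ƛ
        steps = division-steps step>0 step≤ƛ

      k : ℕ
      k = proj₁ steps

      x₀ h : ℝ
      -- The grid has length 2 k h ≤ 4 ƛ inside an interval of length 8 ƛ, so a margin of at least 2
      -- ƛ is left at both ends.
      x₀ = left + (ƛ + ƛ)
      h = fromℕ 4 * (ψ₁ * (K₁ * K₁))

      N : ℕ
      N = suc (k ℕ.+ k)

      abstract

        near-I : ∀ {i y} → i ℕ.< N → y - (x₀ + fromℕ i * h) ∥ ψ₁ * (K₁ * K₁) → I y
        near-I {i} {y} i<N (p , q) = inner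
          ( lin 6 (λ l λ′ i h y e → c 0 :≤ i :* h ∷ :- e :≤ y :- (l :+ (λ′ :+ λ′) :+ i :* h) ∷ c 4 :* e :≤ λ′ ∷ c 0 :< λ′ ∷ [] ⊢ l :< y)
              left ƛ (fromℕ i) h y (ψ₁ * (K₁ * K₁))
              (lin 2 (λ i h → c 0 :≤ i ∷ c 0 :< h ∷ [] ⊢ c 0 :≤ i :* h by # 0 ⊠ # 1 ∷ []) (fromℕ i) h (0≤fromℕ i) step>0) p step≤ƛ ƛ>0
          , lin 10 (λ l r u λ′ i h y e k K → i :≤ K ∷ K :≈ k :+ k ∷ k :* h :≤ λ′ :+ λ′ ∷ y :- (l :+ (λ′ :+ λ′) :+ i :* h) :≤ e ∷ c 4 :* e :≤ λ′ ∷ c 0 :< λ′ ∷ c 0 :< h ∷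
                      λ′ :≈ (r :- l) :* u ∷ c 8 :* u :≈ one ∷ [] ⊢ y :< r by # 0 ⊠ # 6 ∷ h ⊡ # 1 ∷ r :- l ⊡ # 8 ∷ [])
              left right u ƛ (fromℕ i) h y (ψ₁ * (K₁ * K₁)) (fromℕ k) (fromℕ (k ℕ.+ k))
              (fromℕ-mono (ℕP.≤-pred i<N)) (fromℕ-+ k k) (proj₁ (proj₂ steps)) q step≤ƛ ƛ>0 step>0 refl 8u≈1 )

        ƛ<kh : ƛ < fromℕ k * h
        ƛ<kh = proj₁ (proj₂ (proj₂ steps))

        wide : μ * ψ₁ < fromℕ k * h
        wide = lin 4 (λ a b l L → a :≤ b ∷ c 4 :* b :≤ l ∷ l :< L ∷ c 0 :< l ∷ [] ⊢ a :< L) (μ * ψ₁) (μ * ε) ƛ (fromℕ k * h) μψ₁≤με 4με≤λ ƛ<kh ƛ>0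

        wide² : μ * ψ₁ < (fromℕ k * h) * (fromℕ k * h)
        wide² = lin 4 (λ a b l L → a :≤ b ∷ c 4 :* b :≤ l :* l ∷ l :< L ∷ c 0 :< l ∷ [] ⊢ a :< L :* L by # 2 ⊠ # 3 ∷ # 2 ⊠ # 2 ∷ sq l ∷ # 3 ⊠ # 3 ∷ [])
                  (μ * ψ₁) (μ * ε) ƛ (fromℕ k * h) μψ₁≤με 4με≤λλ ƛ<kh ƛ>0

        Q̂≈ : ζ * ζ * Q̂ ≈ fromℕ 4 * Q₁
        Q̂≈ = lin 3 (λ z Q w → c 4 :* w :≈ one ∷ [] ⊢ z :* z :* Q :≈ c 4 :* (z :* z :* Q :* w) by z :* z :* Q ⊡ # 0 ∷ []) ζ Q̂ w 4w≈1

      setup : Setup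
      setup = record
        { μ = μ ; 1≤μ = 1≤μ ; Cₙ = 48 ; 1≤Cₙ = ℕ.s≤s ℕ.z≤n ; ζ = ζ ; ζ>0 = ζ>0 ; ζ≤1 = ζ≤1 ; ζ-small = ζ-small
        ; x₀ = x₀ ; ψ = ψ₁ ; K = K₁ ; Q = Q₁ ; ψ>0 = ψ₁>0 ; K>0 = K₁>0 ; Q>0 = Q₁>0 ; ψKQ≈1 = ψKQ≈1
        ; K≤1 = K≤1 ; ψ≤1 = ψ₁≤1 ; μK³≤1 = μK³≤1 ; k = k ; D = D ; g = g ; g′ = g′ ; f = f ; flip = flip
        ; slope = slope ; taylor = taylor ; transfer = λ {x} {q} {p} → transfer {x} {q} {p}
        ; near-D = λ i<N p → I⊆D (near-I i<N p) ; wide = wide ; wide² = wide² ; Q̂ = Q̂ ; Q̂≈ = Q̂≈ }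

      module A = Approximating setup

      good : ℕ
      good = count (λ i → ¬ A.Bad i) 0 N

      abstract

        -- The number 48 = 2 · 24 is chosen so that at most half of the grid is bad.
        N≤2good : N ℕ.≤ 2 ℕ.* good
        N≤2good = linℕ 3 (λ N b g → c 48 :* b :≤ c 12 :* (N :+ N) ∷ N :≤ b :+ g ∷ [] ⊢ N :≤ c 2 :* g)
          N (count A.Bad 0 N) good (A.few-bad-points) (count-¬ A.Bad 0 N)

        ƛ≤good·h : ƛ ≤ fromℕ good * h
        ƛ≤good·h = lin 6 (λ l k K n n₂ h → l :+ l :< (k :+ one) :* h ∷ l :< k :* h ∷ K :≈ k :+ k ∷ one :+ K :≤ n₂ ∷ n₂ :≈ (one :+ (one :+ c 0)) :* n ∷ c 0 :< h ∷ []
            ⊢ l :≤ n :* h by # 3 ⊠ # 5 ∷ h ⊡ # 2 ∷ h ⊡ # 4 ∷ [])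
          ƛ (fromℕ k) (fromℕ (k ℕ.+ k)) (fromℕ good) (fromℕ (2 ℕ.* good)) h
          (proj₂ (proj₂ (proj₂ steps))) ƛ<kh (fromℕ-+ k k) (fromℕ-mono N≤2good) (fromℕ-* 2 good) step>0

        count-bound : constant * (Q̂ * Q̂) * Ψ * len ≤ fromℕ good
        count-bound = lin 8 (λ len u ζ Ψ Q w K n →
              len :* u :≤ n :* (c 4 :* (ζ :* ζ :* Ψ :* (w :* w) :* (K :* K))) ∷
              ζ :* ζ :* Ψ :* (w :* w) :* (K :* (ζ :* ζ :* Q :* w)) :≈ one ∷ c 4 :* w :≈ one ∷
              c 0 :< w :* (ζ :* ζ :* Ψ :* (w :* w) :* (ζ :* ζ :* Q :* w :* (ζ :* ζ :* Q :* w))) ∷ []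
            ⊢ w :* u :* (ζ :* ζ :* (ζ :* ζ) :* (ζ :* ζ)) :* (w :* w :* (w :* w)) :* (Q :* Q) :* Ψ :* len :≤ n
            by # 0 ⊠ # 3 ∷ n :* c 4 :* w :* (ζ :* ζ :* Ψ :* (w :* w) :* (K :* (ζ :* ζ :* Q :* w))) ⊡ # 1 ∷ n :* c 4 :* w ⊡ # 1 ∷ n ⊡ # 2 ∷ [])
          len u ζ Ψ Q̂ w K₁ (fromℕ good) ƛ≤good·h ψKQ≈1 4w≈1 (*-pos w>0 (*-pos ψ₁>0 (*-pos Q₁>0 Q₁>0)))

        -- By ψ₁ K₁ Q₁ = 1 the left side is 2 ψ₁ / Q₁ = 2 w Ψ / Q̂ = Ψ / (2 Q̂). For this `ψ₁` has
        -- one factor w more than `Q₁`.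
        2E<Ψ÷Q̂ : fromℕ 2 * (ψ₁ * (ψ₁ * K₁)) < Ψ ÷ Q̂
        2E<Ψ÷Q̂ = lin 6 (λ ζ Ψ Q w K X → X :* Q :≈ Ψ ∷ ζ :* ζ :* Ψ :* (w :* w) :* (K :* (ζ :* ζ :* Q :* w)) :≈ one ∷ c 4 :* w :≈ one ∷ c 0 :< Q ∷ c 0 :< Ψ ∷ []
            ⊢ c 2 :* (ζ :* ζ :* Ψ :* (w :* w) :* (ζ :* ζ :* Ψ :* (w :* w) :* K)) :< X
            by ¬g ⊠ # 3 ∷ c 2 :* w :* Ψ ⊡ # 1 ∷ Ψ ⊡ # 2 ∷ []) ζ Ψ Q̂ w K₁ (Ψ ÷ Q̂) (÷-* Ψ Q̂>0) ψKQ≈1 4w≈1 Q̂>0 Ψ>0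

      near : ∀ {ψ} → ψ ⟨$⟩ Q̂ ≡ Ψ → ∀ {pt} → (∃[ i ] i ∈[ 0 ,+ N ⟩ × A.Point i pt) → NearCurve f Q̂ ψ I pt
      near {ψ} eqΨ {pt} (i , (_ , i<N) , P) = from (A.Point.q P) (A.Point.p₁ P) (flip (A.Point.p₂ P)) (A.Point.pt≡ P) (A.Point.q≤Q̂ P) (A.Point.near-x P) (A.Point.near-f P)
        where
        from : ∀ {pt} q p₁ p₂ → pt ≡ (p₁ / suc q , p₂ / suc q) → fromℕ (suc q) ≤ Q̂ →
               fromℚ (proj₁ pt) - (x₀ + fromℕ i * h) ∥ ψ₁ * (K₁ * K₁) →
               (f ⟨$⟩ fromℚ (proj₁ pt)) - fromℚ (proj₂ pt) ∥ fromℕ 2 * (ψ₁ * (ψ₁ * K₁)) → NearCurve f Q̂ ψ I pt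
        from q p₁ p₂ ≡.refl q≤ nx nf = near-curve-intro {f} {Q̂} {ψ} {I} q p₁ p₂ q≤ (near-I i<N nx)
          (≡.subst (λ X → ∣ (f ⟨$⟩ fromℚ (p₁ / suc q)) - fromℚ (p₂ / suc q) ∣ < X ÷ Q̂) (≡.sym eqΨ) (∣∣<-intro
            (lin 3 (λ y e X → y :≤ e ∷ e :< X ∷ [] ⊢ y :< X) _ _ _ (proj₂ nf) 2E<Ψ÷Q̂)
            (lin 3 (λ y e X → :- e :≤ y ∷ e :< X ∷ [] ⊢ :- X :< y) _ _ _ (proj₁ nf) 2E<Ψ÷Q̂)))

      result : ∀ ψ → ψ ⟨$⟩ Q̂ ≡ Ψ → ∃[ n ] (N[ f , Q̂ , ψ , I ]≔ n) × constant * (Q̂ * Q̂) * Ψ * len ≤ fromℕ n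
      result ψ eqΨ = from (near-curve-finite f Q̂ ψ isInterval) A.many-points
        where
        from : (∃[ n ] (N[ f , Q̂ , ψ , I ]≔ n)) →
               (∃[ pts ] length pts ≡ good × Unique pts × (∀ {pt} → pt ∈ pts → ∃[ i ] i ∈[ 0 ,+ N ⟩ × A.Point i pt)) →
               ∃[ n ] (N[ f , Q̂ , ψ , I ]≔ n) × constant * (Q̂ * Q̂) * Ψ * len ≤ fromℕ n
        from (n , card) (pts , len≡ , unique , points-of) = n , card ,
          ≤-trans count-bound (fromℕ-mono (≡.subst (ℕ._≤ n) len≡ (cardinality-≥ card unique (λ pt∈ → near {ψ} eqΨ (points-of pt∈)))))

-- Choice of the constants, the sign of f″, and the theorem

module Main (em : ExcludedMiddle 0ℓ) (R : CompleteOrderedField) where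

  open Real em R
  open Quadratic em R
  open Calculus em R
  open Enumeration em R
  open CountBound em R

  Conclusion : Function → (I : Pred ℝ 0ℓ) → IsInterval I → Function → Set
  Conclusion f I isInterval ψ =
    ∃[ c ] 0# < c × (∃[ Q₀ ] 0# < Q₀ × ((Q : ℝ) → Q₀ < Q →
      ∃[ n ] (N[ f , Q , ψ , I ]≔ n) × c * (Q * Q) * (ψ ⟨$⟩ Q) * IsInterval.len isInterval ≤ fromℕ n))

  -- The lower bound is 0, so any constant serves once the count is known to be finite.
  degenerate : ∀ f {I} (isInterval : IsInterval I) ψ → IsInterval.len isInterval ≈ 0# → Conclusion f I isInterval ψ
  degenerate f {I} isInterval ψ len≈0 = 1# , 0<1 , 1# , 0<1 , λ Q _ → from Q (near-curve-finite f Q ψ isInterval)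
    where
    from : ∀ Q → (∃[ n ] (N[ f , Q , ψ , I ]≔ n)) → _
    from Q (n , card) = n , card , lin 3 (λ a l n → l :≈ c 0 ∷ c 0 :≤ n ∷ [] ⊢ a :* l :≤ n by a ⊡ # 0 ∷ [])
      (1# * (Q * Q) * (ψ ⟨$⟩ Q)) (IsInterval.len isInterval) (fromℕ n) len≈0 (0≤fromℕ n)

  module Constants (μ : ℝ) (1≤μ : 1# ≤ μ) where

    G : ℝ
    G = μ * (μ * μ) * (fromℕ 48 * fromℕ 48)

    abstract

      1≤G : 1# ≤ G
      1≤G = lin 3 (λ μ o C → one :≤ μ ∷ o :≤ C ∷ o :≈ one ∷ [] ⊢ one :≤ μ :* (μ :* μ) :* (C :* C)
              by # 0 ⊠ # 0 ∷ # 0 ⊠ # 0 ⊠ # 0 ∷ # 1 ⊠ # 1 ∷ o ⊡ # 2 ∷ C ⊡ # 2 ∷ (# 0 ⊠ # 0 ⊠ # 0) ⊠ sq C ∷ (# 0 ⊠ # 0) ⊠ sq C ∷ # 0 ⊠ sq C ∷ [])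
              μ (fromℕ 1) (fromℕ 48) 1≤μ (fromℕ-mono {1} {48} (ℕ.s≤s ℕ.z≤n)) (lin 0 ([] ⊢ one :+ c 0 :≈ one))

    ζ : ℝ
    ζ = (fromℕ 42 * G) ⁻¹

    abstract

      42G>0 : 0# < fromℕ 42 * G
      42G>0 = lin 1 (λ G → one :≤ G ∷ [] ⊢ c 0 :< c 42 :* G) G 1≤G

      ζ>0 : 0# < ζ
      ζ>0 = ⁻¹-pos 42G>0

      ζ-small : fromℕ 42 * (G * ζ) ≤ 1#
      ζ-small = ≈⇒≤ (lin 2 (λ G z → c 42 :* G :* z :≈ one ∷ [] ⊢ c 42 :* (G :* z) :≈ one) G ζ (⁻¹-inverse 42G>0))

      ζ≤1 : ζ ≤ 1#
      ζ≤1 = lin 2 (λ G z → c 42 :* (G :* z) :≤ one ∷ one :≤ G ∷ c 0 :< z ∷ [] ⊢ z :≤ one by # 1 ⊠ # 2 ∷ []) G ζ ζ-small 1≤G ζ>0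

  module Convexity
    (μ : ℝ) (1≤μ : 1# ≤ μ) (D : ℝ → Set) (g g′ : Function)
    (slope  : ∀ {x y} → D x → D y → ∃[ w ] Weights.Weight μ 1≤μ w × (g′ ⟨$⟩ y) - (g′ ⟨$⟩ x) ≈ w * (y - x))
    (taylor : ∀ {x y} → D x → D y → ∃[ w ] Weights.Weight μ 1≤μ w × (g ⟨$⟩ y) - (g ⟨$⟩ x) ≈ (g′ ⟨$⟩ x) * (y - x) + w * ((y - x) * (y - x)))
    (f : Function) (flip : ℤ → ℤ)
    (transfer : ∀ {x q p b} → (g ⟨$⟩ x) - fromℚ (p / suc q) ∥ b → (f ⟨$⟩ x) - fromℚ (flip p / suc q) ∥ b)
    (I : Pred ℝ 0ℓ) (isInterval : IsInterval I) (I⊆D : ∀ {x} → I x → D x) (len>0 : 0# < IsInterval.len isInterval)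
    (ψ : Function) (approximating : IsApproximatingFunction ψ)
    (ψ→0 : TendsToAt+∞ (λ t → ψ ⟨$⟩ t) 0#)
    (1/tψ→0 : TendsToAt+∞ (λ t → 1# ÷ (t * (ψ ⟨$⟩ t))) 0#) where

    open Constants μ 1≤μ
    open IsInterval isInterval using (len)

    u w κ θ ƛ : ℝ
    u = fromℕ 8 ⁻¹
    w = fromℕ 4 ⁻¹
    κ = μ ⁻¹
    θ = (ζ * ζ * (ζ * ζ)) ⁻¹
    ƛ = len * u

    abstract

      8u≈1 : fromℕ 8 * u ≈ 1#
      8u≈1 = ⁻¹-inverse (lin 0 ([] ⊢ c 0 :< c 8))

      4w≈1 : fromℕ 4 * w ≈ 1#
      4w≈1 = ⁻¹-inverse (lin 0 ([] ⊢ c 0 :< c 4))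

      u>0 : 0# < u
      u>0 = ⁻¹-pos (lin 0 ([] ⊢ c 0 :< c 8))

      w>0 : 0# < w
      w>0 = ⁻¹-pos (lin 0 ([] ⊢ c 0 :< c 4))

      μ>0 : 0# < μ
      μ>0 = lin 1 (λ μ → one :≤ μ ∷ [] ⊢ c 0 :< μ) μ 1≤μ

      μκ≈1 : μ * κ ≈ 1#
      μκ≈1 = ⁻¹-inverse μ>0

      ζ⁴>0 : 0# < ζ * ζ * (ζ * ζ)
      ζ⁴>0 = *-pos (*-pos ζ>0 ζ>0) (*-pos ζ>0 ζ>0)

      θζ⁴≈1 : θ * (ζ * ζ * (ζ * ζ)) ≈ 1#
      θζ⁴≈1 = trans (*-comm _ _) (⁻¹-inverse ζ⁴>0)

      ƛ>0 : 0# < ƛ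
      ƛ>0 = *-pos len>0 u>0

      4μ>0 : 0# < fromℕ 4 * μ
      4μ>0 = lin 1 (λ μ → c 0 :< μ ∷ [] ⊢ c 0 :< c 4 :* μ) μ μ>0

      -- The half-width of the grid exceeds `ƛ`, so for Ψ ≤ ε these bounds yield `wide` and `wide²`,
      -- by which no vector is short on the whole grid.
      small-ε : ∃[ ε ] 0# < ε × ε ≤ 1# × fromℕ 4 * (μ * ε) ≤ ƛ × fromℕ 4 * (μ * ε) ≤ ƛ * ƛ
      small-ε with minimum 0<1 (*-pos ƛ>0 (⁻¹-pos 4μ>0))
      ... | ε₁ , ε₁>0 , ε₁≤1 , ε₁≤ with minimum ε₁>0 (*-pos (*-pos ƛ>0 ƛ>0) (⁻¹-pos 4μ>0))
      ...   | ε , ε>0 , ε≤ε₁ , ε≤ = ε , ε>0 , ≤-trans ε≤ε₁ ε₁≤1 , scale (≤-trans ε≤ε₁ ε₁≤) , scale ε≤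
        where
        scale : ∀ {b} → ε ≤ b * (fromℕ 4 * μ) ⁻¹ → fromℕ 4 * (μ * ε) ≤ b
        scale {b} p = lin 4 (λ e b m r → e :≤ b :* r ∷ c 4 :* m :* r :≈ one ∷ c 0 :< m ∷ [] ⊢ c 4 :* (m :* e) :≤ b
          by # 0 ⊠ # 2 ∷ b ⊡ # 1 ∷ []) ε b μ ((fromℕ 4 * μ) ⁻¹) p (⁻¹-inverse 4μ>0) μ>0

      -- This is κ ζ⁴ / 64; once 1 / (Q Ψ) is below it, K₁ = 64 z θ is at most κ = 1 / μ.
      ε₂ : ℝ
      ε₂ = κ * (ζ * ζ * (ζ * ζ)) * (w * w * w)

      ε₂>0 : 0# < ε₂
      ε₂>0 = *-pos (*-pos (⁻¹-pos μ>0) ζ⁴>0) (*-pos (*-pos w>0 w>0) w>0)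

      θ>0 : 0# < θ
      θ>0 = ⁻¹-pos ζ⁴>0

      64zθ≤κ : ∀ {z} → z < ε₂ → fromℕ 64 * (z * θ) ≤ κ
      64zθ≤κ {z} z< = lin 5 (λ z k y w θ → z :< k :* y :* (w :* w :* w) ∷ θ :* y :≈ one ∷ c 4 :* w :≈ one ∷ c 0 :< θ ∷ []
        ⊢ c 64 :* (z :* θ) :≤ k by # 0 ⊠ # 3 ∷ k :* c 64 :* w :* w :* w ⊡ # 1 ∷ k :* c 16 :* w :* w ⊡ # 2 ∷ k :* c 4 :* w ⊡ # 2 ∷ k ⊡ # 2 ∷ [])
        z κ (ζ * ζ * (ζ * ζ)) w θ z< θζ⁴≈1 4w≈1 θ>0

    ε : ℝ
    ε = proj₁ small-ε

    hypotheses : Hypotheses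
    hypotheses = record
      { μ = μ ; 1≤μ = 1≤μ ; ζ = ζ ; ζ>0 = ζ>0 ; ζ≤1 = ζ≤1 ; ζ-small = ζ-small ; D = D ; g = g ; g′ = g′ ; f = f ; flip = flip
      ; slope = slope ; taylor = taylor ; transfer = λ {x} {q} {p} → transfer {x} {q} {p} ; I = I ; isInterval = isInterval ; I⊆D = I⊆D
      ; len>0 = len>0 ; u = u ; w = w ; 8u≈1 = 8u≈1 ; 4w≈1 = 4w≈1 ; ε = ε
      ; ε>0 = proj₁ (proj₂ small-ε) ; ε≤1 = proj₁ (proj₂ (proj₂ small-ε)) ; 4με≤λ = proj₁ (proj₂ (proj₂ (proj₂ small-ε)))
      ; 4με≤λλ = proj₂ (proj₂ (proj₂ (proj₂ small-ε))) ; κ = κ ; μκ≈1 = μκ≈1 ; θ = θ ; θζ⁴≈1 = θζ⁴≈1 }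

    conclusion : Conclusion f I isInterval ψ
    conclusion = from (ψ→0 (proj₁ (proj₂ small-ε))) (1/tψ→0 ε₂>0)
      where
      from : (∃[ T ] 0# < T × (∀ {t} → T < t → ∣ (ψ ⟨$⟩ t) - 0# ∣ < ε)) →
             (∃[ T ] 0# < T × (∀ {t} → T < t → ∣ 1# ÷ (t * (ψ ⟨$⟩ t)) - 0# ∣ < ε₂)) → Conclusion f I isInterval ψ
      from (T₁ , T₁>0 , h₁) (T₂ , T₂>0 , h₂) =
        LowerBound.constant hypotheses , *-pos (*-pos (*-pos w>0 u>0) (*-pos ζ⁴>0 (*-pos ζ>0 ζ>0))) (*-pos (*-pos w>0 w>0) (*-pos w>0 w>0)) ,
        T₁ + T₂ , lin 2 (λ a b → c 0 :< a ∷ c 0 :< b ∷ [] ⊢ c 0 :< a :+ b) T₁ T₂ T₁>0 T₂>0 , at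
        where
        at : (Q : ℝ) → T₁ + T₂ < Q → ∃[ n ] (N[ f , Q , ψ , I ]≔ n) × LowerBound.constant hypotheses * (Q * Q) * (ψ ⟨$⟩ Q) * len ≤ fromℕ n
        at Q T<Q = LowerBound.result hypotheses Q Ψ z Q>0 Ψ>0 z≈ z>0 Ψ≤ε (64zθ≤κ z<ε₂) ψ ≡.refl
          where
          Ψ z : ℝ
          Ψ = ψ ⟨$⟩ Q
          z = 1# ÷ (Q * Ψ)
          Q>0 : 0# < Q
          Q>0 = lin 3 (λ a b q → c 0 :< a ∷ c 0 :< b ∷ a :+ b :< q ∷ [] ⊢ c 0 :< q) T₁ T₂ Q T₁>0 T₂>0 T<Q
          Ψ>0 : 0# < Ψ
          Ψ>0 = IsApproximatingFunction.positive approximating Q>0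
          z≈ : z * (Q * Ψ) ≈ 1#
          z≈ = ÷-* 1# (*-pos Q>0 Ψ>0)
          z>0 : 0# < z
          z>0 = *-pos 0<1 (⁻¹-pos (*-pos Q>0 Ψ>0))
          Ψ≤ε : Ψ ≤ ε
          Ψ≤ε = lin 2 (λ y e → y :- c 0 :< e ∷ [] ⊢ y :≤ e) Ψ ε
            (proj₁ (∣∣<-elim (h₁ (lin 3 (λ a b q → c 0 :< b ∷ a :+ b :< q ∷ [] ⊢ a :< q) T₁ T₂ Q T₂>0 T<Q))))
          z<ε₂ : z < ε₂
          z<ε₂ = lin 2 (λ y e → y :- c 0 :< e ∷ [] ⊢ y :< e) z ε₂
            (proj₁ (∣∣<-elim (h₂ (lin 3 (λ a b q → c 0 :< a ∷ a :+ b :< q ∷ [] ⊢ b :< q) T₁ T₂ Q T₁>0 T<Q))))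

  negate-transfer : ∀ f {x q p b} → (negate f ⟨$⟩ x) - fromℚ (p / suc q) ∥ b → (f ⟨$⟩ x) - fromℚ (ℤ.- p / suc q) ∥ b
  negate-transfer f {x} {q} {p} b = ∥-resp
    (lin 3 (λ F y y′ → y′ :≈ :- y ∷ [] ⊢ :- (:- F :- y) :≈ F :- y′) (f ⟨$⟩ x) (fromℚ (p / suc q)) (fromℚ (ℤ.- p / suc q)) neg)
    (∥-neg b)
    where
    neg : fromℚ (ℤ.- p / suc q) ≈ - fromℚ (p / suc q)
    neg = lin 4 (λ y y′ Q P → y :* Q :≈ P ∷ y′ :* Q :≈ :- P ∷ c 0 :< Q ∷ [] ⊢ y′ :≈ :- y by ¬g ⊠ # 2 ∷ [])
      (fromℚ (p / suc q)) (fromℚ (ℤ.- p / suc q)) (fromℕ (suc q)) (fromℤ p) (fromℚ-/ p q)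
      (trans (fromℚ-/ (ℤ.- p) q) (fromℤ-neg p)) (0<fromℕ-suc q)

  theorem : (a₀ b₀ : ℝ) → a₀ < b₀ →
    (f : Function) (fC³ : C³ ⟨ a₀ , b₀ ⟩ f) →
    (m M : ℝ) →
    IsInfimum  (Image ⟨ a₀ , b₀ ⟩ (λ x → ∣ C³.f″ fC³ ⟨$⟩ x ∣)) m →
    IsSupremum (Image ⟨ a₀ , b₀ ⟩ (λ x → ∣ C³.f″ fC³ ⟨$⟩ x ∣)) M →
    0# < m → m ≤ M →
    (I : Pred ℝ 0ℓ) (isInterval : IsInterval I) → I ⊆ ⟨ a₀ , b₀ ⟩ →
    (ψ : Function) → IsApproximatingFunction ψ →
    TendsToAt+∞ (λ t → ψ ⟨$⟩ t) 0# →
    TendsToAt+∞ (λ t → 1# ÷ (t * (ψ ⟨$⟩ t))) 0# → Conclusion f I isInterval ψ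
  theorem a₀ b₀ a₀<b₀ f fC³ m M (lower , _) (upper , _) m>0 m≤M I isInterval I⊆D ψ approximating ψ→0 1/tψ→0 =
    by-length (IsInterval.left≤right isInterval)
    where
    open C³ fC³
    open Growth a₀ b₀

    m≤∣f″∣ : ∀ {t} → D t → m ≤ ∣ f″ ⟨$⟩ t ∣
    m≤∣f″∣ {t} Dt = lower (t , Dt , refl)

    ∣f″∣≤M : ∀ {t} → D t → ∣ f″ ⟨$⟩ t ∣ ≤ M
    ∣f″∣≤M {t} Dt = upper (t , Dt , refl)

    μ : ℝ
    -- The three summands provide `1≤μ`, `M≤μ` and `2≤μm`.
    μ = 1# + M + (1# + 1#) ÷ m

    2/m>0 : 0# < (1# + 1#) ÷ m
    2/m>0 = *-pos (lin 0 ([] ⊢ c 0 :< one :+ one)) (⁻¹-pos m>0)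

    1≤μ : 1# ≤ μ
    1≤μ = lin 3 (λ m M d → c 0 :< m ∷ m :≤ M ∷ c 0 :< d ∷ [] ⊢ one :≤ one :+ M :+ d) m M ((1# + 1#) ÷ m) m>0 m≤M 2/m>0

    M≤μ : M ≤ μ
    M≤μ = lin 2 (λ M d → c 0 :< d ∷ [] ⊢ M :≤ one :+ M :+ d) M ((1# + 1#) ÷ m) 2/m>0

    2≤μm : 1# + 1# ≤ μ * m
    2≤μm = lin 3 (λ m M d → c 0 :< m ∷ m :≤ M ∷ d :* m :≈ one :+ one ∷ [] ⊢ one :+ one :≤ (one :+ M :+ d) :* m by # 0 ⊠ # 0 ∷ # 0 ⊠ # 1 ∷ [])
             m M ((1# + 1#) ÷ m) m>0 m≤M (÷-* (1# + 1#) m>0)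

    middle : D (half (a₀ + b₀))
    middle = lin 3 (λ a b h → a :< b ∷ h :+ h :≈ a :+ b ∷ [] ⊢ a :< h) a₀ b₀ _ a₀<b₀ (half+half (a₀ + b₀))
           , lin 3 (λ a b h → a :< b ∷ h :+ h :≈ a :+ b ∷ [] ⊢ h :< b) a₀ b₀ _ a₀<b₀ (half+half (a₀ + b₀))

    positive : (∀ {t} → D t → m ≤ f″ ⟨$⟩ t) → 0# < IsInterval.len isInterval → Conclusion f I isInterval ψ
    positive m≤ len>0 = Convexity.conclusion μ 1≤μ D f f′ V.slope V.taylor f (λ p → p) (λ b → b) I isInterval I⊆D len>0 ψ approximating ψ→0 1/tψ→0
      where
      bounds : ∀ {t} → D t → m ≤ f″ ⟨$⟩ t × f″ ⟨$⟩ t ≤ M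
      bounds {t} Dt = m≤ Dt , [ (λ (_ , e) → ≤-trans (≈⇒≤ (sym e)) (∣f″∣≤M Dt))
                              , (λ (neg , _) → lin 3 (λ y m M → y :< c 0 ∷ c 0 :< m ∷ m :≤ M ∷ [] ⊢ y :≤ M) (f″ ⟨$⟩ t) m M neg m>0 m≤M) ]′ (∣∣-cases (f″ ⟨$⟩ t))
      module V = Convex {f} {f′} {f″} f′-derivative f″-derivative m>0 bounds μ 1≤μ 2≤μm M≤μ

    negative : (∀ {t} → D t → f″ ⟨$⟩ t ≤ - m) → 0# < IsInterval.len isInterval → Conclusion f I isInterval ψ
    negative ≤-m len>0 = Convexity.conclusion μ 1≤μ D (negate f) (negate f′) V.slope V.taylor f (λ p → ℤ.- p)
        (λ {x} {q} {p} b → negate-transfer f {x} {q} {p} b) I isInterval I⊆D len>0 ψ approximating ψ→0 1/tψ→0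
      where
      bounds : ∀ {t} → D t → m ≤ negate f″ ⟨$⟩ t × negate f″ ⟨$⟩ t ≤ M
      bounds {t} Dt = lin 2 (λ y m → y :≤ :- m ∷ [] ⊢ m :≤ :- y) (f″ ⟨$⟩ t) m (≤-m Dt)
                    , [ (λ (pos , _) → lin 3 (λ y m M → c 0 :≤ y ∷ c 0 :< m ∷ m :≤ M ∷ [] ⊢ :- y :≤ M) (f″ ⟨$⟩ t) m M pos m>0 m≤M)
                      , (λ (_ , e) → ≤-trans (≈⇒≤ (sym e)) (∣f″∣≤M Dt)) ]′ (∣∣-cases (f″ ⟨$⟩ t))
      module V = Convex {negate f} {negate f′} {negate f″} (negate-derivative {f = f} {g = f′} f′-derivative)
        (negate-derivative {f = f′} {g = f″} f″-derivative) m>0 bounds μ 1≤μ 2≤μm M≤μ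

    by-length : IsInterval.left isInterval ≤ IsInterval.right isInterval → Conclusion f I isInterval ψ
    by-length (inj₂ l≈r) = degenerate f isInterval ψ (lin 2 (λ l r → l :≈ r ∷ [] ⊢ r :- l :≈ c 0) _ _ l≈r)
    by-length (inj₁ l<r) = by-sign (ConstantSign.one-signed {f″} {f‴} f‴-derivative m>0 m≤∣f″∣ middle)
      where
      len>0 : 0# < IsInterval.len isInterval
      len>0 = lin 2 (λ l r → l :< r ∷ [] ⊢ c 0 :< r :- l) _ _ l<r
      by-sign : (∀ {t} → D t → m ≤ f″ ⟨$⟩ t) ⊎ (∀ {t} → D t → f″ ⟨$⟩ t ≤ - m) → Conclusion f I isInterval ψ
      by-sign (inj₁ p) = positive p len>0
      by-sign (inj₂ p) = negative p len>0

theorem6 : ExcludedMiddle 0ℓ →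
    (R : CompleteOrderedField) → let open RealAnalysis R in
    (a₀ b₀ : ℝ) → a₀ < b₀ →
    (f : Function) (fC³ : C³ ⟨ a₀ , b₀ ⟩ f) →
    (m M : ℝ) →
    IsInfimum  (Image ⟨ a₀ , b₀ ⟩ (λ x → ∣ C³.f″ fC³ ⟨$⟩ x ∣)) m →
    IsSupremum (Image ⟨ a₀ , b₀ ⟩ (λ x → ∣ C³.f″ fC³ ⟨$⟩ x ∣)) M →
    0# < m → m ≤ M →
    (I : Pred ℝ 0ℓ) (isInterval : IsInterval I) → I ⊆ ⟨ a₀ , b₀ ⟩ →
    (ψ : Function) → IsApproximatingFunction ψ →
    TendsToAt+∞ (λ t → ψ ⟨$⟩ t) 0# →
    TendsToAt+∞ (λ t → 1# ÷ (t * (ψ ⟨$⟩ t))) 0# →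
    ∃[ c ] 0# < c ×
    (∃[ Q₀ ] 0# < Q₀ ×
    ((Q : ℝ) → Q₀ < Q →
    ∃[ n ] (N[ f , Q , ψ , I ]≔ n) ×
    c * (Q * Q) * (ψ ⟨$⟩ Q) * IsInterval.len isInterval ≤ fromℕ n))
theorem6 em R = Main.theorem em R
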